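{- Let $\Gamma=(X,\mathcal E)$ be the complete graph $K_4$ (the distance-regular graph with $4$ vertices and intersection array $\{3;1\}$); the spectrum of its adjacency matrix $A$ is $3^1(-1)^3$. Let $x\in X$, $T=T(x)$, and fix any ordering of the three vertices of $\Gamma_1(x)$. Then the standard module $V=\mathbb C^X$ is an orthogonal direct sum of irreducible $T$-modules $V=W_0\oplus W_{1,a}\oplus W_{1,b}$, where two summands are isomorphic if and only if they have the same type in the following list, and the data are as listed. Each listed basis is a pure basis of the module. For each summand other than $W_0$, the seed vector $\nu$ spans $E_r^*W$ (so $\dim E_r^*W=1$), where $r$ is the endpoint of the summand $W$, and is given by its essential part. Type I ($W_0$): endpoint 0, multiplicity 1, dimension 2, diameter 1, shape $(1,1)$; basis $e_0^*,e_1^*$; matrix representing $A$: $\begin{pmatrix}0&3\\1&2\end{pmatrix}$, with eigenvalues $3,-1$. Type II ($W_{1,a},W_{1,b}$): endpoint 1, multiplicity 2, dimension 1, diameter 0, shape $(1)$; basis $\nu$, where $\nu=[1,-1,0]$ for $W_{1,a}$ and $\nu=[1,1,-2]$ for $W_{1,b}$; matrix representing $A$: $\begin{pmatrix}-1\end{pmatrix}$, with eigenvalue $-1$. Moreover $\dim T=2^2+1^2=5$.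
   Context: Let $\Gamma=(X,\mathcal E)$ be a finite undirected connected graph without loops or multiple edges, with path-length distance $d$ and diameter $D\ge1$; put $\Gamma_i(x)=\{y\in X:d(x,y)=i\}$. $\Gamma$ is distance-regular if for all $0\le h,i,j\le D$ the number $p^h_{i,j}=|\Gamma_i(y)\cap\Gamma_j(z)|$ is the same for all $y,z\in X$ with $d(y,z)=h$. Its intersection array is $\{b_0,\dots,b_{D-1};c_1,\dots,c_D\}$ with $b_i=p^i_{1,i+1}$, $c_i=p^i_{1,i-1}$. $A\in\mathrm{Mat}_X(\mathbb C)$ is the adjacency matrix; in its spectrum, exponents denote multiplicities. The standard module $V=\mathbb C^X$ (column vectors) carries the Hermitian inner product $\langle u,v\rangle=u^t\bar v$. Fix a base vertex $x\in X$. For $0\le i\le D$, $E_i^*=E_i^*(x)$ is the diagonal matrix with $(y,y)$-entry $1$ if $d(x,y)=i$ and $0$ otherwise, and $e_i^*\in V$ is the vector with $y$-entry $1$ if $d(x,y)=i$ and $0$ otherwise. The Terwilliger algebra $T=T(x)$ is the subalgebra of $\mathrm{Mat}_X(\mathbb C)$ generated by $A$ and $E_0^*,\dots,E_D^*$. A $T$-module is a subspace $W\subseteq V$ with $BW\subseteq W$ for all $B\in T$; it is irreducible if $W\ne0$ and it properly contains no nonzero $T$-module. Isomorphisms of $T$-modules are vector space isomorphisms commuting with every $B\in T$. The endpoint of $W$ is $r=\min\{i:E_i^*W\ne0\}$; the diameter of an irreducible $W$ is $\delta=|\{i:E_i^*W\ne0\}|-1$, and its shape is $(\dim E_r^*W,\dots,\dim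 E_{r+\delta}^*W)$. The multiplicity of an irreducible module is the number of summands isomorphic to it in an orthogonal decomposition of $V$ into irreducible $T$-modules. A nonzero vector is pure with support $i$ if it lies in $E_i^*V$; its essential part is the row vector of its coordinates at the vertices of $\Gamma_i(x)$ (all its other coordinates are $0$). A pure basis of an irreducible $T$-module is an ordered basis of pure vectors with weakly increasing supports. The matrix $B$ representing $A$ with respect to a basis $v_1,\dots,v_\ell$ is given by $Av_j=\sum_iB_{ij}v_i$. -}

module Defs where

open import Algebra.Bundles using (RawMonoid)
import Algebra.Definitions.RawMonoid as RawMonoidDefs
open import Algebra.Module.Bundles.Raw using (RawLeftModule)
open import Algebra.Module.Morphism.Structures using (module LeftModuleMorphisms)
open import Data.Bool.Base using (if_then_else_)
open import Data.Empty using (⊥-elim)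
open import Data.Fin.Base as Fin using (Fin; toℕ)
import Data.Fin.Properties as Fin
open import Data.Fin.Subset using (Subset; ∣_∣; _∩_) renaming (_∈_ to _∈ₛ_)
open import Data.Integer.Base as ℤ using (ℤ)
open import Data.List.Base using (List)
open import Data.List.Relation.Unary.All using (All)
open import Data.List.Relation.Unary.AllPairs using (AllPairs)
open import Data.List.Relation.Unary.Any using (Any)
open import Data.Nat.Base as ℕ using (ℕ; zero; suc)
import Data.Nat.Properties as ℕ
open import Data.Product.Base using (Σ; ∃; ∃-syntax; _×_; _,_; proj₁; proj₂; curry)
open import Data.Rational.Base as ℚ using (ℚ; 0ℚ; 1ℚ)
import Data.Rational.Properties as ℚ
open import Data.Rational.Solver using (module +-*-Solver)
open import Data.Sum.Base using (_⊎_)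
open import Data.Unit.Base using (⊤)
open import Data.Vec.Base as Vec using (Vec)
open import Data.Vec.Functional using (Vector; _∷_; [])
open import Function.Bundles using (_⇔_; _⤖_; Bijection)
open import Relation.Binary.PropositionalEquality
  using (_≡_; _≢_; refl; sym; trans; cong; cong₂; subst; ≢-sym)
open import Relation.Nullary using (¬_; Dec; yes; no; does; ¬?)

------------------------------------------------------------------------
-- The real numbers: rational Cauchy sequences with a setoid equality.

record ℝ : Set where
  field
    seq    : ℕ → ℚ
    cauchy : ∀ ε → 0ℚ ℚ.< ε → ∃[ N ] ∀ m n → N ℕ.≤ m → N ℕ.≤ n →
             ℚ.∣ seq m ℚ.- seq n ∣ ℚ.< ε

open ℝ

infix 4 _≈ᵣ_ _#ᵣ_

_≈ᵣ_ : ℝ → ℝ → Set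
x ≈ᵣ y = ∀ ε → 0ℚ ℚ.< ε → ∃[ N ] ∀ n → N ℕ.≤ n → ℚ.∣ seq x n ℚ.- seq y n ∣ ℚ.< ε

-- Apartness, the constructive (and classically equivalent) form of ≢.
_#ᵣ_ : ℝ → ℝ → Set
x #ᵣ y = ∃[ ε ] (0ℚ ℚ.< ε × ∃[ N ] ∀ n → N ℕ.≤ n → ε ℚ.≤ ℚ.∣ seq x n ℚ.- seq y n ∣)

private
  half : ℚ → ℚ
  half ε = ℚ.½ ℚ.* ε

  half-pos : ∀ {ε} → 0ℚ ℚ.< ε → 0ℚ ℚ.< half ε
  half-pos {ε} 0<ε = ℚ.*-monoʳ-<-pos ℚ.½ 0<ε

  half+half : ∀ ε → half ε ℚ.+ half ε ≡ ε
  half+half ε = trans (sym (ℚ.*-distribʳ-+ ε ℚ.½ ℚ.½)) (ℚ.*-identityˡ ε)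

  eventuallyBounded : (x : ℝ) → ∃[ K ] (0ℚ ℚ.< K × ∃[ N ] ∀ n → N ℕ.≤ n → ℚ.∣ seq x n ∣ ℚ.≤ K)
  eventuallyBounded x with cauchy x 1ℚ (ℚ.positive⁻¹ 1ℚ)
  ... | N , close = K , 0<K , N , bound
    where
    K = 1ℚ ℚ.+ ℚ.∣ seq x N ∣
    0<K : 0ℚ ℚ.< K
    0<K = ℚ.+-mono-<-≤ (ℚ.positive⁻¹ 1ℚ) (ℚ.0≤∣p∣ (seq x N))
    bound : ∀ n → N ℕ.≤ n → ℚ.∣ seq x n ∣ ℚ.≤ K
    bound n N≤n = begin
      ℚ.∣ seq x n ∣                                  ≡⟨ cong ℚ.∣_∣ (split (seq x n) (seq x N)) ⟩
      ℚ.∣ (seq x n ℚ.- seq x N) ℚ.+ seq x N ∣        ≤⟨ ℚ.∣p+q∣≤∣p∣+∣q∣ (seq x n ℚ.- seq x N) (seq x N) ⟩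
      ℚ.∣ seq x n ℚ.- seq x N ∣ ℚ.+ ℚ.∣ seq x N ∣    ≤⟨ ℚ.+-monoˡ-≤ ℚ.∣ seq x N ∣ (ℚ.<⇒≤ (close n N N≤n ℕ.≤-refl)) ⟩
      K                                              ∎
      where
      open ℚ.≤-Reasoning
      open +-*-Solver
      split : ∀ p q → p ≡ (p ℚ.- q) ℚ.+ q
      split = solve 2 (λ p q → p := (p :- q) :+ q) refl

infixl 6 _+ᵣ_
infixl 7 _*ᵣ_
infix  8 -ᵣ_

_+ᵣ_ : ℝ → ℝ → ℝ
seq (x +ᵣ y) n = seq x n ℚ.+ seq y n
cauchy (x +ᵣ y) ε 0<ε
  with cauchy x (half ε) (half-pos 0<ε) | cauchy y (half ε) (half-pos 0<ε)
... | M , closeˣ | N , closeʸ = M ℕ.⊔ N , close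
  where
  close : ∀ m n → M ℕ.⊔ N ℕ.≤ m → M ℕ.⊔ N ℕ.≤ n →
          ℚ.∣ (seq x m ℚ.+ seq y m) ℚ.- (seq x n ℚ.+ seq y n) ∣ ℚ.< ε
  close m n h k = begin-strict
    ℚ.∣ (a ℚ.+ b) ℚ.- (c ℚ.+ d) ∣          ≡⟨ cong ℚ.∣_∣ (regroup a b c d) ⟩
    ℚ.∣ (a ℚ.- c) ℚ.+ (b ℚ.- d) ∣          ≤⟨ ℚ.∣p+q∣≤∣p∣+∣q∣ (a ℚ.- c) (b ℚ.- d) ⟩
    ℚ.∣ a ℚ.- c ∣ ℚ.+ ℚ.∣ b ℚ.- d ∣        <⟨ ℚ.+-mono-< (closeˣ m n (ℕ.m⊔n≤o⇒m≤o M N h) (ℕ.m⊔n≤o⇒m≤o M N k))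
                                                       (closeʸ m n (ℕ.m⊔n≤o⇒n≤o M N h) (ℕ.m⊔n≤o⇒n≤o M N k)) ⟩
    half ε ℚ.+ half ε                      ≡⟨ half+half ε ⟩
    ε                                      ∎
    where
    open ℚ.≤-Reasoning
    open +-*-Solver
    a = seq x m
    b = seq y m
    c = seq x n
    d = seq y n
    regroup : ∀ a b c d → (a ℚ.+ b) ℚ.- (c ℚ.+ d) ≡ (a ℚ.- c) ℚ.+ (b ℚ.- d)
    regroup = solve 4 (λ a b c d → (a :+ b) :- (c :+ d) := (a :- c) :+ (b :- d)) refl

-ᵣ_ : ℝ → ℝ
seq (-ᵣ x) n = ℚ.- seq x n
cauchy (-ᵣ x) ε 0<ε with cauchy x ε 0<ε
... | N , close = N , λ m n h k → subst (ℚ._< ε) (flip-sign (seq x m) (seq x n)) (close m n h k)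
  where
  open +-*-Solver
  flip-sign : ∀ a b → ℚ.∣ a ℚ.- b ∣ ≡ ℚ.∣ ℚ.- a ℚ.- ℚ.- b ∣
  flip-sign a b = trans (sym (ℚ.∣-p∣≡∣p∣ (a ℚ.- b)))
    (cong ℚ.∣_∣ (solve 2 (λ a b → :- (a :- b) := :- a :- :- b) refl a b))

_*ᵣ_ : ℝ → ℝ → ℝ
seq (x *ᵣ y) n = seq x n ℚ.* seq y n
cauchy (x *ᵣ y) ε 0<ε = M₁ ℕ.⊔ M₂ ℕ.⊔ (N₁ ℕ.⊔ N₂) , close
  where
  bˣ = eventuallyBounded x
  bʸ = eventuallyBounded y
  Kˣ = proj₁ bˣ
  Kʸ = proj₁ bʸ
  K  = Kˣ ℚ.+ Kʸ
  0<K : 0ℚ ℚ.< K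
  0<K = ℚ.+-mono-< (proj₁ (proj₂ bˣ)) (proj₁ (proj₂ bʸ))
  instance
    posK : ℚ.Positive K
    posK = ℚ.positive 0<K
    nzK : ℚ.NonZero K
    nzK = ℚ.pos⇒nonZero K
    nnKˣ : ℚ.NonNegative Kˣ
    nnKˣ = ℚ.nonNegative (ℚ.<⇒≤ (proj₁ (proj₂ bˣ)))
    nnKʸ : ℚ.NonNegative Kʸ
    nnKʸ = ℚ.nonNegative (ℚ.<⇒≤ (proj₁ (proj₂ bʸ)))
    pos1/K : ℚ.Positive (ℚ.1/ K)
    pos1/K = ℚ.1/pos⇒pos K
  δ = ℚ.1/ K ℚ.* ε
  0<δ : 0ℚ ℚ.< δ
  0<δ = subst (ℚ._< δ) (ℚ.*-zeroʳ (ℚ.1/ K)) (ℚ.*-monoʳ-<-pos (ℚ.1/ K) 0<ε)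
  Kδ≡ε : K ℚ.* δ ≡ ε
  Kδ≡ε = trans (sym (ℚ.*-assoc K (ℚ.1/ K) ε))
           (trans (cong (ℚ._* ε) (ℚ.*-inverseʳ K)) (ℚ.*-identityˡ ε))
  cˣ = cauchy x δ 0<δ
  cʸ = cauchy y δ 0<δ
  M₁ = proj₁ cˣ
  M₂ = proj₁ cʸ
  N₁ = proj₁ (proj₂ (proj₂ bˣ))
  N₂ = proj₁ (proj₂ (proj₂ bʸ))
  close : ∀ m n → M₁ ℕ.⊔ M₂ ℕ.⊔ (N₁ ℕ.⊔ N₂) ℕ.≤ m → M₁ ℕ.⊔ M₂ ℕ.⊔ (N₁ ℕ.⊔ N₂) ℕ.≤ n →
          ℚ.∣ seq x m ℚ.* seq y m ℚ.- seq x n ℚ.* seq y n ∣ ℚ.< ε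
  close m n h k = begin-strict
    ℚ.∣ a ℚ.* b ℚ.- c ℚ.* d ∣                                  ≡⟨ cong ℚ.∣_∣ (regroup a b c d) ⟩
    ℚ.∣ a ℚ.* (b ℚ.- d) ℚ.+ d ℚ.* (a ℚ.- c) ∣                  ≤⟨ ℚ.∣p+q∣≤∣p∣+∣q∣ (a ℚ.* (b ℚ.- d)) (d ℚ.* (a ℚ.- c)) ⟩
    ℚ.∣ a ℚ.* (b ℚ.- d) ∣ ℚ.+ ℚ.∣ d ℚ.* (a ℚ.- c) ∣            ≡⟨ cong₂ ℚ._+_ (ℚ.∣p*q∣≡∣p∣*∣q∣ a (b ℚ.- d)) (ℚ.∣p*q∣≡∣p∣*∣q∣ d (a ℚ.- c)) ⟩
    ℚ.∣ a ∣ ℚ.* ℚ.∣ b ℚ.- d ∣ ℚ.+ ℚ.∣ d ∣ ℚ.* ℚ.∣ a ℚ.- c ∣    ≤⟨ ℚ.+-mono-≤ (ℚ.*-monoʳ-≤-nonNeg ℚ.∣ b ℚ.- d ∣ {{ℚ.nonNegative (ℚ.0≤∣p∣ (b ℚ.- d))}} a≤)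
                                                                            (ℚ.*-monoʳ-≤-nonNeg ℚ.∣ a ℚ.- c ∣ {{ℚ.nonNegative (ℚ.0≤∣p∣ (a ℚ.- c))}} d≤) ⟩
    Kˣ ℚ.* ℚ.∣ b ℚ.- d ∣ ℚ.+ Kʸ ℚ.* ℚ.∣ a ℚ.- c ∣              <⟨ ℚ.+-mono-≤-< (ℚ.*-monoˡ-≤-nonNeg Kˣ (ℚ.<⇒≤ b-d<))
                                                                              (ℚ.*-monoʳ-<-pos Kʸ {{ℚ.positive (proj₁ (proj₂ bʸ))}} a-c<) ⟩
    Kˣ ℚ.* δ ℚ.+ Kʸ ℚ.* δ                                      ≡⟨ sym (ℚ.*-distribʳ-+ δ Kˣ Kʸ) ⟩
    K ℚ.* δ                                                    ≡⟨ Kδ≡ε ⟩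
    ε                                                          ∎
    where
    open ℚ.≤-Reasoning
    open +-*-Solver
    a = seq x m
    b = seq y m
    c = seq x n
    d = seq y n
    M≤ : ∀ {o} → M₁ ℕ.⊔ M₂ ℕ.⊔ (N₁ ℕ.⊔ N₂) ℕ.≤ o → M₁ ℕ.⊔ M₂ ℕ.≤ o
    M≤ = ℕ.m⊔n≤o⇒m≤o (M₁ ℕ.⊔ M₂) (N₁ ℕ.⊔ N₂)
    N≤ : ∀ {o} → M₁ ℕ.⊔ M₂ ℕ.⊔ (N₁ ℕ.⊔ N₂) ℕ.≤ o → N₁ ℕ.⊔ N₂ ℕ.≤ o
    N≤ = ℕ.m⊔n≤o⇒n≤o (M₁ ℕ.⊔ M₂) (N₁ ℕ.⊔ N₂)
    a-c< = proj₂ cˣ m n (ℕ.m⊔n≤o⇒m≤o M₁ M₂ (M≤ h)) (ℕ.m⊔n≤o⇒m≤o M₁ M₂ (M≤ k))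
    b-d< = proj₂ cʸ m n (ℕ.m⊔n≤o⇒n≤o M₁ M₂ (M≤ h)) (ℕ.m⊔n≤o⇒n≤o M₁ M₂ (M≤ k))
    a≤ = proj₂ (proj₂ (proj₂ bˣ)) m (ℕ.m⊔n≤o⇒m≤o N₁ N₂ (N≤ h))
    d≤ = proj₂ (proj₂ (proj₂ bʸ)) n (ℕ.m⊔n≤o⇒n≤o N₁ N₂ (N≤ k))
    regroup : ∀ a b c d → a ℚ.* b ℚ.- c ℚ.* d ≡ a ℚ.* (b ℚ.- d) ℚ.+ d ℚ.* (a ℚ.- c)
    regroup = solve 4 (λ a b c d → a :* b :- c :* d := a :* (b :- d) :+ d :* (a :- c)) refl

constᵣ : ℚ → ℝ
seq (constᵣ q) _ = q
cauchy (constᵣ q) ε 0<ε = 0 , λ _ _ _ _ →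
  subst (ℚ._< ε) (cong ℚ.∣_∣ (sym (ℚ.+-inverseʳ q))) 0<ε

------------------------------------------------------------------------
-- The complex numbers.

record ℂ : Set where
  constructor _+i_
  field
    re im : ℝ

open ℂ

infix  4 _≈_ _#_
infixl 6 _+_
infixl 7 _*_

-- Opaque only so that type checking does not unfold real arithmetic.
opaque
  _≈_ : ℂ → ℂ → Set
  z ≈ w = re z ≈ᵣ re w × im z ≈ᵣ im w

  _#_ : ℂ → ℂ → Set
  z # w = re z #ᵣ re w ⊎ im z #ᵣ im w

  _+_ : ℂ → ℂ → ℂ
  z + w = (re z +ᵣ re w) +i (im z +ᵣ im w)

  _*_ : ℂ → ℂ → ℂ
  z * w = (re z *ᵣ re w +ᵣ -ᵣ (im z *ᵣ im w)) +i (re z *ᵣ im w +ᵣ im z *ᵣ re w)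

  conj : ℂ → ℂ
  conj z = re z +i (-ᵣ im z)

  fromℤ : ℤ → ℂ
  fromℤ k = constᵣ (k ℚ./ 1) +i constᵣ 0ℚ

fromℕ : ℕ → ℂ
fromℕ k = fromℤ (ℤ.+ k)

0# 1# -1# : ℂ
0#  = fromℕ 0
1#  = fromℕ 1
-1# = fromℤ ℤ.-1ℤ

+-rawMonoid : RawMonoid _ _
+-rawMonoid = record { Carrier = ℂ ; _≈_ = _≈_ ; _∙_ = _+_ ; ε = 0# }

open RawMonoidDefs +-rawMonoid using (sum)

------------------------------------------------------------------------
-- Linear algebra in ℂ^I.  Subsets of ℂ^I are predicates; dimensions and
-- bases are used only for predicates that are linear subspaces.

module _ {I : Set} where

  infix 4 _≋_

  _≋_ : (I → ℂ) → (I → ℂ) → Set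
  u ≋ v = ∀ i → u i ≈ v i

  -- v ≢ 0, in its constructive form.
  Nonzero : (I → ℂ) → Set
  Nonzero v = ∃[ i ] v i # 0#

  combine : ∀ {k} → Vector ℂ k → Vector (I → ℂ) k → (I → ℂ)
  combine a v i = sum λ j → a j * v j i

  LinearlyIndependent : ∀ {k} → Vector (I → ℂ) k → Set
  LinearlyIndependent v = ∀ a → combine a v ≋ (λ _ → 0#) → ∀ j → a j ≈ 0#

  Spans : ∀ {k} → Vector (I → ℂ) k → ((I → ℂ) → Set) → Set
  Spans v P = (∀ j → P (v j)) × (∀ u → P u → ∃[ a ] u ≋ combine a v)

  IsBasis : ∀ {k} → Vector (I → ℂ) k → ((I → ℂ) → Set) → Set
  IsBasis v P = Spans v P × LinearlyIndependent v

  HasDim : ((I → ℂ) → Set) → ℕ → Set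
  HasDim P k = ∃[ v ] IsBasis {k} v P

Mat : ℕ → Set
Mat n = Fin n → Fin n → ℂ

infixr 7 _·_

_·_ : ∀ {n} → Mat n → Vector ℂ n → Vector ℂ n
(M · v) y = sum λ z → M y z * v z

IsEigenvalue : ∀ {n} → Mat n → ℂ → Set
IsEigenvalue M θ = ∃[ v ] (Nonzero v × M · v ≋ λ y → θ * v y)

EigenvaluesAre : ∀ {n} → Mat n → List ℂ → Set
EigenvaluesAre M θs = ∀ θ → IsEigenvalue M θ ⇔ Any (θ ≈_) θs

-- Multiplicities are dimensions of eigenspaces; this is applied only to
-- adjacency matrices, which are real symmetric.
record HasSpectrum {n} (M : Mat n) (spec : List (ℂ × ℕ)) : Set where
  field
    distinct       : AllPairs (λ s t → proj₁ s # proj₁ t) spec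
    eigenvalues    : ∀ θ → IsEigenvalue M θ ⇔ Any (λ s → θ ≈ proj₁ s) spec
    multiplicities : All (λ s → HasDim (λ v → M · v ≋ λ y → proj₁ s * v y) (proj₂ s)) spec

------------------------------------------------------------------------
-- Connected graphs of diameter at least one, on the vertex set Fin n.

data Walk {n} (Adj : Fin n → Fin n → Set) : Fin n → Fin n → ℕ → Set where
  here : ∀ {y} → Walk Adj y y 0
  step : ∀ {y z w k} → Adj y z → Walk Adj z w k → Walk Adj y w (suc k)

record Graph (n : ℕ) : Set₁ where
  field
    Adj         : Fin n → Fin n → Set
    adj?        : ∀ y z → Dec (Adj y z)
    irreflexive : ∀ {y} → ¬ Adj y y
    symmetric   : ∀ {y z} → Adj y z → Adj z y
    -- dist is determined by the next two fields; its existence is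
    -- connectedness.
    dist        : Fin n → Fin n → ℕ
    geodesic    : ∀ y z → Walk Adj y z (dist y z)
    shortest    : ∀ {y z k} → Walk Adj y z k → dist y z ℕ.≤ k
    diam        : ℕ
    dist≤diam   : ∀ y z → dist y z ℕ.≤ diam
    attained    : ∃[ y ] ∃[ z ] dist y z ≡ diam
    diam≥1      : 1 ℕ.≤ diam

  sphere : ℕ → Fin n → Subset n
  sphere i y = Vec.tabulate λ z → does (dist y z ℕ.≟ i)

  adjacency : Mat n
  adjacency y z = if does (adj? y z) then 1# else 0#

open Graph

record _≅ᴳ_ {m n} (Γ : Graph m) (Δ : Graph n) : Set where
  field
    bijection : Fin m ⤖ Fin n
    preserves : ∀ y z → Adj Γ y z ⇔ Adj Δ (Bijection.to bijection y) (Bijection.to bijection z)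

record IsDistanceRegular {n} (Γ : Graph n) : Set where
  field
    p      : ℕ → ℕ → ℕ → ℕ
    p-card : ∀ h i j → h ℕ.≤ diam Γ → i ℕ.≤ diam Γ → j ℕ.≤ diam Γ →
             ∀ y z → dist Γ y z ≡ h → ∣ sphere Γ i y ∩ sphere Γ j z ∣ ≡ p h i j

-- Γ is distance-regular with intersection array {b₀,…,b_{D-1}; c₁,…,c_D}.
record HasIntersectionArray {n} (Γ : Graph n) {D} (b c : Vec ℕ D) : Set where
  field
    isDistanceRegular : IsDistanceRegular Γ
    diam≡D            : diam Γ ≡ D
  open IsDistanceRegular isDistanceRegular
  field
    b-entries : ∀ (i : Fin D) → Vec.lookup b i ≡ p (toℕ i) 1 (suc (toℕ i))
    c-entries : ∀ (i : Fin D) → Vec.lookup c i ≡ p (suc (toℕ i)) 1 (toℕ i)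

K₄ : Graph 4
K₄ = record
  { Adj         = _≢_
  ; adj?        = λ y z → ¬? (y Fin.≟ z)
  ; irreflexive = λ y≢y → y≢y refl
  ; symmetric   = ≢-sym
  ; dist        = d
  ; geodesic    = geo
  ; shortest    = short
  ; diam        = 1
  ; dist≤diam   = d≤1
  ; attained    = Fin.zero , Fin.suc Fin.zero , refl
  ; diam≥1      = ℕ.≤-refl
  }
  where
  d : Fin 4 → Fin 4 → ℕ
  d y z = if does (y Fin.≟ z) then 0 else 1

  geo : ∀ y z → Walk _≢_ y z (d y z)
  geo y z with y Fin.≟ z
  ... | yes refl = here
  ... | no  y≢z  = step y≢z here

  d≤1 : ∀ y z → d y z ℕ.≤ 1
  d≤1 y z with y Fin.≟ z
  ... | yes _ = ℕ.z≤n
  ... | no  _ = ℕ.≤-refl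

  short : ∀ {y z k} → Walk _≢_ y z k → d y z ℕ.≤ k
  short {y} here with y Fin.≟ y
  ... | yes _   = ℕ.z≤n
  ... | no  y≢y = ⊥-elim (y≢y refl)
  short {y} {z} (step _ _) = ℕ.≤-trans (d≤1 y z) (ℕ.s≤s ℕ.z≤n)

------------------------------------------------------------------------
-- The Terwilliger algebra of Γ with respect to x and its modules.

module Terwilliger {n} (Γ : Graph n) (x : Fin n) where

  V : Set
  V = Vector ℂ n

  A : Mat n
  A = adjacency Γ

  e* : ℕ → V
  e* i y = if does (dist Γ x y ℕ.≟ i) then 1# else 0#

  E* : ℕ → Mat n
  E* i y z = if does (y Fin.≟ z) then e* i y else 0#

  ⟨_,_⟩ : V → V → ℂ
  ⟨ u , v ⟩ = sum λ y → u y * conj (v y)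

  data T : Mat n → Set where
    A∈T    : T A
    E*∈T   : ∀ i → i ℕ.≤ diam Γ → T (E* i)
    one    : T (λ y z → if does (y Fin.≟ z) then 1# else 0#)
    add    : ∀ {B C} → T B → T C → T (λ y z → B y z + C y z)
    scale  : ∀ a {B} → T B → T (λ y z → a * B y z)
    mul    : ∀ {B C} → T B → T C → T (λ y z → sum λ w → B y w * C w z)
    resp   : ∀ {B C} → (∀ y z → B y z ≈ C y z) → T B → T C

  DimT : ℕ → Set
  DimT = HasDim {Fin n × Fin n} λ M → T (curry M)

  record TModule : Set₁ where
    field
      Mem      : V → Set
      ∈-resp   : ∀ {u v} → u ≋ v → Mem u → Mem v
      ∈-zero   : Mem (λ _ → 0#)
      ∈-add    : ∀ {u v} → Mem u → Mem v → Mem (λ y → u y + v y)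
      ∈-scale  : ∀ a {v} → Mem v → Mem (λ y → a * v y)
      T-closed : ∀ {B v} → T B → Mem v → Mem (B · v)

    act : ∀ {B} → T B → Σ V Mem → Σ V Mem
    act {B} B∈T (v , v∈W) = B · v , T-closed B∈T v∈W

    rawModule : RawLeftModule ℂ _ _
    rawModule = record
      { Carrierᴹ = Σ V Mem
      ; _≈ᴹ_     = λ u v → proj₁ u ≋ proj₁ v
      ; _+ᴹ_     = λ (u , u∈W) (v , v∈W) → (λ y → u y + v y) , ∈-add u∈W v∈W
      ; _*ₗ_     = λ a (v , v∈W) → (λ y → a * v y) , ∈-scale a v∈W
      ; 0ᴹ       = (λ _ → 0#) , ∈-zero
      ; -ᴹ_      = λ (v , v∈W) → (λ y → -1# * v y) , ∈-scale -1# v∈W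
      }

  open TModule

  NonzeroSpace : (V → Set) → Set
  NonzeroSpace P = ∃[ v ] (P v × Nonzero v)

  _⊆_ : TModule → TModule → Set
  U ⊆ W = ∀ v → Mem U v → Mem W v

  -- "No nonzero submodule is proper" in positive form.
  Irreducible : TModule → Set₁
  Irreducible W = NonzeroSpace (Mem W) × (∀ U → U ⊆ W → NonzeroSpace (Mem U) → W ⊆ U)

  record _≅_ (U W : TModule) : Set where
    field
      to          : Σ V (Mem U) → Σ V (Mem W)
      isLinearIso : LeftModuleMorphisms.IsLeftModuleIsomorphism (rawModule U) (rawModule W) to
      commutes    : ∀ {B} (B∈T : T B) u → proj₁ (to (act U B∈T u)) ≋ proj₁ (act W B∈T (to u))

  -- The subspace E*ᵢ P.
  E*[_] : ℕ → (V → Set) → (V → Set)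
  E*[ i ] P v = ∃[ w ] (P w × v ≋ E* i · w)

  record IsOrthogonalDirectSum {m} (W : Fin m → TModule) : Set where
    field
      orthogonal : ∀ i j → i ≢ j → ∀ u v → Mem (W i) u → Mem (W j) v → ⟨ u , v ⟩ ≈ 0#
      decompose  : ∀ v → Σ (Vector V m) λ w → (∀ i → Mem (W i) (w i)) × v ≋ λ y → sum λ i → w i y
      direct     : ∀ (w : Vector V m) → (∀ i → Mem (W i) (w i)) → (λ y → sum λ i → w i y) ≋ (λ _ → 0#) →
                   ∀ i → w i ≋ λ _ → 0#

  HasEndpoint : TModule → ℕ → Set
  HasEndpoint W r = NonzeroSpace (E*[ r ] (Mem W)) ×
                    (∀ i → NonzeroSpace (E*[ i ] (Mem W)) → r ℕ.≤ i)

  HasDiameter : TModule → ℕ → Set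
  HasDiameter W δ = Σ (Subset (suc (diam Γ))) λ S →
    (∀ i → (i ∈ₛ S) ⇔ NonzeroSpace (E*[ toℕ i ] (Mem W))) × ∣ S ∣ ≡ suc δ

  -- Relative to the endpoint r and diameter δ.
  HasShape : TModule → (r : ℕ) {δ : ℕ} → Vec ℕ (suc δ) → Set
  HasShape W r s = ∀ i → HasDim (E*[ r ℕ.+ toℕ i ] (Mem W)) (Vec.lookup s i)

  -- The count is required to be the same for every decomposition.
  HasMultiplicity : TModule → ℕ → Set₁
  HasMultiplicity W k = ∀ {m} (U : Fin m → TModule) → (∀ i → Irreducible (U i)) →
    IsOrthogonalDirectSum U →
    Σ (Subset m) λ S → (∀ i → (i ∈ₛ S) ⇔ (U i ≅ W)) × ∣ S ∣ ≡ k

  Pure : V → ℕ → Set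
  Pure v i = Nonzero v × E*[ i ] (λ _ → ⊤) v

  IsPureBasis : ∀ {ℓ} → Vector V ℓ → TModule → Set
  IsPureBasis {ℓ} v W = IsBasis v (Mem W) ×
    Σ (Fin ℓ → ℕ) λ s → (∀ j → Pure (v j) (s j)) × (∀ j k → j Fin.≤ k → s j ℕ.≤ s k)

  Represents : ∀ {ℓ} → Mat ℓ → Mat n → Vector V ℓ → Set
  Represents B M v = ∀ j → M · v j ≋ combine (λ i → B i j) v

  -- An ordering of Γᵢ(x), listing its k vertices.
  Ordering : ℕ → ℕ → Set
  Ordering i k = Fin k ⤖ (∃[ y ] dist Γ x y ≡ i)

  HasEssentialPart : ∀ {i k} → Ordering i k → V → Vector ℂ k → Set
  HasEssentialPart {i} o v a = Pure v i × (∀ j → v (proj₁ (Bijection.to o j)) ≈ a j)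

  record ModuleData (W : TModule) (r mult dim δ : ℕ) (shape : Vec ℕ (suc δ))
                    (basis : Vector V dim) (B : Mat dim) (θs : List ℂ) : Set₁ where
    field
      irreducible  : Irreducible W
      endpoint     : HasEndpoint W r
      multiplicity : HasMultiplicity W mult
      dimension    : HasDim (Mem W) dim
      diameter     : HasDiameter W δ
      hasShape     : HasShape W r shape
      pureBasis    : IsPureBasis basis W
      represents   : Represents B A basis
      eigenvalues  : EigenvaluesAre B θs

  IsSeed : V → ℕ → TModule → Set
  IsSeed ν r W = Spans (ν ∷ []) (E*[ r ] (Mem W)) × HasDim (E*[ r ] (Mem W)) 1

data Type : Set where
  I II : Type

-- In K₄ the adjacency matrix is A = J − I, with J the all-ones matrix, so T is generated by J and the
-- projections onto the coordinate x and onto Γ₁(x).  Subtracting from a vector its coordinate at x and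
-- its mean over Γ₁(x) leaves a vector supported on Γ₁(x) with coordinate sum 0, and T acts on all such
-- vectors, those of type II, by one character.  If a submodule contains a nonzero vector, then one of
-- these three parts is apart from 0 and T extracts it; hence every irreducible submodule is either W₀ or
-- a line of type II, and any two such lines are isomorphic.
-- In an arbitrary decomposition into irreducibles, the traces of the projections onto the summands
-- give 4 = Σ dim, and their diagonal entries at x sum to 1, which leaves exactly one W₀ and two lines.
-- Finally, an element of T is determined by its action on W₀ and its character, whence dim T = 2² + 1².

module Submission where

-- Equality of complex numbers is not decidable here, so no step may ask whether a coordinate
-- vanishes. A nonzero vector carries a coordinate apart from 0, and a choice is possible only
-- through the fact that a sum apart from 0 has a summand apart from 0. This shapes the
-- classification: a vector is written as an explicit sum, and the term found apart from 0 settles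
-- the type. Irreducibility is likewise used positively: a nonzero submodule, once exhibited, is the
-- whole module. Multiplicities are claimed for every decomposition into irreducibles, so no basis
-- adapted to the given summands can be fixed in advance. Traces avoid any exchange argument between
-- bases: they yield an equation between natural numbers inside ℂ, and `fromℤ-injective` brings it
-- back to ℕ. The entry at `x` isolates W₀ because e*₀ is the unit vector at `x`, lies in W₀, and
-- every vector of type II vanishes at `x`.

open import Algebra.Bundles using (CommutativeRing)
open import Algebra.Module.Morphism.Structures using (module LeftModuleMorphisms)
import Algebra.Properties.Semiring.Sum as Sums
import Algebra.Solver.Ring as RingSolver
open import Algebra.Solver.Ring.AlmostCommutativeRing
  using (fromCommutativeRing; _-Raw-AlmostCommutative⟶_)
open import Data.Bool.Base using (Bool; true; false; not; if_then_else_)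
open import Data.Fin.Base as Fin using (Fin; zero; suc)
open import Data.Fin.Permutation using (Permutation; _⟨$⟩ˡ_; inverseˡ)
import Data.Fin.Properties as Fin
open import Data.Fin.Subset using (∣_∣; _∩_) renaming (_∈_ to _∈ₛ_)
open import Data.Integer.Base as ℤ using (ℤ; -[1+_])
import Data.Integer.Properties as ℤ
open import Data.List.Base as List using (List)
open import Data.List.Relation.Unary.All as All using (All)
open import Data.List.Relation.Unary.AllPairs as AllPairs using (AllPairs)
open import Data.List.Relation.Unary.Any using (Any; here; there)
open import Data.Maybe.Base using (Maybe; just; nothing)
open import Data.Nat.Base as ℕ using (ℕ; zero; suc; z≤n; s≤s)
import Data.Nat.Properties as ℕ
open import Data.Product.Base using (Σ; ∃-syntax; _×_; _,_; proj₁; proj₂; curry)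
open import Data.Rational.Base as ℚ using (ℚ; 0ℚ; 1ℚ)
import Data.Rational.Properties as ℚ
open import Data.Rational.Solver using (module +-*-Solver)
import Data.Rational.Unnormalised.Base as ℚᵘ
import Data.Rational.Unnormalised.Properties as ℚᵘ
open import Data.Sum.Base as Sum using (_⊎_; inj₁; inj₂)
open import Data.Unit.Base using (tt)
open import Data.Vec.Base as Vec using (Vec)
open import Data.Vec.Functional using (Vector; _∷_; [])
import Data.Vec.Properties as Vec
open import Function.Base using (_∘_; case_of_)
open import Function.Bundles using (Equivalence; _⇔_; mk⇔; mk⤖; Bijection)
open import Function.Properties.Bijection using (⤖⇒↔)
open import Level using (0ℓ)
open import Relation.Binary.PropositionalEquality as ≡ using (_≡_; _≢_; refl; cong; cong₂; subst)
open import Relation.Nullary using (¬_; Dec; yes; no; contradiction; does)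
open import Relation.Nullary.Decidable using (dec-true; dec-false; toWitness; _→-dec_)

-- These identities are stated for variables, as conversion checking would unfold the operations of
-- ℚ if they were solved in place, at terms of sequences.

module Identities where
  open import Data.Rational.Base using (_+_; _*_; _-_; -_)
  open +-*-Solver

  add-sub : ∀ p q → (p + q) - q ≡ p
  add-sub = solve 2 (λ p q → (p :+ q) :- q := p) refl

  sub-add : ∀ p q → (p - q) + q ≡ p
  sub-add = solve 2 (λ p q → (p :- q) :+ q := p) refl

  -‿sub : ∀ p q → - (p - q) ≡ q - p
  -‿sub = solve 2 (λ p q → :- (p :- q) := q :- p) refl

  sub-neg : ∀ p q → q - p ≡ - p - - q
  sub-neg = solve 2 (λ p q → q :- p := :- p :- :- q) refl

  square-neg : ∀ p → p * p ≡ - p * - p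
  square-neg = solve 1 (λ p → p :* p := :- p :* :- p) refl

  double : ∀ p → p + p ≡ (1ℚ + 1ℚ) * p
  double = solve 1 (λ p → p :+ p := (con 1ℚ :+ con 1ℚ) :* p) refl

  telescope : ∀ p q r → (p - q) + (q - r) ≡ p - r
  telescope = solve 3 (λ p q r → (p :- q) :+ (q :- r) := p :- r) refl

  sub-interchange : ∀ p q r s → (p - q) + (r - s) ≡ (p + r) - (q + s)
  sub-interchange = solve 4 (λ p q r s → (p :- q) :+ (r :- s) := (p :+ r) :- (q :+ s)) refl

  rearrange : ∀ p q r → p + ((q - p) + (r - 0ℚ)) ≡ (q + r) - 0ℚ
  rearrange = solve 3 (λ p q r → p :+ ((q :- p) :+ (r :- con 0ℚ)) := (q :+ r) :- con 0ℚ) refl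

  factor : ∀ p q r → p * q - p * r ≡ p * (q - r)
  factor = solve 3 (λ p q r → p :* q :- p :* r := p :* (q :- r)) refl

  cross : ∀ p p′ q q′ → p′ * (q * q′) - q′ * (p * p′) ≡ p′ * (q′ * (q - p))
  cross = solve 4 (λ p p′ q q′ → p′ :* (q :* q′) :- q′ :* (p :* p′) := p′ :* (q′ :* (q :- p))) refl

  *-assoc-re : ∀ a b c d e f → (a * c + - (b * d)) * e + - ((a * d + b * c) * f) ≡ a * (c * e + - (d * f)) + - (b * (c * f + d * e))
  *-assoc-re = solve 6 (λ a b c d e f → (a :* c :+ :- (b :* d)) :* e :+ :- ((a :* d :+ b :* c) :* f)
    := a :* (c :* e :+ :- (d :* f)) :+ :- (b :* (c :* f :+ d :* e))) refl

  *-assoc-im : ∀ a b c d e f → (a * c + - (b * d)) * f + (a * d + b * c) * e ≡ a * (c * f + d * e) + b * (c * e + - (d * f))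
  *-assoc-im = solve 6 (λ a b c d e f → (a :* c :+ :- (b :* d)) :* f :+ (a :* d :+ b :* c) :* e
    := a :* (c :* f :+ d :* e) :+ b :* (c :* e :+ :- (d :* f))) refl

  *-comm-re : ∀ a b c d → a * c + - (b * d) ≡ c * a + - (d * b)
  *-comm-re = solve 4 (λ a b c d → a :* c :+ :- (b :* d) := c :* a :+ :- (d :* b)) refl

  *-comm-im : ∀ a b c d → a * d + b * c ≡ c * b + d * a
  *-comm-im = solve 4 (λ a b c d → a :* d :+ b :* c := c :* b :+ d :* a) refl

  *-identityˡ-re : ∀ a b → 1ℚ * a + - (0ℚ * b) ≡ a
  *-identityˡ-re = solve 2 (λ a b → con 1ℚ :* a :+ :- (con 0ℚ :* b) := a) refl

  *-identityˡ-im : ∀ a b → 1ℚ * b + 0ℚ * a ≡ b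
  *-identityˡ-im = solve 2 (λ a b → con 1ℚ :* b :+ con 0ℚ :* a := b) refl

  *-zeroˡ-re : ∀ a b → 0ℚ * a + - (0ℚ * b) ≡ 0ℚ
  *-zeroˡ-re = solve 2 (λ a b → con 0ℚ :* a :+ :- (con 0ℚ :* b) := con 0ℚ) refl

  *-zeroˡ-im : ∀ a b → 0ℚ * b + 0ℚ * a ≡ 0ℚ
  *-zeroˡ-im = solve 2 (λ a b → con 0ℚ :* b :+ con 0ℚ :* a := con 0ℚ) refl

  distribˡ-re : ∀ a b c d e f → a * (c + e) + - (b * (d + f)) ≡ (a * c + - (b * d)) + (a * e + - (b * f))
  distribˡ-re = solve 6 (λ a b c d e f → a :* (c :+ e) :+ :- (b :* (d :+ f))
    := (a :* c :+ :- (b :* d)) :+ (a :* e :+ :- (b :* f))) refl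

  distribˡ-im : ∀ a b c d e f → a * (d + f) + b * (c + e) ≡ (a * d + b * c) + (a * f + b * e)
  distribˡ-im = solve 6 (λ a b c d e f → a :* (d :+ f) :+ b :* (c :+ e)
    := (a :* d :+ b :* c) :+ (a :* f :+ b :* e)) refl

  real-*-re : ∀ a b → a * b ≡ a * b + - (0ℚ * 0ℚ)
  real-*-re = solve 2 (λ a b → a :* b := a :* b :+ :- (con 0ℚ :* con 0ℚ)) refl

  real-*-im : ∀ a b → 0ℚ ≡ a * 0ℚ + 0ℚ * b
  real-*-im = solve 2 (λ a b → con 0ℚ := a :* con 0ℚ :+ con 0ℚ :* b) refl

  conj-*-re : ∀ a b c d → a * c + - (b * d) ≡ a * c + - (- b * - d)
  conj-*-re = solve 4 (λ a b c d → a :* c :+ :- (b :* d) := a :* c :+ :- (:- b :* :- d)) refl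

  conj-*-im : ∀ a b c d → - (a * d + b * c) ≡ a * - d + - b * c
  conj-*-im = solve 4 (λ a b c d → :- (a :* d :+ b :* c) := a :* :- d :+ :- b :* c) refl

  inverse-re : ∀ a b s → a * (a * s) + - (b * - (b * s)) ≡ (a * a + b * b) * s
  inverse-re = solve 3 (λ a b s → a :* (a :* s) :+ :- (b :* :- (b :* s)) := (a :* a :+ b :* b) :* s) refl

  inverse-im : ∀ a b s → a * - (b * s) + b * (a * s) ≡ 0ℚ
  inverse-im = solve 3 (λ a b s → a :* :- (b :* s) :+ b :* (a :* s) := con 0ℚ) refl

open Identities
open import Defs

open ℝ
open ℂ

-- Estimates in ℚ

scaled : ∀ {K ε} → 0ℚ ℚ.< K → 0ℚ ℚ.< ε → ∃[ δ ] (0ℚ ℚ.< δ × K ℚ.* δ ≡ ε)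
scaled {K} {ε} 0<K 0<ε = ℚ.1/ K ℚ.* ε , ℚ.positive⁻¹ _ , (begin
  K ℚ.* (ℚ.1/ K ℚ.* ε)  ≡⟨ ℚ.*-assoc K (ℚ.1/ K) ε ⟨
  K ℚ.* ℚ.1/ K ℚ.* ε    ≡⟨ cong (ℚ._* ε) (ℚ.*-inverseʳ K) ⟩
  1ℚ ℚ.* ε              ≡⟨ ℚ.*-identityˡ ε ⟩
  ε                     ∎)
  where
  open ≡.≡-Reasoning
  instance
    posK = ℚ.positive 0<K
    posε = ℚ.positive 0<ε
    nzK = ℚ.pos⇒nonZero K
    pos1/K = ℚ.1/pos⇒pos K
    posδ = ℚ.pos*pos⇒pos (ℚ.1/ K) ε

∣p∣≤∣p+q∣+∣q∣ : ∀ p q → ℚ.∣ p ∣ ℚ.≤ ℚ.∣ p ℚ.+ q ∣ ℚ.+ ℚ.∣ q ∣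
∣p∣≤∣p+q∣+∣q∣ p q = subst (λ r → ℚ.∣ r ∣ ℚ.≤ ℚ.∣ p ℚ.+ q ∣ ℚ.+ ℚ.∣ q ∣)
  (add-sub p q) (ℚ.∣p-q∣≤∣p∣+∣q∣ (p ℚ.+ q) q)

∣p-q∣≡∣q-p∣ : ∀ p q → ℚ.∣ p ℚ.- q ∣ ≡ ℚ.∣ q ℚ.- p ∣
∣p-q∣≡∣q-p∣ p q = ≡.trans (≡.sym (ℚ.∣-p∣≡∣p∣ (p ℚ.- q)))
  (cong ℚ.∣_∣ (-‿sub p q))

p*p≡∣p∣*∣p∣ : ∀ p → p ℚ.* p ≡ ℚ.∣ p ∣ ℚ.* ℚ.∣ p ∣
p*p≡∣p∣*∣p∣ p with ℚ.∣p∣≡p∨∣p∣≡-p p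
... | inj₁ eq = ≡.sym (cong₂ ℚ._*_ eq eq)
... | inj₂ eq = ≡.trans (square-neg p) (≡.sym (cong₂ ℚ._*_ eq eq))

0≤p*q : ∀ {p q} → 0ℚ ℚ.≤ p → 0ℚ ℚ.≤ q → 0ℚ ℚ.≤ p ℚ.* q
0≤p*q {p} {q} 0≤p 0≤q = ℚ.nonNegative⁻¹ _ {{ℚ.nonNeg*nonNeg⇒nonNeg p {{ℚ.nonNegative 0≤p}} q {{ℚ.nonNegative 0≤q}}}}

*-mono-≤-nonNeg : ∀ {p q r s} → 0ℚ ℚ.≤ q → 0ℚ ℚ.≤ r → p ℚ.≤ q → r ℚ.≤ s → p ℚ.* r ℚ.≤ q ℚ.* s
*-mono-≤-nonNeg {q = q} {r = r} 0≤q 0≤r p≤q r≤s = ℚ.≤-trans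
  (ℚ.*-monoʳ-≤-nonNeg r {{ℚ.nonNegative 0≤r}} p≤q)
  (ℚ.*-monoˡ-≤-nonNeg q {{ℚ.nonNegative 0≤q}} r≤s)

0≤p*p : ∀ p → 0ℚ ℚ.≤ p ℚ.* p
0≤p*p p = subst (0ℚ ℚ.≤_) (≡.sym (p*p≡∣p∣*∣p∣ p)) (0≤p*q (ℚ.0≤∣p∣ p) (ℚ.0≤∣p∣ p))

-- recip 0 = 0
recip : ℚ → ℚ
recip p with p ℚ.≟ 0ℚ
... | yes _  = 0ℚ
... | no p≢0 = (ℚ.1/ p) {{ℚ.≢-nonZero p≢0}}

recip-inverse : ∀ p → p ≢ 0ℚ → p ℚ.* recip p ≡ 1ℚ
recip-inverse p p≢0 with p ℚ.≟ 0ℚ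
... | yes p≡0 = contradiction p≡0 p≢0
... | no p≢0′ = ℚ.*-inverseʳ p {{ℚ.≢-nonZero p≢0′}}

-- Cauchy sequences

Eventually : (ℕ → Set) → Set
Eventually P = ∃[ N ] ∀ n → N ℕ.≤ n → P n

map₂ : ∀ {P Q R : ℕ → Set} → (∀ n → P n → Q n → R n) → Eventually P → Eventually Q → Eventually R
map₂ f (M , p) (N , q) = M ℕ.⊔ N , λ n h →
  f n (p n (ℕ.m⊔n≤o⇒m≤o M N h)) (q n (ℕ.m⊔n≤o⇒n≤o M N h))

map₁ : ∀ {P Q : ℕ → Set} → (∀ n → P n → Q n) → Eventually P → Eventually Q
map₁ f (M , p) = M , λ n h → f n (p n h)

≐⇒≈ᵣ : ∀ {x y} → (∀ n → seq x n ≡ seq y n) → x ≈ᵣ y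
≐⇒≈ᵣ {x} {y} eq ε 0<ε = 0 , λ n _ → subst (λ r → ℚ.∣ r ∣ ℚ.< ε)
  (≡.sym (≡.trans (cong (ℚ._- seq y n) (eq n)) (ℚ.+-inverseʳ (seq y n)))) 0<ε

≈ᵣ-refl : ∀ {x} → x ≈ᵣ x
≈ᵣ-refl {x} = ≐⇒≈ᵣ {x} {x} λ _ → refl

≈ᵣ-sym : ∀ {x y} → x ≈ᵣ y → y ≈ᵣ x
≈ᵣ-sym {x} {y} x≈y ε 0<ε =
  map₁ (λ n → subst (ℚ._< ε) (∣p-q∣≡∣q-p∣ (seq x n) (seq y n))) (x≈y ε 0<ε)

halve : ∀ {ε} → 0ℚ ℚ.< ε → ∃[ δ ] (0ℚ ℚ.< δ × δ ℚ.+ δ ≡ ε)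
halve 0<ε =
  let (δ , 0<δ , eq) = scaled {1ℚ ℚ.+ 1ℚ} (ℚ.positive⁻¹ _) 0<ε
  in δ , 0<δ , ≡.trans (double δ) eq

∣p+q∣<2δ : ∀ {δ ε} p q → δ ℚ.+ δ ≡ ε → ℚ.∣ p ∣ ℚ.< δ → ℚ.∣ q ∣ ℚ.< δ → ℚ.∣ p ℚ.+ q ∣ ℚ.< ε
∣p+q∣<2δ {δ} {ε} p q eq p< q< = begin-strict
  ℚ.∣ p ℚ.+ q ∣          ≤⟨ ℚ.∣p+q∣≤∣p∣+∣q∣ p q ⟩
  ℚ.∣ p ∣ ℚ.+ ℚ.∣ q ∣    <⟨ ℚ.+-mono-< p< q< ⟩
  δ ℚ.+ δ                ≡⟨ eq ⟩
  ε                      ∎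
  where open ℚ.≤-Reasoning

close-trans : ∀ {δ ε} p q r → δ ℚ.+ δ ≡ ε → ℚ.∣ p ℚ.- q ∣ ℚ.< δ → ℚ.∣ q ℚ.- r ∣ ℚ.< δ → ℚ.∣ p ℚ.- r ∣ ℚ.< ε
close-trans {ε = ε} p q r eq p-q q-r = subst (λ s → ℚ.∣ s ∣ ℚ.< ε) (telescope p q r)
  (∣p+q∣<2δ (p ℚ.- q) (q ℚ.- r) eq p-q q-r)

close-+ : ∀ {δ ε} p q r s → δ ℚ.+ δ ≡ ε → ℚ.∣ p ℚ.- q ∣ ℚ.< δ → ℚ.∣ r ℚ.- s ∣ ℚ.< δ →
          ℚ.∣ (p ℚ.+ r) ℚ.- (q ℚ.+ s) ∣ ℚ.< ε
close-+ {ε = ε} p q r s eq p-q r-s = subst (λ t → ℚ.∣ t ∣ ℚ.< ε) (sub-interchange p q r s)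
  (∣p+q∣<2δ (p ℚ.- q) (r ℚ.- s) eq p-q r-s)

close-neg : ∀ {ε} p q → ℚ.∣ p ℚ.- q ∣ ℚ.< ε → ℚ.∣ ℚ.- p ℚ.- ℚ.- q ∣ ℚ.< ε
close-neg {ε} p q = subst (ℚ._< ε) (≡.trans (∣p-q∣≡∣q-p∣ p q) (cong ℚ.∣_∣ (sub-neg p q)))

≈ᵣ-trans : ∀ {x y z} → x ≈ᵣ y → y ≈ᵣ z → x ≈ᵣ z
≈ᵣ-trans {x} {y} {z} x≈y y≈z ε 0<ε =
  let (δ , 0<δ , eq) = halve 0<ε
  in map₂ (λ n → close-trans (seq x n) (seq y n) (seq z n) eq) (x≈y δ 0<δ) (y≈z δ 0<δ)

+ᵣ-cong : ∀ {x x′ y y′} → x ≈ᵣ x′ → y ≈ᵣ y′ → x +ᵣ y ≈ᵣ x′ +ᵣ y′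
+ᵣ-cong {x} {x′} {y} {y′} p q ε 0<ε =
  let (δ , 0<δ , eq) = halve 0<ε
  in map₂ (λ n → close-+ (seq x n) (seq x′ n) (seq y n) (seq y′ n) eq) (p δ 0<δ) (q δ 0<δ)

-ᵣ-cong : ∀ {x x′} → x ≈ᵣ x′ → -ᵣ x ≈ᵣ -ᵣ x′
-ᵣ-cong {x} {x′} p ε 0<ε = map₁ (λ n → close-neg (seq x n) (seq x′ n)) (p ε 0<ε)

∣p∣≤1+∣q∣ : ∀ p q → ℚ.∣ p ℚ.- q ∣ ℚ.< 1ℚ → ℚ.∣ p ∣ ℚ.≤ 1ℚ ℚ.+ ℚ.∣ q ∣
∣p∣≤1+∣q∣ p q close = subst (λ r → ℚ.∣ p ∣ ℚ.≤ 1ℚ ℚ.+ r) (ℚ.∣-p∣≡∣p∣ q)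
  (ℚ.≤-trans (∣p∣≤∣p+q∣+∣q∣ p (ℚ.- q)) (ℚ.+-monoˡ-≤ ℚ.∣ ℚ.- q ∣ (ℚ.<⇒≤ close)))

bounded : ∀ x → ∃[ K ] (0ℚ ℚ.< K × Eventually λ n → ℚ.∣ seq x n ∣ ℚ.≤ K)
bounded x =
  let (N , close) = cauchy x 1ℚ (ℚ.positive⁻¹ 1ℚ)
  in 1ℚ ℚ.+ ℚ.∣ seq x N ∣
     , ℚ.+-mono-<-≤ (ℚ.positive⁻¹ 1ℚ) (ℚ.0≤∣p∣ (seq x N))
     , N , λ n N≤n → ∣p∣≤1+∣q∣ (seq x n) (seq x N) (close n N N≤n ℕ.≤-refl)

*ᵣ-comm : ∀ x y → x *ᵣ y ≈ᵣ y *ᵣ x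
*ᵣ-comm x y = ≐⇒≈ᵣ {x *ᵣ y} {y *ᵣ x} λ n → ℚ.*-comm (seq x n) (seq y n)

close-* : ∀ {K δ ε} p q r → 0ℚ ℚ.< K → K ℚ.* δ ≡ ε → ℚ.∣ p ∣ ℚ.≤ K → ℚ.∣ q ℚ.- r ∣ ℚ.< δ →
          ℚ.∣ p ℚ.* q ℚ.- p ℚ.* r ∣ ℚ.< ε
close-* {K} {δ} {ε} p q r 0<K Kδ≡ε p≤K q-r<δ = begin-strict
  ℚ.∣ p ℚ.* q ℚ.- p ℚ.* r ∣       ≡⟨ cong ℚ.∣_∣ (factor p q r) ⟩
  ℚ.∣ p ℚ.* (q ℚ.- r) ∣           ≡⟨ ℚ.∣p*q∣≡∣p∣*∣q∣ p (q ℚ.- r) ⟩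
  ℚ.∣ p ∣ ℚ.* ℚ.∣ q ℚ.- r ∣       ≤⟨ ℚ.*-monoʳ-≤-nonNeg ℚ.∣ q ℚ.- r ∣ {{ℚ.∣-∣-nonNeg (q ℚ.- r)}} p≤K ⟩
  K ℚ.* ℚ.∣ q ℚ.- r ∣             <⟨ ℚ.*-monoʳ-<-pos K {{ℚ.positive 0<K}} q-r<δ ⟩
  K ℚ.* δ                         ≡⟨ Kδ≡ε ⟩
  ε                               ∎
  where open ℚ.≤-Reasoning

*ᵣ-congˡ : ∀ {x y y′} → y ≈ᵣ y′ → x *ᵣ y ≈ᵣ x *ᵣ y′
*ᵣ-congˡ {x} {y} {y′} p ε 0<ε =
  let (K , 0<K , x≤K) = bounded x
      (δ , 0<δ , Kδ≡ε) = scaled 0<K 0<ε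
  in map₂ (λ n → close-* (seq x n) (seq y n) (seq y′ n) 0<K Kδ≡ε) x≤K (p δ 0<δ)

-- Replacing one factor at a time needs a bound only on the factor that stays; commutativity reduces
-- the first replacement to the second.
*ᵣ-cong : ∀ {x x′ y y′} → x ≈ᵣ x′ → y ≈ᵣ y′ → x *ᵣ y ≈ᵣ x′ *ᵣ y′
*ᵣ-cong {x} {x′} {y} {y′} p q =
  ≈ᵣ-trans {x *ᵣ y} {x *ᵣ y′} {x′ *ᵣ y′} (*ᵣ-congˡ {x} {y} {y′} q)
    (≈ᵣ-trans {x *ᵣ y′} {y′ *ᵣ x} {x′ *ᵣ y′} (*ᵣ-comm x y′)
      (≈ᵣ-trans {y′ *ᵣ x} {y′ *ᵣ x′} {x′ *ᵣ y′} (*ᵣ-congˡ {y′} {x} {x′} p) (*ᵣ-comm y′ x′)))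

-- Reciprocals of real numbers apart from zero

module _ (x : ℝ) (0#x : ∃[ δ ] (0ℚ ℚ.< δ × Eventually λ n → δ ℚ.≤ ℚ.∣ seq x n ∣)) where

  private
    δ = proj₁ 0#x
    0<δ = proj₁ (proj₂ 0#x)
    δ≤∣x∣ = proj₂ (proj₂ 0#x)

    instance
      posδ = ℚ.positive 0<δ

    -- `K` is 1 / δ, a common bound for the reciprocals of all late terms.
    K = proj₁ (scaled 0<δ (ℚ.positive⁻¹ 1ℚ))
    0<K = proj₁ (proj₂ (scaled 0<δ (ℚ.positive⁻¹ 1ℚ)))
    δK≡1 = proj₂ (proj₂ (scaled 0<δ (ℚ.positive⁻¹ 1ℚ)))

    ≢0 : ∀ {a} → δ ℚ.≤ ℚ.∣ a ∣ → a ≢ 0ℚ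
    ≢0 δ≤0 refl = ℚ.<-irrefl refl (ℚ.<-≤-trans 0<δ δ≤0)

    inverse : ∀ {a} → δ ℚ.≤ ℚ.∣ a ∣ → a ℚ.* recip a ≡ 1ℚ
    inverse {a} δ≤a = recip-inverse a (≢0 δ≤a)

    recip≤K : ∀ {a} → δ ℚ.≤ ℚ.∣ a ∣ → ℚ.∣ recip a ∣ ℚ.≤ K
    recip≤K {a} δ≤a = ℚ.*-cancelˡ-≤-pos δ (begin
      δ ℚ.* ℚ.∣ recip a ∣          ≤⟨ ℚ.*-monoʳ-≤-nonNeg ℚ.∣ recip a ∣ {{ℚ.∣-∣-nonNeg (recip a)}} δ≤a ⟩
      ℚ.∣ a ∣ ℚ.* ℚ.∣ recip a ∣    ≡⟨ ℚ.∣p*q∣≡∣p∣*∣q∣ a (recip a) ⟨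
      ℚ.∣ a ℚ.* recip a ∣          ≡⟨ cong ℚ.∣_∣ (inverse δ≤a) ⟩
      1ℚ                           ≡⟨ δK≡1 ⟨
      δ ℚ.* K                      ∎)
      where open ℚ.≤-Reasoning

    -- As 1/a - 1/b = (1/a)(1/b)(b - a), distances grow at most by the factor `K` squared. Hence ε
    -- is divided by `K` twice, first to η and then to θ.
    recip-close : ∀ {a b ε η} → δ ℚ.≤ ℚ.∣ a ∣ → δ ℚ.≤ ℚ.∣ b ∣ → K ℚ.* η ≡ ε →
                  ∀ {θ} → K ℚ.* θ ≡ η → ℚ.∣ b ℚ.- a ∣ ℚ.< θ → ℚ.∣ recip a ℚ.- recip b ∣ ℚ.< ε
    recip-close {a} {b} {ε} {η} δ≤a δ≤b eq {θ} eq′ b-a<θ = begin-strict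
      ℚ.∣ a′ ℚ.- b′ ∣                            ≡⟨ cong ℚ.∣_∣ (cong₂ ℚ._-_ (ℚ.*-identityʳ a′) (ℚ.*-identityʳ b′)) ⟨
      ℚ.∣ a′ ℚ.* 1ℚ ℚ.- b′ ℚ.* 1ℚ ∣
        ≡⟨ cong ℚ.∣_∣ (cong₂ (λ r s → a′ ℚ.* r ℚ.- b′ ℚ.* s) (inverse δ≤b) (inverse δ≤a)) ⟨
      ℚ.∣ a′ ℚ.* (b ℚ.* b′) ℚ.- b′ ℚ.* (a ℚ.* a′) ∣
        ≡⟨ cong ℚ.∣_∣ (cross a a′ b b′) ⟩
      ℚ.∣ a′ ℚ.* (b′ ℚ.* (b ℚ.- a)) ∣            ≡⟨ ℚ.∣p*q∣≡∣p∣*∣q∣ a′ _ ⟩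
      ℚ.∣ a′ ∣ ℚ.* ℚ.∣ b′ ℚ.* (b ℚ.- a) ∣        ≡⟨ cong (ℚ.∣ a′ ∣ ℚ.*_) (ℚ.∣p*q∣≡∣p∣*∣q∣ b′ (b ℚ.- a)) ⟩
      ℚ.∣ a′ ∣ ℚ.* (ℚ.∣ b′ ∣ ℚ.* ℚ.∣ b ℚ.- a ∣)
        ≤⟨ *-mono-≤-nonNeg (ℚ.<⇒≤ 0<K) (0≤p*q (ℚ.0≤∣p∣ b′) (ℚ.0≤∣p∣ (b ℚ.- a))) (recip≤K δ≤a)
                                                      (ℚ.*-monoʳ-≤-nonNeg ℚ.∣ b ℚ.- a ∣ {{ℚ.∣-∣-nonNeg (b ℚ.- a)}} (recip≤K δ≤b)) ⟩
      K ℚ.* (K ℚ.* ℚ.∣ b ℚ.- a ∣)                <⟨ ℚ.*-monoʳ-<-pos K (ℚ.*-monoʳ-<-pos K b-a<θ) ⟩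
      K ℚ.* (K ℚ.* θ)                            ≡⟨ cong (K ℚ.*_) eq′ ⟩
      K ℚ.* η                                    ≡⟨ eq ⟩
      ε                                          ∎
      where
      open ℚ.≤-Reasoning
      a′ = recip a
      b′ = recip b
      instance
        posK = ℚ.positive 0<K

  -- Early terms of `x` may be 0 although `x` is apart from 0. The value of `recip` there is
  -- harmless, since only a tail of the sequence matters.
  recipᵣ : ℝ
  seq recipᵣ n = recip (seq x n)
  cauchy recipᵣ ε 0<ε =
    let (η , 0<η , eq) = scaled 0<K 0<ε
        (θ , 0<θ , eq′) = scaled 0<K 0<η
        (M , close) = cauchy x θ 0<θ
        (N , δ≤) = δ≤∣x∣
    in M ℕ.⊔ N , λ m n h k →
      recip-close (δ≤ m (ℕ.m⊔n≤o⇒n≤o M N h)) (δ≤ n (ℕ.m⊔n≤o⇒n≤o M N k)) eq eq′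
        (close n m (ℕ.m⊔n≤o⇒m≤o M N k) (ℕ.m⊔n≤o⇒m≤o M N h))

  *ᵣ-inverseʳ : x *ᵣ recipᵣ ≈ᵣ constᵣ 1ℚ
  *ᵣ-inverseʳ ε 0<ε = map₁
    (λ n δ≤ → subst (λ r → ℚ.∣ r ∣ ℚ.< ε) (cong (ℚ._- 1ℚ) (≡.sym (inverse δ≤))) 0<ε) δ≤∣x∣

-- Apartness

-- The contrapositive of `close-trans`, legitimate because the order on ℚ is decidable.
close⇒far : ∀ {δ ε} p q r → δ ℚ.+ δ ≡ ε → ℚ.∣ p ℚ.- q ∣ ℚ.< δ → ε ℚ.≤ ℚ.∣ p ℚ.- r ∣ → δ ℚ.≤ ℚ.∣ q ℚ.- r ∣
close⇒far p q r eq p-q p-r = ℚ.≮⇒≥ λ q-r → ℚ.<-irrefl refl (ℚ.≤-<-trans p-r (close-trans p q r eq p-q q-r))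

#ᵣ-resp-≈ᵣ : ∀ {x x′ y} → x ≈ᵣ x′ → x #ᵣ y → x′ #ᵣ y
#ᵣ-resp-≈ᵣ {x} {x′} {y} x≈x′ (ε , 0<ε , far) =
  let (δ , 0<δ , eq) = halve 0<ε
  in δ , 0<δ , map₂ (λ n → close⇒far (seq x n) (seq x′ n) (seq y n) eq) (x≈x′ δ 0<δ) far

-- Comparing a sufficiently late term of x with 2δ, where ε = 4δ, decides the alternative.
+ᵣ-apart : ∀ {x y} → x +ᵣ y #ᵣ constᵣ 0ℚ → x #ᵣ constᵣ 0ℚ ⊎ y #ᵣ constᵣ 0ℚ
+ᵣ-apart {x} {y} (ε , 0<ε , N , far) =
  let (η , 0<η , η+η) = halve 0<ε
      (δ , 0<δ , δ+δ) = halve 0<η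
      (M , close) = cauchy x δ 0<δ
  in decide 0<δ η+η δ+δ M close (η ℚ.≤? ℚ.∣ seq x M ∣)
  where
  far-x : ∀ {η δ} p q → δ ℚ.+ δ ≡ η → η ℚ.≤ ℚ.∣ p ∣ → ℚ.∣ p ℚ.- q ∣ ℚ.< δ → δ ℚ.≤ ℚ.∣ q ℚ.- 0ℚ ∣
  far-x {η} p q eq far p-q = close⇒far p q 0ℚ eq p-q
    (subst (λ r → η ℚ.≤ ℚ.∣ r ∣) (≡.sym (ℚ.+-identityʳ p)) far)
  -- If r were within δ of 0, then q + r = p + ((q - p) + r) would be smaller than η + (δ + δ) = ε
  -- in absolute value.
  far-y : ∀ {η δ} p q r → η ℚ.+ η ≡ ε → δ ℚ.+ δ ≡ η → ℚ.∣ p ∣ ℚ.< η → ℚ.∣ q ℚ.- p ∣ ℚ.< δ →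
          ε ℚ.≤ ℚ.∣ (q ℚ.+ r) ℚ.- 0ℚ ∣ → δ ℚ.≤ ℚ.∣ r ℚ.- 0ℚ ∣
  far-y p q r η+η δ+δ p< q-p far = ℚ.≮⇒≥ λ r< → ℚ.<-irrefl refl (ℚ.≤-<-trans far
    (subst (λ s → ℚ.∣ s ∣ ℚ.< ε) (rearrange p q r)
      (∣p+q∣<2δ p ((q ℚ.- p) ℚ.+ (r ℚ.- 0ℚ)) η+η p< (∣p+q∣<2δ (q ℚ.- p) (r ℚ.- 0ℚ) δ+δ q-p r<))))
  decide : ∀ {η δ} → 0ℚ ℚ.< δ → η ℚ.+ η ≡ ε → δ ℚ.+ δ ≡ η → ∀ M →
           (∀ m n → M ℕ.≤ m → M ℕ.≤ n → ℚ.∣ seq x m ℚ.- seq x n ∣ ℚ.< δ) →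
           Dec (η ℚ.≤ ℚ.∣ seq x M ∣) → x #ᵣ constᵣ 0ℚ ⊎ y #ᵣ constᵣ 0ℚ
  decide 0<δ η+η δ+δ M close (yes η≤) = inj₁ (_ , 0<δ , M , λ n M≤n →
    far-x (seq x M) (seq x n) δ+δ η≤ (close M n ℕ.≤-refl M≤n))
  decide 0<δ η+η δ+δ M close (no η≰) = inj₂ (_ , 0<δ , M ℕ.⊔ N , λ n h →
    far-y (seq x M) (seq x n) (seq y n) η+η δ+δ (ℚ.≰⇒> η≰)
      (close n M (ℕ.m⊔n≤o⇒m≤o M N h) ℕ.≤-refl) (far n (ℕ.m⊔n≤o⇒n≤o M N h)))

-- Integers inside ℚ

private
  -- The normalisation in `k ℚ./ 1` does not compute for a variable `k`. Among unnormalised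
  -- rationals the operations do, and the homomorphism laws become integer identities.
  /1 : ∀ k → ℚ.toℚᵘ (k ℚ./ 1) ℚᵘ.≃ ℚᵘ.mkℚᵘ k 0
  /1 k = ℚ.toℚᵘ-fromℚᵘ (ℚᵘ.mkℚᵘ k 0)

/1-homo-+ : ∀ k l → (k ℤ.+ l) ℚ./ 1 ≡ (k ℚ./ 1) ℚ.+ (l ℚ./ 1)
/1-homo-+ k l = ℚ.toℚᵘ-injective (begin
  ℚ.toℚᵘ ((k ℤ.+ l) ℚ./ 1)                        ≈⟨ /1 (k ℤ.+ l) ⟩
  ℚᵘ.mkℚᵘ (k ℤ.+ l) 0
    ≈⟨ ℚᵘ.*≡* (cong (ℤ._* ℤ.1ℤ) (cong₂ ℤ._+_ (ℤ.*-identityʳ k) (ℤ.*-identityʳ l))) ⟨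
  ℚᵘ.mkℚᵘ k 0 ℚᵘ.+ ℚᵘ.mkℚᵘ l 0                    ≈⟨ ℚᵘ.+-cong (/1 k) (/1 l) ⟨
  ℚ.toℚᵘ (k ℚ./ 1) ℚᵘ.+ ℚ.toℚᵘ (l ℚ./ 1)          ≈⟨ ℚ.toℚᵘ-homo-+ (k ℚ./ 1) (l ℚ./ 1) ⟨
  ℚ.toℚᵘ (k ℚ./ 1 ℚ.+ l ℚ./ 1)                    ∎)
  where open ℚᵘ.≃-Reasoning

/1-homo-* : ∀ k l → (k ℤ.* l) ℚ./ 1 ≡ (k ℚ./ 1) ℚ.* (l ℚ./ 1)
/1-homo-* k l = ℚ.toℚᵘ-injective (begin
  ℚ.toℚᵘ ((k ℤ.* l) ℚ./ 1)                        ≈⟨ /1 (k ℤ.* l) ⟩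
  ℚᵘ.mkℚᵘ k 0 ℚᵘ.* ℚᵘ.mkℚᵘ l 0                    ≈⟨ ℚᵘ.*-cong (/1 k) (/1 l) ⟨
  ℚ.toℚᵘ (k ℚ./ 1) ℚᵘ.* ℚ.toℚᵘ (l ℚ./ 1)          ≈⟨ ℚ.toℚᵘ-homo-* (k ℚ./ 1) (l ℚ./ 1) ⟨
  ℚ.toℚᵘ ((k ℚ./ 1) ℚ.* (l ℚ./ 1))                    ∎)
  where open ℚᵘ.≃-Reasoning

/1-injective : ∀ {k l} → k ℚ./ 1 ≡ l ℚ./ 1 → k ≡ l
/1-injective {k} {l} eq with ℚᵘ.≃-trans (ℚᵘ.≃-sym (/1 k)) (ℚᵘ.≃-trans (ℚᵘ.≃-reflexive (cong ℚ.toℚᵘ eq)) (/1 l))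
... | ℚᵘ.*≡* k*1≡l*1 = ≡.trans (≡.sym (ℤ.*-identityʳ k)) (≡.trans k*1≡l*1 (ℤ.*-identityʳ l))

≢⇒0<∣p-q∣ : ∀ {p q} → p ≢ q → 0ℚ ℚ.< ℚ.∣ p ℚ.- q ∣
≢⇒0<∣p-q∣ {p} {q} p≢q = ℚ.≰⇒> λ ≤0 → p≢q (begin
  p                 ≡⟨ sub-add p q ⟨
  (p ℚ.- q) ℚ.+ q   ≡⟨ cong (ℚ._+ q) (ℚ.∣p∣≡0⇒p≡0 (p ℚ.- q) (ℚ.≤-antisym ≤0 (ℚ.0≤∣p∣ (p ℚ.- q)))) ⟩
  0ℚ ℚ.+ q          ≡⟨ ℚ.+-identityˡ q ⟩
  q                 ∎)
  where
  open ≡.≡-Reasoning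

-- Equality in ℚ is decidable, and for distinct `p` and `q` the tolerance |p - q| itself refutes
-- closeness.
constᵣ-injective : ∀ {p q} → constᵣ p ≈ᵣ constᵣ q → p ≡ q
constᵣ-injective {p} {q} p≈q with p ℚ.≟ q
... | yes p≡q = p≡q
... | no  p≢q = let (N , close) = p≈q ℚ.∣ p ℚ.- q ∣ (≢⇒0<∣p-q∣ p≢q)
                in contradiction (close N ℕ.≤-refl) (ℚ.<-irrefl refl)

constᵣ-apart : ∀ {p q} → p ≢ q → constᵣ p #ᵣ constᵣ q
constᵣ-apart {p} {q} p≢q = ℚ.∣ p ℚ.- q ∣ , ≢⇒0<∣p-q∣ p≢q , 0 , λ _ _ → ℚ.≤-refl

-- The field of complex numbers

infix 8 -_

-- Multiplication by `-1#` is also the negation in `rawModule`, and it makes every difference an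
-- instance of the form `u + c * v` handled by the linearity lemmas.
-_ : ℂ → ℂ
- z = -1# * z

opaque
  unfolding _≈_

  private
    -- The operations act term by term on the sequences, so ring laws need no estimates, only
    -- identities in ℚ.
    pointwise : ∀ z w → (∀ n → seq (re z) n ≡ seq (re w) n) → (∀ n → seq (im z) n ≡ seq (im w) n) → z ≈ w
    pointwise z w p q = ≐⇒≈ᵣ {re z} {re w} p , ≐⇒≈ᵣ {im z} {im w} q

  ≈-refl : ∀ {z} → z ≈ z
  ≈-refl {z} = ≈ᵣ-refl {re z} , ≈ᵣ-refl {im z}

  ≈-sym : ∀ {z w} → z ≈ w → w ≈ z
  ≈-sym {z} {w} (p , q) = ≈ᵣ-sym {re z} {re w} p , ≈ᵣ-sym {im z} {im w} q

  ≈-trans : ∀ {z w u} → z ≈ w → w ≈ u → z ≈ u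
  ≈-trans {z} {w} {u} (p , q) (p′ , q′) = ≈ᵣ-trans {re z} {re w} {re u} p p′ , ≈ᵣ-trans {im z} {im w} {im u} q q′

  +-cong : ∀ {z z′ w w′} → z ≈ z′ → w ≈ w′ → z + w ≈ z′ + w′
  +-cong {z} {z′} {w} {w′} (p , q) (p′ , q′) =
    +ᵣ-cong {re z} {re z′} {re w} {re w′} p p′ , +ᵣ-cong {im z} {im z′} {im w} {im w′} q q′

  *-cong : ∀ {z z′ w w′} → z ≈ z′ → w ≈ w′ → z * w ≈ z′ * w′
  *-cong {a +i b} {a′ +i b′} {c +i d} {c′ +i d′} (p , q) (p′ , q′) =
      +ᵣ-cong {a *ᵣ c} {a′ *ᵣ c′} { -ᵣ (b *ᵣ d)} { -ᵣ (b′ *ᵣ d′)} (*ᵣ-cong {a} {a′} {c} {c′} p p′)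
        (-ᵣ-cong {b *ᵣ d} {b′ *ᵣ d′} (*ᵣ-cong {b} {b′} {d} {d′} q q′))
    , +ᵣ-cong {a *ᵣ d} {a′ *ᵣ d′} {b *ᵣ c} {b′ *ᵣ c′} (*ᵣ-cong {a} {a′} {d} {d′} p q′)
        (*ᵣ-cong {b} {b′} {c} {c′} q p′)

  conj-cong : ∀ {z w} → z ≈ w → conj z ≈ conj w
  conj-cong {z} {w} (p , q) = p , -ᵣ-cong {im z} {im w} q

  +-assoc : ∀ z w u → (z + w) + u ≈ z + (w + u)
  +-assoc z w u = pointwise ((z + w) + u) (z + (w + u)) (λ n → ℚ.+-assoc (seq (re z) n) _ _) (λ n → ℚ.+-assoc (seq (im z) n) _ _)

  +-comm : ∀ z w → z + w ≈ w + z
  +-comm z w = pointwise (z + w) (w + z) (λ n → ℚ.+-comm (seq (re z) n) _) (λ n → ℚ.+-comm (seq (im z) n) _)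

  +-identityˡ : ∀ z → 0# + z ≈ z
  +-identityˡ z = pointwise (0# + z) z (λ n → ℚ.+-identityˡ _) (λ n → ℚ.+-identityˡ _)

  *-assoc : ∀ z w u → (z * w) * u ≈ z * (w * u)
  *-assoc z w u = pointwise ((z * w) * u) (z * (w * u))
    (λ n → *-assoc-re
      (seq (re z) n) (seq (im z) n) (seq (re w) n) (seq (im w) n) (seq (re u) n) (seq (im u) n))
    (λ n → *-assoc-im
      (seq (re z) n) (seq (im z) n) (seq (re w) n) (seq (im w) n) (seq (re u) n) (seq (im u) n))

  *-comm : ∀ z w → z * w ≈ w * z
  *-comm z w = pointwise (z * w) (w * z)
    (λ n → *-comm-re
      (seq (re z) n) (seq (im z) n) (seq (re w) n) (seq (im w) n))
    (λ n → *-comm-im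
      (seq (re z) n) (seq (im z) n) (seq (re w) n) (seq (im w) n))

  *-identityˡ : ∀ z → 1# * z ≈ z
  *-identityˡ z = pointwise (1# * z) z
    (λ n → *-identityˡ-re (seq (re z) n) (seq (im z) n))
    (λ n → *-identityˡ-im (seq (re z) n) (seq (im z) n))

  *-zeroˡ : ∀ z → 0# * z ≈ 0#
  *-zeroˡ z = pointwise (0# * z) 0#
    (λ n → *-zeroˡ-re (seq (re z) n) (seq (im z) n))
    (λ n → *-zeroˡ-im (seq (re z) n) (seq (im z) n))

  distribˡ : ∀ u z w → u * (z + w) ≈ u * z + u * w
  distribˡ u z w = pointwise (u * (z + w)) (u * z + u * w)
    (λ n → distribˡ-re
      (seq (re u) n) (seq (im u) n) (seq (re z) n) (seq (im z) n) (seq (re w) n) (seq (im w) n))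
    (λ n → distribˡ-im
      (seq (re u) n) (seq (im u) n) (seq (re z) n) (seq (im z) n) (seq (re w) n) (seq (im w) n))

  fromℤ-homo-+ : ∀ k l → fromℤ (k ℤ.+ l) ≈ fromℤ k + fromℤ l
  fromℤ-homo-+ k l = pointwise (fromℤ (k ℤ.+ l)) (fromℤ k + fromℤ l) (λ _ → /1-homo-+ k l) (λ _ → refl)

  fromℤ-homo-* : ∀ k l → fromℤ (k ℤ.* l) ≈ fromℤ k * fromℤ l
  fromℤ-homo-* k l = pointwise (fromℤ (k ℤ.* l)) (fromℤ k * fromℤ l)
    (λ _ → ≡.trans (/1-homo-* k l) (real-*-re (k ℚ./ 1) (l ℚ./ 1)))
    (λ _ → real-*-im (k ℚ./ 1) (l ℚ./ 1))

  conj-homo-* : ∀ z w → conj (z * w) ≈ conj z * conj w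
  conj-homo-* z w = pointwise (conj (z * w)) (conj z * conj w)
    (λ n → conj-*-re
      (seq (re z) n) (seq (im z) n) (seq (re w) n) (seq (im w) n))
    (λ n → conj-*-im
      (seq (re z) n) (seq (im z) n) (seq (re w) n) (seq (im w) n))

  conj-homo-+ : ∀ z w → conj (z + w) ≈ conj z + conj w
  conj-homo-+ z w = pointwise (conj (z + w)) (conj z + conj w) (λ _ → refl) (λ n → ℚ.neg-distrib-+ (seq (im z) n) _)

  conj-fromℤ : ∀ k → conj (fromℤ k) ≈ fromℤ k
  conj-fromℤ k = pointwise (conj (fromℤ k)) (fromℤ k) (λ _ → refl) (λ _ → refl)

opaque
  unfolding _≈_ _#_

  fromℤ-injective : ∀ {k l} → fromℤ k ≈ fromℤ l → k ≡ l
  fromℤ-injective (k≈l , _) = /1-injective (constᵣ-injective k≈l)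

  fromℤ-apart : ∀ {k l} → k ≢ l → fromℤ k # fromℤ l
  fromℤ-apart k≢l = inj₁ (constᵣ-apart (k≢l ∘ /1-injective))

  #-resp-≈ : ∀ {z w u} → z ≈ w → z # u → w # u
  #-resp-≈ {z} {w} {u} (p , _) (inj₁ h) = inj₁ (#ᵣ-resp-≈ᵣ {re z} {re w} {re u} p h)
  #-resp-≈ {z} {w} {u} (_ , q) (inj₂ h) = inj₂ (#ᵣ-resp-≈ᵣ {im z} {im w} {im u} q h)

  -- This stands in for the undecidable test whether a number is 0. The real and imaginary parts are
  -- treated separately.
  +-apart : ∀ {z w} → z + w # 0# → z # 0# ⊎ w # 0#
  +-apart {z} {w} (inj₁ h) = Sum.map inj₁ inj₁ (+ᵣ-apart {re z} {re w} h)
  +-apart {z} {w} (inj₂ h) = Sum.map inj₂ inj₂ (+ᵣ-apart {im z} {im w} h)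

  -- The inverse is the conjugate of z divided by `r`, the squared modulus. One of the two squares
  -- in `r` is bounded away from 0 and the other is nonnegative, so `r` is bounded away from 0 as
  -- well.
  invertible : ∀ {z} → z # 0# → ∃[ w ] z * w ≈ 1#
  invertible {z} z#0 = (re z *ᵣ s) +i (-ᵣ (im z *ᵣ s))
    , ≈ᵣ-trans {re (z * w)} {r *ᵣ s} {constᵣ 1ℚ}
        (≐⇒≈ᵣ {re (z * w)} {r *ᵣ s} λ n → inverse-re
          (seq (re z) n) (seq (im z) n) (seq s n))
        (*ᵣ-inverseʳ r r#0)
    , ≐⇒≈ᵣ {im (z * w)} {constᵣ 0ℚ} (λ n → inverse-im (seq (re z) n) (seq (im z) n) (seq s n))
    where
    r : ℝ
    r = re z *ᵣ re z +ᵣ im z *ᵣ im z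
    square-far : ∀ {ε} p q → 0ℚ ℚ.< ε → ε ℚ.≤ ℚ.∣ p ℚ.- 0ℚ ∣ → ε ℚ.* ε ℚ.≤ ℚ.∣ p ℚ.* p ℚ.+ q ℚ.* q ∣
    square-far {ε} p q 0<ε far = begin
      ε ℚ.* ε                          ≤⟨ *-mono-≤-nonNeg (ℚ.0≤∣p∣ p) (ℚ.<⇒≤ 0<ε) far′ far′ ⟩
      ℚ.∣ p ∣ ℚ.* ℚ.∣ p ∣              ≡⟨ p*p≡∣p∣*∣p∣ p ⟨
      p ℚ.* p                          ≡⟨ ℚ.+-identityʳ (p ℚ.* p) ⟨
      p ℚ.* p ℚ.+ 0ℚ                   ≤⟨ ℚ.+-monoʳ-≤ (p ℚ.* p) (0≤p*p q) ⟩
      p ℚ.* p ℚ.+ q ℚ.* q              ≡⟨ ℚ.0≤p⇒∣p∣≡p (ℚ.+-mono-≤ (0≤p*p p) (0≤p*p q)) ⟨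
      ℚ.∣ p ℚ.* p ℚ.+ q ℚ.* q ∣        ∎
      where
      open ℚ.≤-Reasoning
      far′ : ε ℚ.≤ ℚ.∣ p ∣
      far′ = subst (λ s → ε ℚ.≤ ℚ.∣ s ∣) (ℚ.+-identityʳ p) far
    0<ε*ε : ∀ {ε} → 0ℚ ℚ.< ε → 0ℚ ℚ.< ε ℚ.* ε
    0<ε*ε {ε} 0<ε = ℚ.positive⁻¹ _ {{ℚ.pos*pos⇒pos ε {{ℚ.positive 0<ε}} ε {{ℚ.positive 0<ε}}}}
    r#0′ : z # 0# → ∃[ δ ] (0ℚ ℚ.< δ × Eventually λ n → δ ℚ.≤ ℚ.∣ seq r n ∣)
    r#0′ (inj₁ (ε , 0<ε , far)) = ε ℚ.* ε , 0<ε*ε 0<ε ,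
      map₁ (λ n → square-far (seq (re z) n) (seq (im z) n) 0<ε) far
    r#0′ (inj₂ (ε , 0<ε , far)) = ε ℚ.* ε , 0<ε*ε 0<ε ,
      map₁ (λ n h → subst (λ s → ε ℚ.* ε ℚ.≤ ℚ.∣ s ∣) (ℚ.+-comm (seq (im z) n ℚ.* seq (im z) n) _)
        (square-far (seq (im z) n) (seq (re z) n) 0<ε h)) far
    r#0 : ∃[ δ ] (0ℚ ℚ.< δ × Eventually λ n → δ ℚ.≤ ℚ.∣ seq r n ∣)
    r#0 = r#0′ z#0
    s : ℝ
    s = recipᵣ r r#0
    w : ℂ
    w = (re z *ᵣ s) +i (-ᵣ (im z *ᵣ s))

commutativeRing : CommutativeRing 0ℓ 0ℓ
commutativeRing = record
  { Carrier = ℂ ; _≈_ = _≈_ ; _+_ = _+_ ; _*_ = _*_ ; -_ = -_ ; 0# = 0# ; 1# = 1#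
  ; isCommutativeRing = record
    { isRing = record
      { +-isAbelianGroup = record
        { isGroup = record
          { isMonoid = record
            { isSemigroup = record
              { isMagma = record
                { isEquivalence = record { refl = ≈-refl ; sym = ≈-sym ; trans = ≈-trans }
                ; ∙-cong = +-cong }
              ; assoc = +-assoc }
            ; identity = +-identityˡ , λ z → ≈-trans (+-comm z 0#) (+-identityˡ z) }
          ; inverse = -‿inverseˡ , λ z → ≈-trans (+-comm z (- z)) (-‿inverseˡ z)
          ; ⁻¹-cong = *-cong ≈-refl }
        ; comm = +-comm }
      ; *-cong = *-cong
      ; *-assoc = *-assoc
      ; *-identity = *-identityˡ , λ z → ≈-trans (*-comm z 1#) (*-identityˡ z)
      ; distrib = distribˡ , distribʳ
      }
    ; *-comm = *-comm
    }
  }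
  where
  distribʳ : ∀ u z w → (z + w) * u ≈ z * u + w * u
  distribʳ u z w = ≈-trans (*-comm (z + w) u) (≈-trans (distribˡ u z w) (+-cong (*-comm u z) (*-comm u w)))
  -‿inverseˡ : ∀ z → - z + z ≈ 0#
  -‿inverseˡ z = ≈-trans (+-cong ≈-refl (≈-sym (*-identityˡ z)))
    (≈-trans (≈-sym (distribʳ z -1# 1#)) (≈-trans (*-cong (≈-sym (fromℤ-homo-+ ℤ.-1ℤ ℤ.1ℤ)) ≈-refl) (*-zeroˡ z)))

private
  -- Integer coefficients give the solver the equality test that ℂ cannot offer, and let it compute
  -- with numerals such as `fromℕ 3` and `-1#`.
  fromℤ-morphism : ℤ.+-*-rawRing -Raw-AlmostCommutative⟶ fromCommutativeRing commutativeRing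
  fromℤ-morphism = record
    { ⟦_⟧    = fromℤ
    ; +-homo = fromℤ-homo-+
    ; *-homo = fromℤ-homo-*
    ; -‿homo = λ k → ≈-trans (≈-reflexive (cong fromℤ (≡.sym (ℤ.-1*i≡-i k)))) (fromℤ-homo-* ℤ.-1ℤ k)
    ; 0-homo = ≈-refl
    ; 1-homo = ≈-refl
    }
    where
    ≈-reflexive : ∀ {z w} → z ≡ w → z ≈ w
    ≈-reflexive refl = ≈-refl

  _coeff≟_ : ∀ k l → Maybe (fromℤ k ≈ fromℤ l)
  k coeff≟ l with k ℤ.≟ l
  ... | yes refl = just ≈-refl
  ... | no _     = nothing

module ℂ-Solver = RingSolver ℤ.+-*-rawRing (fromCommutativeRing commutativeRing) fromℤ-morphism _coeff≟_

open CommutativeRing commutativeRing using (setoid; semiring; +-congˡ; +-congʳ; *-congˡ; *-congʳ;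
  *-identityʳ; +-identityʳ; zeroˡ; zeroʳ; reflexive; -‿inverseʳ; -‿cong)
open Sums semiring using (sum; sum-cong-≋; sum-replicate-zero; ∑-distrib-+; ∑-comm; sum-permute;
  *-distribˡ-sum; *-distribʳ-sum)
open import Relation.Binary.Reasoning.Setoid setoid
open ℂ-Solver using (solve; _:=_; _:+_; _:*_; :-_; con)

-- Units

Invertible : ℂ → Set
Invertible z = ∃[ w ] z * w ≈ 1#

Invertible-resp : ∀ {z w} → z ≈ w → Invertible z → Invertible w
Invertible-resp z≈w (t , zt≈1) = t , ≈-trans (*-congʳ (≈-sym z≈w)) zt≈1

-- From a product known to be apart from 0 this recovers that a chosen factor is a unit, with no
-- case distinction.
*-invertibleˡ : ∀ {z} w → Invertible (z * w) → Invertible z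
*-invertibleˡ {z} w (t , eq) = w * t , ≈-trans (≈-sym (*-assoc z w t)) eq

*-cancel-invertible : ∀ {z u w} → Invertible z → u * z ≈ w * z → u ≈ w
*-cancel-invertible {z} {u} {w} (t , zt≈1) eq = begin
  u              ≈⟨ *-identityʳ u ⟨
  u * 1#         ≈⟨ *-congˡ zt≈1 ⟨
  u * (z * t)    ≈⟨ *-assoc u z t ⟨
  (u * z) * t    ≈⟨ *-congʳ eq ⟩
  (w * z) * t    ≈⟨ *-assoc w z t ⟩
  w * (z * t)    ≈⟨ *-congˡ zt≈1 ⟩
  w * 1#         ≈⟨ *-identityʳ w ⟩
  w              ∎

invertible⇒≉0 : ∀ {z} → Invertible z → ¬ z ≈ 0#
invertible⇒≉0 {z} (t , zt≈1) z≈0 with () ← fromℤ-injective (≈-trans (≈-sym zt≈1) (≈-trans (*-congʳ z≈0) (zeroˡ t)))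

#0⇒≉0 : ∀ {z} → z # 0# → ¬ z ≈ 0#
#0⇒≉0 z#0 = invertible⇒≉0 (invertible z#0)

1#0 : 1# # 0#
1#0 = fromℤ-apart λ ()

-- Sums

δ : ∀ {n} → Fin n → Fin n → ℂ
δ y z = if does (y Fin.≟ z) then 1# else 0#

δ-refl : ∀ {n} (y : Fin n) → δ y y ≈ 1#
δ-refl y = reflexive (cong (if_then 1# else 0#) (dec-true (y Fin.≟ y) refl))

δ-≢ : ∀ {n} {y z : Fin n} → y ≢ z → δ y z ≈ 0#
δ-≢ {y = y} {z} y≢z = reflexive (cong (if_then 1# else 0#) (dec-false (y Fin.≟ z) y≢z))

δ-sym : ∀ {n} (y z : Fin n) → δ y z ≈ δ z y
δ-sym y z with y Fin.≟ z
... | yes refl = ≈-sym (δ-refl y)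
... | no  y≢z  = ≈-sym (δ-≢ (y≢z ∘ ≡.sym))

δ-subst : ∀ {n} (f : Fin n → ℂ) y z → δ y z * f z ≈ δ y z * f y
δ-subst f y z with y Fin.≟ z
... | yes refl = ≈-refl
... | no  _    = ≈-trans (zeroˡ (f z)) (≈-sym (zeroˡ (f y)))

sum-zero : ∀ {n} {f : Fin n → ℂ} → (∀ i → f i ≈ 0#) → sum f ≈ 0#
sum-zero {n} f≈0 = ≈-trans (sum-cong-≋ f≈0) (sum-replicate-zero n)

-- The constant `c` in place of 1 makes this cover the rows of `E* i` together with those of the
-- identity matrix.
sum-if : ∀ {n} y c (v : Vector ℂ n) → sum (λ z → (if does (y Fin.≟ z) then c else 0#) * v z) ≈ c * v y
sum-if zero c v = ≈-trans (+-congˡ (sum-zero λ z → zeroˡ (v (suc z)))) (+-identityʳ _)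
sum-if (suc y) c v = ≈-trans (+-congʳ (zeroˡ (v zero))) (≈-trans (+-identityˡ _) (sum-if y c (v ∘ suc)))

sum-δ : ∀ {n} y (v : Vector ℂ n) → sum (λ z → δ y z * v z) ≈ v y
sum-δ y v = ≈-trans (sum-if y 1# v) (*-identityˡ (v y))

sum-δʳ : ∀ {n} y (v : Vector ℂ n) → sum (λ z → v z * δ z y) ≈ v y
sum-δʳ y v = ≈-trans (sum-cong-≋ λ z → ≈-trans (*-comm (v z) (δ z y)) (*-congʳ (δ-sym z y))) (sum-δ y v)

sum-δ-one : ∀ {n} (y : Fin n) → sum (δ y) ≈ 1#
sum-δ-one y = ≈-trans (sum-cong-≋ λ z → ≈-sym (*-identityʳ (δ y z))) (sum-δ y λ _ → 1#)

sum-one : ∀ n → sum {n} (λ _ → 1#) ≈ fromℕ n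
sum-one zero = ≈-refl
sum-one (suc n) = ≈-trans (+-congˡ (sum-one n)) (≈-sym (fromℤ-homo-+ (ℤ.+ 1) (ℤ.+ n)))

sum-linear : ∀ {n} c (f g : Vector ℂ n) → sum (λ y → f y + c * g y) ≈ sum f + c * sum g
sum-linear c f g = ≈-trans (∑-distrib-+ f (λ y → c * g y)) (+-congˡ (≈-sym (*-distribˡ-sum c g)))

-- Linear combinations

module _ {I : Set} where

  combine-closed : (P : (I → ℂ) → Set) → P (λ _ → 0#) → (∀ {u v} → P u → P v → P (λ i → u i + v i)) →
                   (∀ a {v} → P v → P (λ i → a * v i)) →
                   ∀ {k} (a : Vector ℂ k) v → (∀ j → P (v j)) → P (combine a v)
  combine-closed P P0 P+ P* {zero}  a v Pv = P0
  combine-closed P P0 P+ P* {suc k} a v Pv =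
    P+ (P* (a zero) (Pv zero)) (combine-closed P P0 P+ P* (a ∘ suc) (v ∘ suc) (Pv ∘ suc))

  combine-zero : ∀ {k} (a : Vector ℂ k) (v : Vector (I → ℂ) k) → (∀ j → a j ≈ 0#) → combine a v ≋ λ _ → 0#
  combine-zero a v a≈0 i = sum-zero λ j → ≈-trans (*-congʳ (a≈0 j)) (zeroˡ (v j i))

  combine-linear : ∀ {k} c (a b : Vector ℂ k) (v : Vector (I → ℂ) k) i →
                   combine (λ j → a j + c * b j) v i ≈ combine a v i + c * combine b v i
  combine-linear c a b v i = ≈-trans
    (sum-cong-≋ λ j → solve 4 (λ a b c v → (a :+ c :* b) :* v := a :* v :+ c :* (b :* v))
        ≈-refl (a j) (b j) c (v j i))
    (sum-linear c (λ j → a j * v j i) (λ j → b j * v j i))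

  Span : ∀ {k} → Vector (I → ℂ) k → (I → ℂ) → Set
  Span v u = ∃[ a ] u ≋ combine a v

  module _ {k : ℕ} (v : Vector (I → ℂ) k) where

    Span-resp : ∀ {u w} → u ≋ w → Span v u → Span v w
    Span-resp u≋w (a , eq) = a , λ i → ≈-trans (≈-sym (u≋w i)) (eq i)

    Span-zero : Span v (λ _ → 0#)
    Span-zero = (λ _ → 0#) , λ i → ≈-sym (combine-zero (λ _ → 0#) v (λ _ → ≈-refl) i)

    Span-+ : ∀ {u w} → Span v u → Span v w → Span v (λ i → u i + w i)
    Span-+ (a , p) (b , q) = (λ j → a j + 1# * b j) , λ i →
      ≈-trans (+-cong (p i) (≈-trans (q i) (≈-sym (*-identityˡ _)))) (≈-sym (combine-linear 1# a b v i))

    Span-* : ∀ c {u} → Span v u → Span v (λ i → c * u i)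
    Span-* c (a , p) = (λ j → c * a j) , λ i → ≈-trans (*-congˡ (p i))
      (≈-trans (*-distribˡ-sum c (λ j → a j * v j i)) (sum-cong-≋ λ j → ≈-sym (*-assoc c (a j) (v j i))))

    Span-gen : ∀ j → Span v (v j)
    Span-gen j = δ j , λ i → ≈-sym (sum-δ j (λ l → v l i))

-- Matrices acting on vectors

module _ {n : ℕ} where

  ·-cong : ∀ (M : Mat n) {u v} → u ≋ v → M · u ≋ M · v
  ·-cong M u≋v y = sum-cong-≋ λ z → *-congˡ (u≋v z)

  ·-congˡ : ∀ {M N : Mat n} v → (∀ y z → M y z ≈ N y z) → M · v ≋ N · v
  ·-congˡ v M≈N y = sum-cong-≋ λ z → *-congʳ (M≈N y z)

  ·-zero : ∀ (M : Mat n) → M · (λ _ → 0#) ≋ λ _ → 0#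
  ·-zero M y = sum-zero λ z → zeroʳ (M y z)

  ·-+ : ∀ (M : Mat n) u v → M · (λ y → u y + v y) ≋ λ y → (M · u) y + (M · v) y
  ·-+ M u v y = ≈-trans (sum-cong-≋ λ z → distribˡ (M y z) (u z) (v z))
    (∑-distrib-+ (λ z → M y z * u z) (λ z → M y z * v z))

  ·-* : ∀ (M : Mat n) c v → M · (λ y → c * v y) ≋ λ y → c * (M · v) y
  ·-* M c v y = ≈-trans
    (sum-cong-≋ λ z → solve 3 (λ m c v → m :* (c :* v) := c :* (m :* v)) ≈-refl (M y z) c (v z))
    (≈-sym (*-distribˡ-sum c (λ z → M y z * v z)))

  ·-combine : ∀ (M : Mat n) {k} a (v : Vector (Vector ℂ n) k) → M · combine a v ≋ combine a (λ j → M · v j)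
  ·-combine M {zero}  a v = ·-zero M
  ·-combine M {suc k} a v y = ≈-trans (·-+ M (λ z → a zero * v zero z) (combine (a ∘ suc) (v ∘ suc)) y)
    (+-cong (·-* M (a zero) (v zero) y) (·-combine M (a ∘ suc) (v ∘ suc) y))

  δ· : ∀ (v : Vector ℂ n) → δ · v ≋ v
  δ· v y = sum-δ y v

  +· : ∀ (M N : Mat n) v → (λ y z → M y z + N y z) · v ≋ λ y → (M · v) y + (N · v) y
  +· M N v y = ≈-trans
    (sum-cong-≋ λ z → solve 3 (λ a b v → (a :+ b) :* v := a :* v :+ b :* v) ≈-refl (M y z) (N y z) (v z))
    (∑-distrib-+ (λ z → M y z * v z) (λ z → N y z * v z))

  *· : ∀ c (M : Mat n) v → (λ y z → c * M y z) · v ≋ λ y → c * (M · v) y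
  *· c M v y = ≈-trans (sum-cong-≋ λ z → *-assoc c (M y z) (v z)) (≈-sym (*-distribˡ-sum c (λ z → M y z * v z)))

  mul· : ∀ (M N : Mat n) v → (λ y z → sum λ w → M y w * N w z) · v ≋ M · N · v
  mul· M N v y = begin
    sum (λ z → sum (λ w → M y w * N w z) * v z)    ≈⟨ sum-cong-≋ (λ z → *-distribʳ-sum (v z) (λ w → M y w * N w z)) ⟩
    sum (λ z → sum (λ w → M y w * N w z * v z))    ≈⟨ ∑-comm (λ z w → M y w * N w z * v z) ⟩
    sum (λ w → sum (λ z → M y w * N w z * v z))
      ≈⟨ sum-cong-≋ (λ w → sum-cong-≋ λ z → *-assoc (M y w) (N w z) (v z)) ⟩
    sum (λ w → sum (λ z → M y w * (N w z * v z)))  ≈⟨ sum-cong-≋ (λ w → *-distribˡ-sum (M y w) (λ z → N w z * v z)) ⟨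
    sum (λ w → M y w * (N · v) w)                  ∎

-- Terwilliger modules of an arbitrary graph

module Modules {n : ℕ} (Γ : Graph n) (x : Fin n) where

  open Terwilliger Γ x
  open TModule

  E*· : ∀ i v y → (E* i · v) y ≈ e* i y * v y
  E*· i v y = sum-if y (e* i y) v

  record IsSubspace (P : V → Set) : Set where
    field
      ≋-resp : ∀ {u v} → u ≋ v → P u → P v
      zero∈  : P (λ _ → 0#)
      +∈     : ∀ {u v} → P u → P v → P (λ y → u y + v y)
      *∈     : ∀ a {v} → P v → P (λ y → a * v y)

  Span-isSubspace : ∀ {k} (v : Vector V k) → IsSubspace (Span v)
  Span-isSubspace v = record { ≋-resp = Span-resp v ; zero∈ = Span-zero v ; +∈ = Span-+ v ; *∈ = Span-* v }

  module _ {P : V → Set} (P-sub : IsSubspace P) where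
    open IsSubspace P-sub

    -- Induction on the generation of T: for a subspace, invariance passes from the generators to
    -- sums, multiples and products.
    closed-under-T : (∀ {v} → P v → P (A · v)) → (∀ i → i ℕ.≤ Graph.diam Γ → ∀ {v} → P v → P (E* i · v)) →
                     ∀ {B} → T B → ∀ {v} → P v → P (B · v)
    closed-under-T cA cE A∈T p = cA p
    closed-under-T cA cE (E*∈T i i≤D) p = cE i i≤D p
    closed-under-T cA cE one {v} p = ≋-resp (λ y → ≈-sym (δ· v y)) p
    closed-under-T cA cE (add {B} {C} b c) {v} p = ≋-resp (λ y → ≈-sym (+· B C v y))
      (+∈ (closed-under-T cA cE b p) (closed-under-T cA cE c p))
    closed-under-T cA cE (scale a {B} b) {v} p = ≋-resp (λ y → ≈-sym (*· a B v y)) (*∈ a (closed-under-T cA cE b p))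
    closed-under-T cA cE (mul {B} {C} b c) {v} p = ≋-resp (λ y → ≈-sym (mul· B C v y))
      (closed-under-T cA cE b (closed-under-T cA cE c p))
    closed-under-T cA cE (resp B≈C b) {v} p = ≋-resp (·-congˡ v B≈C) (closed-under-T cA cE b p)

    toModule : (∀ {v} → P v → P (A · v)) → (∀ i → i ℕ.≤ Graph.diam Γ → ∀ {v} → P v → P (E* i · v)) → TModule
    toModule cA cE = record
      { Mem = P ; ∈-resp = ≋-resp ; ∈-zero = zero∈ ; ∈-add = +∈ ; ∈-scale = *∈
      ; T-closed = λ B∈T → closed-under-T cA cE B∈T }

  Span-· : ∀ M {k} {v : Vector V k} → (∀ j → Span v (M · v j)) → ∀ {u} → Span v u → Span v (M · u)
  Span-· M {v = v} gens {u} (a , eq) = Span-resp v (λ y → ≈-sym (≈-trans (·-cong M eq y) (·-combine M a v y)))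
    (combine-closed (Span v) (Span-zero v) (Span-+ v) (Span-* v) a (λ j → M · v j) gens)

  spanModule : ∀ {k} (v : Vector V k) → (∀ j → Span v (A · v j)) →
               (∀ i → i ℕ.≤ Graph.diam Γ → ∀ j → Span v (E* i · v j)) → TModule
  spanModule v cA cE = toModule (Span-isSubspace v) (Span-· A cA) (λ i i≤D → Span-· (E* i) (cE i i≤D))

  ⊆-antisym⇒≅ : ∀ U W → U ⊆ W → W ⊆ U → U ≅ W
  ⊆-antisym⇒≅ U W U⊆W W⊆U = record
    { to = λ (u , u∈U) → u , U⊆W u u∈U
    ; isLinearIso = record
      { isLeftModuleMonomorphism = record
        { isLeftModuleHomomorphism = record
          { +ᴹ-isGroupHomomorphism = record
            { isMonoidHomomorphism = record
              { isMagmaHomomorphism = record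
                { isRelHomomorphism = record { cong = λ u≋v → u≋v }
                ; homo = λ _ _ _ → ≈-refl }
              ; ε-homo = λ _ → ≈-refl }
            ; ⁻¹-homo = λ _ _ → ≈-refl }
          ; *ₗ-homo = λ _ _ _ → ≈-refl }
        ; injective = λ u≋v → u≋v }
      ; surjective = λ (w , w∈W) → (w , W⊆U w w∈W) , λ z≋w → z≋w }
    ; commutes = λ _ _ _ → ≈-refl }

  module _ {U W : TModule} (iso : U ≅ W) where
    open _≅_ iso
    open LeftModuleMorphisms.IsLeftModuleIsomorphism isLinearIso

    -- Isomorphic modules have the same annihilator in T. Injectivity gives this direction and
    -- surjectivity the next one; both serve to show that modules of different types are not
    -- isomorphic.
    ≅-annihilatesˡ : ∀ {B} → T B → (∀ w → Mem W w → B · w ≋ λ _ → 0#) → ∀ u → Mem U u → B · u ≋ λ _ → 0#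
    ≅-annihilatesˡ B∈T kill u u∈U = injective {act U B∈T (u , u∈U)} {_ , ∈-zero U} λ y →
      ≈-trans (commutes B∈T (u , u∈U) y)
        (≈-trans (kill (proj₁ (to (u , u∈U))) (proj₂ (to (u , u∈U))) y) (≈-sym (0ᴹ-homo y)))

    ≅-annihilatesʳ : ∀ {B} → T B → (∀ u → Mem U u → B · u ≋ λ _ → 0#) → ∀ w → Mem W w → B · w ≋ λ _ → 0#
    ≅-annihilatesʳ {B} B∈T kill w w∈W y =
      let ((u , u∈U) , to-u) = surjective (w , w∈W)
      in begin
        (B · w) y                             ≈⟨ ·-cong B (λ z → ≈-sym (to-u {u , u∈U} (λ _ → ≈-refl) z)) y ⟩
        (B · proj₁ (to (u , u∈U))) y          ≈⟨ commutes B∈T (u , u∈U) y ⟨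
        proj₁ (to (act U B∈T (u , u∈U))) y    ≈⟨ ⟦⟧-cong {act U B∈T (u , u∈U)} {_ , ∈-zero U} (kill u u∈U) y ⟩
        proj₁ (to (_ , ∈-zero U)) y           ≈⟨ 0ᴹ-homo y ⟩
        0#                                    ∎

  -- The span of one vector, without the trailing `+ 0#` that `combine` produces.
  Line : V → V → Set
  Line u v = ∃[ a ] v ≋ λ y → a * u y

  Line⇒Span : ∀ u {v} → Line u v → Span (u ∷ []) v
  Line⇒Span u (a , eq) = (λ _ → a) , λ y → ≈-trans (eq y) (≈-sym (+-identityʳ _))

  Span⇒Line : ∀ u {v} → Span (u ∷ []) v → Line u v
  Span⇒Line u (a , eq) = a zero , λ y → ≈-trans (eq y) (+-identityʳ _)

  line-independent : ∀ {u : V} → Nonzero u → LinearlyIndependent (u ∷ [])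
  line-independent {u} (y , uy#0) a eq zero = *-cancel-invertible (invertible uy#0)
    (≈-trans (≈-sym (+-identityʳ _)) (≈-trans (eq y) (≈-sym (zeroˡ (u y)))))

  line-basis : ∀ {P} {u : V} → P u → Nonzero u → (∀ v → P v → Line u v) → IsBasis (u ∷ []) P
  line-basis {u = u} Pu u#0 gen = ((λ { zero → Pu }) , λ v Pv → Line⇒Span u (gen v Pv)) , line-independent u#0

  -- The map sends a u to a w. It is well defined because a nonzero u determines its coefficient,
  -- and it commutes with T because each element of T acts on both lines by one scalar.
  line-≅ : ∀ U W {u w} → Nonzero u → Nonzero w → Mem W w →
           (∀ v → Mem U v → Line u v) → (∀ v → Mem W v → Line w v) → Mem U u →
           (∀ {B} → T B → ∃[ χ ] (B · u ≋ (λ y → χ * u y) × B · w ≋ λ y → χ * w y)) → U ≅ W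
  line-≅ U W {u} {w} (yᵤ , u#0) (y𝓌 , w#0) w∈W genᵤ gen𝓌 u∈U χ = record
    { to = to
    ; isLinearIso = record
      { isLeftModuleMonomorphism = record
        { isLeftModuleHomomorphism = record
          { +ᴹ-isGroupHomomorphism = record
            { isMonoidHomomorphism = record
              { isMagmaHomomorphism = record
                { isRelHomomorphism = record { cong = λ {p} {q} p≋q y → *-congʳ (coord-unique p (coord q) λ z → ≈-trans (p≋q z) (coord-eq q z)) }
                ; homo = λ p q y → ≈-trans
                    (*-congʳ (coord-unique (_ , ∈-add U (proj₂ p) (proj₂ q)) (coord p + coord q) λ z →
                      ≈-trans (+-cong (coord-eq p z) (coord-eq q z))
                        (solve 3 (λ a b u → a :* u :+ b :* u := (a :+ b) :* u) ≈-refl (coord p) (coord q) (u z))))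
                    (solve 3 (λ a b w → (a :+ b) :* w := a :* w :+ b :* w) ≈-refl (coord p) (coord q) (w y)) }
              ; ε-homo = λ y → ≈-trans
                  (*-congʳ (coord-unique (_ , ∈-zero U) 0# λ z → ≈-sym (zeroˡ (u z)))) (zeroˡ (w y)) }
            ; ⁻¹-homo = λ p → homo-* -1# p }
          ; *ₗ-homo = homo-* }
        ; injective = λ {p} {q} p≋q y → ≈-trans (coord-eq p y) (≈-trans
            (*-congʳ (*-cancel-invertible (invertible w#0) (p≋q y𝓌))) (≈-sym (coord-eq q y))) }
      ; surjective = λ (v , v∈W) → let (a , v≋aw) = gen𝓌 v v∈W in
          (_ , ∈-scale U a u∈U) , λ {p} p≋au y → ≈-trans (*-congʳ (coord-unique p a p≋au)) (≈-sym (v≋aw y)) }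
    ; commutes = λ {B} B∈T p y → let (c , Bu , Bw) = χ B∈T in begin
        coord (act U B∈T p) * w y       ≈⟨ *-congʳ (coord-unique (act U B∈T p) (coord p * c) λ z →
                                            ≈-trans (·-cong B (coord-eq p) z) (≈-trans (·-* B (coord p) u z)
                                              (≈-trans (*-congˡ (Bu z)) (≈-sym (*-assoc (coord p) c (u z)))))) ⟩
        coord p * c * w y               ≈⟨ *-assoc (coord p) c (w y) ⟩
        coord p * (c * w y)             ≈⟨ *-congˡ (Bw y) ⟨
        coord p * (B · w) y             ≈⟨ ·-* B (coord p) w y ⟨
        (B · (λ z → coord p * w z)) y   ∎ }
    where
    coord : Σ V (Mem U) → ℂ
    coord (v , v∈U) = proj₁ (genᵤ v v∈U)
    coord-eq : ∀ p → proj₁ p ≋ λ y → coord p * u y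
    coord-eq (v , v∈U) = proj₂ (genᵤ v v∈U)
    coord-unique : ∀ p a → (proj₁ p ≋ λ y → a * u y) → coord p ≈ a
    coord-unique p a eq = *-cancel-invertible (invertible u#0) (≈-trans (≈-sym (coord-eq p yᵤ)) (eq yᵤ))
    to : Σ V (Mem U) → Σ V (Mem W)
    to p = (λ y → coord p * w y) , ∈-scale W (coord p) w∈W
    homo-* : ∀ a p y → coord (_ , ∈-scale U a (proj₂ p)) * w y ≈ a * (coord p * w y)
    homo-* a p y = ≈-trans
      (*-congʳ (coord-unique (_ , ∈-scale U a (proj₂ p)) (a * coord p) λ z →
        ≈-trans (*-congˡ (coord-eq p z)) (≈-sym (*-assoc a (coord p) (u z)))))
      (*-assoc a (coord p) (w y))

  -- part y i is the component in W i of the unit vector at y, so that part _ i _ is the matrix of a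
  -- projection onto W i, whose trace is the dimension of W i.
  module _ {m : ℕ} {W : Fin m → TModule} (⨁W : IsOrthogonalDirectSum W) where
    open IsOrthogonalDirectSum ⨁W

    part : Fin n → Fin m → V
    part y = proj₁ (decompose (δ y))

    part∈ : ∀ y i → Mem (W i) (part y i)
    part∈ y = proj₁ (proj₂ (decompose (δ y)))

    sum-part : ∀ y → δ y ≋ λ z → sum λ i → part y i z
    sum-part y = proj₂ (proj₂ (decompose (δ y)))

    -- Expanding u in unit vectors and decomposing each of them gives components `c`, while u
    -- itself, placed in the summand i, is another decomposition of u. Their differences `d` sum to
    -- 0, so directness makes them vanish.
    part-project : ∀ i {u} → Mem (W i) u → (λ z → sum λ y → u y * part y i z) ≋ u
    part-project i {u} u∈Wi z = begin
      c i z
        ≈⟨ solve 2 (λ c u → c := (c :+ con ℤ.-1ℤ :* (con ℤ.1ℤ :* u)) :+ u) ≈-refl (c i z) (u z) ⟩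
      c i z + -1# * (1# * u z) + u z            ≈⟨ +-congʳ (+-congˡ (*-congˡ (*-congʳ (δ-refl i)))) ⟨
      c i z + -1# * (δ i i * u z) + u z         ≈⟨ +-congʳ (direct d d∈ d-sum i z) ⟩
      0# + u z                                  ≈⟨ +-identityˡ (u z) ⟩
      u z                                       ∎
      where
      c d : Fin m → V
      c j z = sum λ y → u y * part y j z
      d j z = c j z + -1# * (δ i j * u z)
      picked : ∀ j → Mem (W j) (λ z → δ i j * u z)
      picked j with i Fin.≟ j
      ... | yes refl = ∈-scale (W i) 1# u∈Wi
      ... | no _ = ∈-resp (W j) (λ z → ≈-sym (zeroˡ (u z))) (∈-zero (W j))
      d∈ : ∀ j → Mem (W j) (d j)
      d∈ j = ∈-add (W j)
        (combine-closed (Mem (W j)) (∈-zero (W j)) (∈-add (W j)) (∈-scale (W j)) u (λ y → part y j) (λ y → part∈ y j))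
        (∈-scale (W j) -1# (picked j))
      d-sum : (λ z → sum λ j → d j z) ≋ λ _ → 0#
      d-sum z = begin
        sum (λ j → d j z)
          ≈⟨ sum-linear -1# (λ j → c j z) (λ j → δ i j * u z) ⟩
        sum (λ j → c j z) + -1# * sum (λ j → δ i j * u z)
          ≈⟨ +-cong (∑-comm (λ j y → u y * part y j z)) (*-congˡ (sum-δ i (λ _ → u z))) ⟩
        sum (λ y → sum λ j → u y * part y j z) + -1# * u z
          ≈⟨ +-congʳ (sum-cong-≋ λ y → *-distribˡ-sum (u y) (λ j → part y j z)) ⟨
        sum (λ y → u y * sum (λ j → part y j z)) + -1# * u z
          ≈⟨ +-congʳ (sum-cong-≋ λ y → *-congˡ (sum-part y z)) ⟨
        sum (λ y → u y * δ y z) + -1# * u z                            ≈⟨ +-congʳ (sum-δʳ z u) ⟩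
        u z + -1# * u z                                                ≈⟨ -‿inverseʳ (u z) ⟩
        0#                                                             ∎

    -- Written in the basis v, the projection has coefficients `a` that are dual to v: it fixes each
    -- v j, so independence forces the pairing `c j l` to be δ j l. Exchanging the sums turns the
    -- trace into the sum of the `c l l`.
    part-trace : ∀ i {k} → HasDim (Mem (W i)) k → sum (λ y → part y i y) ≈ fromℕ k
    part-trace i {k} (v , (v∈ , spans) , independent) = begin
      sum (λ y → part y i y)                        ≈⟨ sum-cong-≋ (λ y → a-eq y y) ⟩
      sum (λ y → sum λ l → a y l * v l y)           ≈⟨ ∑-comm (λ y l → a y l * v l y) ⟩
      sum (λ l → sum λ y → a y l * v l y)           ≈⟨ sum-cong-≋ (λ l → sum-cong-≋ λ y → *-comm (a y l) (v l y)) ⟩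
      sum (λ l → c l l)                             ≈⟨ sum-cong-≋ (λ l → ≈-trans (dual l l) (δ-refl l)) ⟩
      sum {k} (λ l → 1#)                            ≈⟨ sum-one k ⟩
      fromℕ k                                       ∎
      where
      a : Fin n → Fin k → ℂ
      a y = proj₁ (spans (part y i) (part∈ y i))
      a-eq : ∀ y → part y i ≋ combine (a y) v
      a-eq y = proj₂ (spans (part y i) (part∈ y i))
      c : Fin k → Fin k → ℂ
      c j l = sum λ y → v j y * a y l
      c-eq : ∀ j → combine (c j) v ≋ v j
      c-eq j z = begin
        sum (λ l → c j l * v l z)
          ≈⟨ sum-cong-≋ (λ l → *-distribʳ-sum (v l z) (λ y → v j y * a y l)) ⟩
        sum (λ l → sum λ y → v j y * a y l * v l z)          ≈⟨ ∑-comm (λ l y → v j y * a y l * v l z) ⟩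
        sum (λ y → sum λ l → v j y * a y l * v l z)
          ≈⟨ sum-cong-≋ (λ y → sum-cong-≋ λ l → *-assoc (v j y) (a y l) (v l z)) ⟩
        sum (λ y → sum λ l → v j y * (a y l * v l z))
          ≈⟨ sum-cong-≋ (λ y → *-distribˡ-sum (v j y) (λ l → a y l * v l z)) ⟨
        sum (λ y → v j y * combine (a y) v z)                ≈⟨ sum-cong-≋ (λ y → *-congˡ (a-eq y z)) ⟨
        sum (λ y → v j y * part y i z)                       ≈⟨ part-project i (v∈ j) z ⟩
        v j z                                                ∎
      dual : ∀ j l → c j l ≈ δ j l
      dual j l = begin
        c j l                          ≈⟨ solve 2 (λ c d → c := (c :+ con ℤ.-1ℤ :* d) :+ d) ≈-refl (c j l) (δ j l) ⟩
        c j l + -1# * δ j l + δ j l    ≈⟨ +-congʳ (independent (λ l → c j l + -1# * δ j l) (λ z → begin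
          combine (λ l → c j l + -1# * δ j l) v z          ≈⟨ combine-linear -1# (c j) (δ j) v z ⟩
          combine (c j) v z + -1# * combine (δ j) v z      ≈⟨ +-cong (c-eq j z) (*-congˡ (sum-δ j (λ l → v l z))) ⟩
          v j z + -1# * v j z                              ≈⟨ -‿inverseʳ (v j z) ⟩
          0#                                               ∎) l) ⟩
        0# + δ j l                     ≈⟨ +-identityˡ (δ j l) ⟩
        δ j l                          ∎

    -- The projections add up to the identity matrix, whose trace is n; no bases have to be merged
    -- or compared.
    dimension-⨁ : ∀ {d : Fin m → ℕ} → (∀ i → HasDim (Mem (W i)) (d i)) → sum (λ i → fromℕ (d i)) ≈ fromℕ n
    dimension-⨁ {d} dims = begin
      sum (λ i → fromℕ (d i))               ≈⟨ sum-cong-≋ (λ i → part-trace i (dims i)) ⟨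
      sum (λ i → sum λ y → part y i y)      ≈⟨ ∑-comm (λ i y → part y i y) ⟩
      sum (λ y → sum λ i → part y i y)      ≈⟨ sum-cong-≋ {n} (λ y → sum-part y y) ⟨
      sum {n} (λ y → δ y y)                  ≈⟨ sum-cong-≋ {n} (λ y → δ-refl y) ⟩
      sum {n} (λ y → 1#)                    ≈⟨ sum-one n ⟩
      fromℕ n                               ∎

private
  k0 k1 k2 k3 : ∀ {n} → ℂ-Solver.Polynomial n
  k0 = con (ℤ.+ 0)
  k1 = con (ℤ.+ 1)
  k2 = con (ℤ.+ 2)
  k3 = con (ℤ.+ 3)

-- Eigenvalues of the representing matrices

fromℤ-invertible : ∀ {k} → k ≢ ℤ.+ 0 → Invertible (fromℤ k)
fromℤ-invertible k≢0 = invertible (fromℤ-apart k≢0)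

*-cancel-zero : ∀ {z u} → Invertible z → u * z ≈ 0# → u ≈ 0#
*-cancel-zero {z} inv eq = *-cancel-invertible inv (≈-trans eq (≈-sym (zeroˡ z)))

difference-zero : ∀ {u w} → u + - w ≈ 0# → u ≈ w
difference-zero {u} {w} eq = begin
  u                ≈⟨ solve 2 (λ u w → u := (u :+ :- w) :+ w) ≈-refl u w ⟩
  u + - w + w      ≈⟨ +-congʳ eq ⟩
  0# + w           ≈⟨ +-identityˡ w ⟩
  w                ∎

-- Since (3 − θ) + (θ + 1) = 4, one of the two factors is apart from 0, and the other one vanishes.
root : ∀ {θ z} → z # 0# → (θ + - fromℕ 3) * (θ + 1#) * z ≈ 0# → θ ≈ fromℕ 3 ⊎ θ ≈ -1#
root {θ} {z} z#0 eq = Sum.map left right (+-apart {θ + 1#} {fromℕ 3 + - θ} (#-resp-≈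
    (solve 1 (λ θ → con (ℤ.+ 4) := (θ :+ k1) :+ (k3 :+ :- θ)) ≈-refl θ) (fromℤ-apart {ℤ.+ 4} {ℤ.+ 0} λ ())))
  where
  product : (θ + - fromℕ 3) * (θ + 1#) ≈ 0#
  product = *-cancel-zero (invertible z#0) eq
  left : θ + 1# # 0# → θ ≈ fromℕ 3
  left h = difference-zero (*-cancel-zero (invertible h) product)
  right : fromℕ 3 + - θ # 0# → θ ≈ -1#
  right h = difference-zero (*-cancel-zero (invertible h) (begin
    (θ + - -1#) * (fromℕ 3 + - θ)
      ≈⟨ solve 1 (λ θ → (θ :+ :- con ℤ.-1ℤ) :* (k3 :+ :- θ) := :- ((θ :+ :- k3) :* (θ :+ k1))) ≈-refl θ ⟩
    - ((θ + - fromℕ 3) * (θ + 1#))  ≈⟨ -‿cong product ⟩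
    - 0#                            ≈⟨ zeroʳ -1# ⟩
    0#                              ∎))

W₀-matrix : Mat 2
W₀-matrix = (fromℕ 0 ∷ fromℕ 3 ∷ []) ∷ (fromℕ 1 ∷ fromℕ 2 ∷ []) ∷ []

-- The characteristic polynomial (θ - 3)(θ + 1) kills both coordinates of an eigenvector, and one of
-- them is apart from 0, so `root` applies.
W₀-eigenvalues : EigenvaluesAre W₀-matrix (fromℕ 3 List.∷ -1# List.∷ List.[])
W₀-eigenvalues θ = mk⇔ to from
  where
  to : IsEigenvalue W₀-matrix θ → Any (θ ≈_) (fromℕ 3 List.∷ -1# List.∷ List.[])
  to (v , (i , vi#0) , eq) = Sum.[ here , there ∘ here ]′ (root vi#0 (vanish i))
    where
    a = v zero
    b = v (suc zero)
    eq₀ : fromℕ 3 * b ≈ θ * a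
    eq₀ = ≈-trans (solve 2 (λ a b → k3 :* b := k0 :* a :+ (k3 :* b :+ k0)) ≈-refl a b) (eq zero)
    eq₁ : a ≈ θ * b + - (fromℕ 2 * b)
    eq₁ = begin
      a  ≈⟨ solve 2 (λ a b → a := (k1 :* a :+ (k2 :* b :+ k0)) :+ :- (k2 :* b)) ≈-refl a b ⟩
      fromℕ 1 * a + (fromℕ 2 * b + 0#) + - (fromℕ 2 * b)  ≈⟨ +-congʳ (eq (suc zero)) ⟩
      θ * b + - (fromℕ 2 * b)  ∎
    -- The second row says a = (θ - 2) b; put into the first row, it leaves θ² - 2θ - 3 times b.
    vanish-b : (θ + - fromℕ 3) * (θ + 1#) * b ≈ 0#
    vanish-b = begin
      (θ + - fromℕ 3) * (θ + 1#) * b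
        ≈⟨ solve 2 (λ θ b → (θ :+ :- k3) :* (θ :+ k1) :* b := θ :* (θ :* b :+ :- (k2 :* b)) :+ :- (k3 :* b))
            ≈-refl θ b ⟩
      θ * (θ * b + - (fromℕ 2 * b)) + - (fromℕ 3 * b)  ≈⟨ +-cong (*-congˡ (≈-sym eq₁)) (-‿cong eq₀) ⟩
      θ * a + - (θ * a)  ≈⟨ -‿inverseʳ (θ * a) ⟩
      0#  ∎
    vanish : ∀ i → (θ + - fromℕ 3) * (θ + 1#) * v i ≈ 0#
    vanish zero = begin
      (θ + - fromℕ 3) * (θ + 1#) * a                        ≈⟨ *-congˡ eq₁ ⟩
      (θ + - fromℕ 3) * (θ + 1#) * (θ * b + - (fromℕ 2 * b))
        ≈⟨ solve 2 (λ θ b → (θ :+ :- k3) :* (θ :+ k1) :* (θ :* b :+ :- (k2 :* b))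
             := (θ :+ :- k2) :* ((θ :+ :- k3) :* (θ :+ k1) :* b)) ≈-refl θ b ⟩
      (θ + - fromℕ 2) * ((θ + - fromℕ 3) * (θ + 1#) * b)    ≈⟨ *-congˡ vanish-b ⟩
      (θ + - fromℕ 2) * 0#                                  ≈⟨ zeroʳ _ ⟩
      0#                                                    ∎
    vanish (suc zero) = vanish-b
  -- The eigenvector is (a, 1). The second row forces a = μ - 2, that is 1 for μ = 3 and -3 for μ =
  -- -1, and the first row then reads 3 = μ a.
  eigen : (a : ℤ) → ∀ μ → (fromℤ (ℤ.+ 3) ≈ fromℤ μ * fromℤ a) → (fromℤ a + fromℕ 2 ≈ fromℤ μ) → θ ≈ fromℤ μ → IsEigenvalue W₀-matrix θ
  eigen a μ eq₀ eq₁ θ≈μ = (fromℤ a ∷ 1# ∷ []) , (suc zero , 1#0) , λ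
    { zero → begin
        fromℕ 0 * fromℤ a + (fromℕ 3 * 1# + 0#)
          ≈⟨ solve 1 (λ a → k0 :* a :+ (k3 :* k1 :+ k0) := k3) ≈-refl (fromℤ a) ⟩
        fromℕ 3                                  ≈⟨ eq₀ ⟩
        fromℤ μ * fromℤ a                        ≈⟨ *-congʳ θ≈μ ⟨
        θ * fromℤ a                              ∎
    ; (suc zero) → begin
        fromℕ 1 * fromℤ a + (fromℕ 2 * 1# + 0#)
          ≈⟨ solve 1 (λ a → k1 :* a :+ (k2 :* k1 :+ k0) := a :+ k2) ≈-refl (fromℤ a) ⟩
        fromℤ a + fromℕ 2                        ≈⟨ eq₁ ⟩
        fromℤ μ                                  ≈⟨ θ≈μ ⟨
        θ                                        ≈⟨ *-identityʳ θ ⟨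
        θ * 1#                                   ∎ }
  from : Any (θ ≈_) (fromℕ 3 List.∷ -1# List.∷ List.[]) → IsEigenvalue W₀-matrix θ
  from (here θ≈3) = eigen (ℤ.+ 1) (ℤ.+ 3) (fromℤ-homo-* (ℤ.+ 3) (ℤ.+ 1)) (≈-sym (fromℤ-homo-+ (ℤ.+ 1) (ℤ.+ 2))) θ≈3
  from (there (here θ≈-1)) = eigen -[1+ 2 ] ℤ.-1ℤ (fromℤ-homo-* ℤ.-1ℤ -[1+ 2 ]) (≈-sym (fromℤ-homo-+ -[1+ 2 ] (ℤ.+ 2))) θ≈-1

line-eigenvalues : ∀ μ → EigenvaluesAre ((μ ∷ []) ∷ []) (μ List.∷ List.[])
line-eigenvalues μ θ = mk⇔ to from
  where
  to : IsEigenvalue ((μ ∷ []) ∷ []) θ → Any (θ ≈_) (μ List.∷ List.[])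
  to (v , (zero , v#0) , eq) = here (*-cancel-invertible (invertible v#0)
    (≈-trans (≈-sym (eq zero)) (+-identityʳ (μ * v zero))))
  from : Any (θ ≈_) (μ List.∷ List.[]) → IsEigenvalue ((μ ∷ []) ∷ []) θ
  from (here θ≈μ) = (1# ∷ []) , (zero , 1#0) , λ { zero → ≈-trans (+-identityʳ (μ * 1#)) (*-congʳ (≈-sym θ≈μ)) }

-- The graph K₄

K₄-array : HasIntersectionArray K₄ (3 Vec.∷ Vec.[]) (1 Vec.∷ Vec.[])
K₄-array = record
  { isDistanceRegular = record { p = p ; p-card = p-card }
  ; diam≡D = refl
  ; b-entries = λ { zero → refl }
  ; c-entries = λ { zero → refl } }
  where
  open Graph K₄
  -- The parameters are read off at the pairs (0, 0) and (0, 1); evaluating `regular?` compares them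
  -- with all other pairs.
  p : ℕ → ℕ → ℕ → ℕ
  p zero    i j = ∣ sphere i zero ∩ sphere j zero ∣
  p (suc _) i j = ∣ sphere i zero ∩ sphere j (suc zero) ∣
  Regular : ℕ → ℕ → ℕ → Set
  Regular h i j = ∀ y z → dist y z ≡ h → ∣ sphere i y ∩ sphere j z ∣ ≡ p h i j
  regular? : ∀ h i j → Dec (Regular h i j)
  regular? h i j = Fin.all? λ y → Fin.all? λ z → (dist y z ℕ.≟ h) →-dec (_ ℕ.≟ _)
  p-card : ∀ h i j → h ℕ.≤ 1 → i ℕ.≤ 1 → j ℕ.≤ 1 → Regular h i j
  p-card zero    zero    zero    _ _ _ = toWitness {a? = regular? 0 0 0} tt
  p-card zero    zero    (suc zero) _ _ _ = toWitness {a? = regular? 0 0 1} tt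
  p-card zero    (suc zero) zero    _ _ _ = toWitness {a? = regular? 0 1 0} tt
  p-card zero    (suc zero) (suc zero) _ _ _ = toWitness {a? = regular? 0 1 1} tt
  p-card (suc zero) zero    zero    _ _ _ = toWitness {a? = regular? 1 0 0} tt
  p-card (suc zero) zero    (suc zero) _ _ _ = toWitness {a? = regular? 1 0 1} tt
  p-card (suc zero) (suc zero) zero    _ _ _ = toWitness {a? = regular? 1 1 0} tt
  p-card (suc zero) (suc zero) (suc zero) _ _ _ = toWitness {a? = regular? 1 1 1} tt
  p-card (suc (suc _)) _ _ (s≤s ()) _ _
  p-card _ (suc (suc _)) _ _ (s≤s ()) _
  p-card _ _ (suc (suc _)) _ _ (s≤s ())

-- In diameter 1 a geodesic between distinct vertices is a single edge, so the identity on vertices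
-- is an isomorphism.
diameter-one⇒complete : (Γ : Graph 4) → Graph.diam Γ ≡ 1 → Γ ≅ᴳ K₄
diameter-one⇒complete Γ diam≡1 = record
  { bijection = mk⤖ {to = λ y → y} ((λ y≡z → y≡z) , λ y → y , λ z≡y → z≡y)
  ; preserves = λ y z → mk⇔ (λ { adj refl → irreflexive adj }) (λ y≢z →
      distinct⇒adjacent y≢z (subst (dist y z ℕ.≤_) diam≡1 (dist≤diam y z)) (geodesic y z)) }
  where
  open Graph Γ
  distinct⇒adjacent : ∀ {y z k} → y ≢ z → k ℕ.≤ 1 → Walk Adj y z k → Adj y z
  distinct⇒adjacent y≢z _ here = contradiction refl y≢z
  distinct⇒adjacent y≢z _ (step adj here) = adj
  distinct⇒adjacent y≢z (s≤s ()) (step _ (step _ _))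

K₄-adjacency· : ∀ v y → (Graph.adjacency K₄ · v) y ≈ sum v + - v y
K₄-adjacency· v y = begin
  sum (λ z → Graph.adjacency K₄ y z * v z)   ≈⟨ sum-cong-≋ entry ⟩
  sum (λ z → v z + -1# * (δ y z * v z))      ≈⟨ sum-linear -1# v (λ z → δ y z * v z) ⟩
  sum v + -1# * sum (λ z → δ y z * v z)      ≈⟨ +-congˡ (*-congˡ (sum-δ y v)) ⟩
  sum v + - v y                              ∎
  where
  entry : ∀ z → Graph.adjacency K₄ y z * v z ≈ v z + -1# * (δ y z * v z)
  entry z with does (y Fin.≟ z)
  ... | true  = solve 1 (λ v → k0 :* v := v :+ con ℤ.-1ℤ :* (k1 :* v)) ≈-refl (v z)
  ... | false = solve 1 (λ v → k1 :* v := v :+ con ℤ.-1ℤ :* (k0 :* v)) ≈-refl (v z)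

K₄-spectrum : HasSpectrum (Graph.adjacency K₄) ((fromℕ 3 , 1) List.∷ (-1# , 3) List.∷ List.[])
K₄-spectrum = record
  { distinct = (fromℤ-apart (λ ()) All.∷ All.[]) AllPairs.∷ All.[] AllPairs.∷ AllPairs.[]
  ; eigenvalues = λ θ → mk⇔ (to θ) (from θ)
  ; multiplicities = dim-3 All.∷ dim--1 All.∷ All.[] }
  where
  A = Graph.adjacency K₄
  Eigenvector : ℂ → Vector ℂ 4 → Set
  Eigenvector θ v = A · v ≋ λ y → θ * v y

  constant : Eigenvector (fromℕ 3) (λ _ → 1#)
  constant y = ≈-trans (K₄-adjacency· (λ _ → 1#) y)
    (solve 0 ((k1 :+ (k1 :+ (k1 :+ (k1 :+ k0)))) :+ :- k1 := k3 :* k1) ≈-refl)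

  sum-zero⇒eigen : ∀ v → sum v ≈ 0# → Eigenvector -1# v
  sum-zero⇒eigen v sum≈0 y = ≈-trans (K₄-adjacency· v y) (≈-trans (+-congʳ sum≈0) (+-identityˡ (- v y)))

  eigen⇒sum-zero : ∀ v → Eigenvector -1# v → sum v ≈ 0#
  eigen⇒sum-zero v eq = begin
    sum v                                  ≈⟨ solve 2 (λ s a → s := (s :+ :- a) :+ a) ≈-refl (sum v) (v zero) ⟩
    (sum v + - v zero) + v zero            ≈⟨ +-congʳ (≈-trans (≈-sym (K₄-adjacency· v zero)) (eq zero)) ⟩
    -1# * v zero + v zero                  ≈⟨ solve 1 (λ a → con ℤ.-1ℤ :* a :+ a := k0) ≈-refl (v zero) ⟩
    0#                                     ∎

  difference : Vector (Vector ℂ 4) 3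
  difference = (1# ∷ -1# ∷ 0# ∷ 0# ∷ []) ∷ (1# ∷ 0# ∷ -1# ∷ 0# ∷ []) ∷ (1# ∷ 0# ∷ 0# ∷ -1# ∷ []) ∷ []

  sum-difference : ∀ j → sum (difference j) ≈ 0#
  sum-difference zero = solve 0 (k1 :+ (con ℤ.-1ℤ :+ (k0 :+ (k0 :+ k0))) := k0) ≈-refl
  sum-difference (suc zero) = solve 0 (k1 :+ (k0 :+ (con ℤ.-1ℤ :+ (k0 :+ k0))) := k0) ≈-refl
  sum-difference (suc (suc zero)) = solve 0 (k1 :+ (k0 :+ (k0 :+ (con ℤ.-1ℤ :+ k0))) := k0) ≈-refl

  -- Each coordinate satisfies (θ + 1) v z = s. Summing over the four vertices gives (θ + 1) s = 4
  -- s, hence (θ - 3) s = 0.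
  to : ∀ θ → IsEigenvalue A θ → Any (λ s → θ ≈ proj₁ s) ((fromℕ 3 , 1) List.∷ (-1# , 3) List.∷ List.[])
  to θ (v , (y , vy#0) , eq) = Sum.[ here , there ∘ here ]′ (root vy#0 (begin
    (θ + - fromℕ 3) * (θ + 1#) * v y    ≈⟨ *-assoc _ _ (v y) ⟩
    (θ + - fromℕ 3) * ((θ + 1#) * v y)  ≈⟨ *-congˡ (shift y) ⟩
    (θ + - fromℕ 3) * s
      ≈⟨ solve 2 (λ θ s → (θ :+ :- k3) :* s := (θ :+ k1) :* s :+ :- (s :+ (s :+ (s :+ (s :+ k0))))) ≈-refl θ s ⟩
    (θ + 1#) * s + - sum {4} (λ _ → s)
      ≈⟨ +-cong (*-distribˡ-sum (θ + 1#) v) (-‿cong (sum-cong-≋ {4} (λ z → ≈-sym (shift z)))) ⟩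
    sum (λ z → (θ + 1#) * v z) + - sum (λ z → (θ + 1#) * v z)  ≈⟨ -‿inverseʳ _ ⟩
    0#                                  ∎))
    where
    s = sum v
    shift : ∀ z → (θ + 1#) * v z ≈ s
    shift z = begin
      (θ + 1#) * v z          ≈⟨ solve 2 (λ θ a → (θ :+ k1) :* a := θ :* a :+ a) ≈-refl θ (v z) ⟩
      θ * v z + v z           ≈⟨ +-congʳ (≈-trans (≈-sym (eq z)) (K₄-adjacency· v z)) ⟩
      s + - v z + v z         ≈⟨ solve 2 (λ s a → s :+ :- a :+ a := s) ≈-refl s (v z) ⟩
      s                       ∎

  from : ∀ θ → Any (λ s → θ ≈ proj₁ s) ((fromℕ 3 , 1) List.∷ (-1# , 3) List.∷ List.[]) → IsEigenvalue A θ
  from θ (here θ≈3) = (λ _ → 1#) , (zero , 1#0) , λ y → ≈-trans (constant y) (*-congʳ (≈-sym θ≈3))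
  from θ (there (here θ≈-1)) = difference zero , (zero , 1#0) , λ y →
    ≈-trans (sum-zero⇒eigen (difference zero) (sum-difference zero) y) (*-congʳ (≈-sym θ≈-1))

  dim-3 : HasDim (Eigenvector (fromℕ 3)) 1
  dim-3 = ((λ _ → 1#) ∷ []) , ((λ { zero → constant }) , spans) , λ { a eq zero → ≈-trans
      (solve 1 (λ a → a := a :* k1 :+ k0) ≈-refl (a zero)) (eq zero) }
    where
    spans : ∀ v → Eigenvector (fromℕ 3) v → Span ((λ _ → 1#) ∷ []) v
    -- From 3 v y = s - v y every coordinate is s / 4, where s is the coordinate sum and `q` is 1 /
    -- 4.
    spans v eq = let (q , 4q≈1) = fromℤ-invertible {ℤ.+ 4} (λ ()) in (λ _ → q * sum v) , λ y → begin
      v y                                ≈⟨ *-identityʳ (v y) ⟨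
      v y * 1#                           ≈⟨ *-congˡ 4q≈1 ⟨
      v y * (fromℕ 4 * q)
        ≈⟨ solve 2 (λ a q → a :* (con (ℤ.+ 4) :* q) := q :* (k3 :* a :+ a)) ≈-refl (v y) q ⟩
      q * (fromℕ 3 * v y + v y)          ≈⟨ *-congˡ (+-congʳ (≈-trans (≈-sym (eq y)) (K₄-adjacency· v y))) ⟩
      q * (sum v + - v y + v y)
        ≈⟨ solve 3 (λ a q s → q :* (s :+ :- a :+ a) := q :* s :* k1 :+ k0) ≈-refl (v y) q (sum v) ⟩
      q * sum v * 1# + 0#                ∎

  dim--1 : HasDim (Eigenvector -1#) 3
  dim--1 = difference , ((λ j → sum-zero⇒eigen (difference j) (sum-difference j)) , spans) , independent
    where
    spans : ∀ v → Eigenvector -1# v → Span difference v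
    -- The vector `difference j` is the only one involving vertex j + 1, where it has the entry -1.
    -- This fixes the coefficients, and the remaining coordinate agrees because the sum of v is 0.
    spans v eq = (λ j → - v (suc j)) , λ
      { zero → begin
          a
            ≈⟨ solve 4 (λ a b c d → a := (a :+ (b :+ (c :+ (d :+ k0)))) :+ (:- b :* k1 :+ (:- c :* k1 :+ (:- d :* k1 :+ k0))))
                ≈-refl a b c d ⟩
          sum v + combine (λ j → - v (suc j)) difference zero  ≈⟨ +-congʳ (eigen⇒sum-zero v eq) ⟩
          0# + combine (λ j → - v (suc j)) difference zero     ≈⟨ +-identityˡ _ ⟩
          combine (λ j → - v (suc j)) difference zero          ∎
      ; (suc zero) → solve 3 (λ b c d → b := :- b :* con ℤ.-1ℤ :+ (:- c :* k0 :+ (:- d :* k0 :+ k0))) ≈-refl b c d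
      ; (suc (suc zero)) → solve 3 (λ b c d → c := :- b :* k0 :+ (:- c :* con ℤ.-1ℤ :+ (:- d :* k0 :+ k0)))
          ≈-refl b c d
      ; (suc (suc (suc zero))) → solve 3 (λ b c d → d := :- b :* k0 :+ (:- c :* k0 :+ (:- d :* con ℤ.-1ℤ :+ k0)))
          ≈-refl b c d }
      where
      a = v zero
      b = v (suc zero)
      c = v (suc (suc zero))
      d = v (suc (suc (suc zero)))
    independent : LinearlyIndependent difference
    independent a eq zero = ≈-trans
      (solve 3 (λ a b c → a := :- (a :* con ℤ.-1ℤ :+ (b :* k0 :+ (c :* k0 :+ k0))))
          ≈-refl (a zero) (a (suc zero)) (a (suc (suc zero))))
      (≈-trans (-‿cong (eq (suc zero))) (zeroʳ -1#))
    independent a eq (suc zero) = ≈-trans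
      (solve 3 (λ a b c → b := :- (a :* k0 :+ (b :* con ℤ.-1ℤ :+ (c :* k0 :+ k0))))
          ≈-refl (a zero) (a (suc zero)) (a (suc (suc zero))))
      (≈-trans (-‿cong (eq (suc (suc zero)))) (zeroʳ -1#))
    independent a eq (suc (suc zero)) = ≈-trans
      (solve 3 (λ a b c → c := :- (a :* k0 :+ (b :* k0 :+ (c :* con ℤ.-1ℤ :+ k0))))
          ≈-refl (a zero) (a (suc zero)) (a (suc (suc zero))))
      (≈-trans (-‿cong (eq (suc (suc (suc zero))))) (zeroʳ -1#))

-- Counting the summands of a given type

isInj₁ : ∀ {a b} {A : Set a} {B : Set b} → A ⊎ B → Bool
isInj₁ (inj₁ _) = true
isInj₁ (inj₂ _) = false

-- A `Subset` stores only Booleans; this returns the evidence that tabulating a classification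
-- discards.
isInj₁-correct : ∀ {a b} {A : Set a} {B : Set b} (s : A ⊎ B) → (isInj₁ s ≡ true × A) ⊎ (isInj₁ s ≡ false × B)
isInj₁-correct (inj₁ a) = inj₁ (refl , a)
isInj₁-correct (inj₂ b) = inj₂ (refl , b)

indicator : Bool → ℂ
indicator b = if b then 1# else 0#

-- This makes a cardinality comparable with traces and diagonal entries.
sum-indicator : ∀ {m} (f : Fin m → Bool) → sum (indicator ∘ f) ≈ fromℕ ∣ Vec.tabulate f ∣
sum-indicator {zero} f = ≈-refl
sum-indicator {suc m} f with f zero
... | true  = ≈-trans (+-congˡ (sum-indicator (f ∘ suc))) (≈-sym (fromℤ-homo-+ (ℤ.+ 1) _))
... | false = ≈-trans (+-identityˡ _) (sum-indicator (f ∘ suc))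

∈-tabulate⇔ : ∀ {m} (f : Fin m → Bool) i → (i ∈ₛ Vec.tabulate f) ⇔ (f i ≡ true)
∈-tabulate⇔ f i = mk⇔ (λ i∈ → ≡.trans (≡.sym (Vec.lookup∘tabulate f i)) (Vec.[]=⇒lookup i∈))
  (λ fi → Vec.lookup⇒[]= i _ (≡.trans (Vec.lookup∘tabulate f i) fi))

-- Irreducible modules for K₄

module K₄-Modules (x : Fin 4) where

  open Terwilliger K₄ x
  open TModule
  open Modules K₄ x
  open Graph K₄ using (dist)

  dist-refl : dist x x ≡ 0
  dist-refl = ℕ.n≤0⇒n≡0 (Graph.shortest K₄ {x} here)

  e*-dist : ∀ {i y} → dist x y ≡ i → e* i y ≈ 1#
  e*-dist {i} {y} eq = reflexive (cong (if_then 1# else 0#) (dec-true (dist x y ℕ.≟ i) eq))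

  e*-≢ : ∀ {i y} → dist x y ≢ i → e* i y ≈ 0#
  e*-≢ {i} {y} neq = reflexive (cong (if_then 1# else 0#) (dec-false (dist x y ℕ.≟ i) neq))

  e*-idem : ∀ i y → e* i y * e* i y ≈ e* i y
  e*-idem i y with dist x y ℕ.≟ i
  ... | yes p = ≈-trans (*-congʳ (e*-dist p)) (*-identityˡ _)
  ... | no ¬p = ≈-trans (*-congʳ (e*-≢ ¬p)) (≈-trans (zeroˡ _) (≈-sym (e*-≢ ¬p)))

  e*-orthogonal : ∀ {i j} → i ≢ j → ∀ y → e* i y * e* j y ≈ 0#
  e*-orthogonal {i} {j} i≢j y with dist x y ℕ.≟ i
  ... | yes p = ≈-trans (*-congˡ (e*-≢ λ q → i≢j (≡.trans (≡.sym p) q))) (zeroʳ _)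
  ... | no ¬p = ≈-trans (*-congʳ (e*-≢ ¬p)) (zeroˡ _)

  e*₀≋δ : e* 0 ≋ δ x
  e*₀≋δ y with does (x Fin.≟ y)
  ... | true  = ≈-refl
  ... | false = ≈-refl

  e*₁≋1-δ : e* 1 ≋ λ y → 1# + - δ x y
  e*₁≋1-δ y with does (x Fin.≟ y)
  ... | true  = solve 0 (k0 := k1 :+ :- k1) ≈-refl
  ... | false = solve 0 (k1 := k1 :+ :- k0) ≈-refl

  e*₀+e*₁ : ∀ y → e* 0 y + e* 1 y ≈ 1#
  e*₀+e*₁ y = ≈-trans (+-cong (e*₀≋δ y) (e*₁≋1-δ y)) (solve 1 (λ d → d :+ (k1 :+ :- d) := k1) ≈-refl (δ x y))

  e*₀* : ∀ v y → e* 0 y * v y ≈ e* 0 y * v x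
  e*₀* v y = ≈-trans (*-congʳ (e*₀≋δ y)) (≈-trans (δ-subst v x y) (*-congʳ (≈-sym (e*₀≋δ y))))

  e*₀-x : e* 0 x ≈ 1#
  e*₀-x = e*-dist dist-refl

  e*₁-x : e* 1 x ≈ 0#
  e*₁-x = e*-≢ λ eq → case ≡.trans (≡.sym dist-refl) eq of λ ()

  sum-e*₀ : sum (e* 0) ≈ fromℕ 1
  sum-e*₀ = ≈-trans (sum-cong-≋ e*₀≋δ) (sum-δ-one x)

  sum-e*₁ : sum (e* 1) ≈ fromℕ 3
  sum-e*₁ = begin
    sum (e* 1)                                 ≈⟨ sum-cong-≋ e*₁≋1-δ ⟩
    sum (λ y → 1# + - δ x y)                   ≈⟨ sum-linear -1# (λ _ → 1#) (δ x) ⟩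
    sum {4} (λ _ → 1#) + - sum (δ x)           ≈⟨ +-cong (sum-one 4) (-‿cong (sum-δ-one x)) ⟩
    fromℕ 4 + - 1#                             ≈⟨ solve 0 (con (ℤ.+ 4) :+ :- k1 := k3) ≈-refl ⟩
    fromℕ 3                                    ∎

  -- The primary module

  B₀ : Vector V 2
  B₀ = e* 0 ∷ e* 1 ∷ []

  -- J maps e*ᵢ to |Γᵢ(x)| times the all-ones vector e*₀ + e*₁, with |Γᵢ(x)| equal to 1 or 3;
  -- subtracting e*ᵢ leaves the two columns.
  A-represents : Represents W₀-matrix A B₀
  A-represents zero y = begin
    (A · e* 0) y                           ≈⟨ K₄-adjacency· (e* 0) y ⟩
    sum (e* 0) + - e* 0 y                  ≈⟨ +-congʳ (≈-trans sum-e*₀ (≈-sym (e*₀+e*₁ y))) ⟩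
    e* 0 y + e* 1 y + - e* 0 y
      ≈⟨ solve 2 (λ a b → a :+ b :+ :- a := k0 :* a :+ (k1 :* b :+ k0)) ≈-refl (e* 0 y) (e* 1 y) ⟩
    combine (λ i → W₀-matrix i zero) B₀ y  ∎
  A-represents (suc zero) y = begin
    (A · e* 1) y                                 ≈⟨ K₄-adjacency· (e* 1) y ⟩
    sum (e* 1) + - e* 1 y
      ≈⟨ +-congʳ (≈-trans sum-e*₁ (≈-sym (≈-trans (*-congˡ (e*₀+e*₁ y)) (*-identityʳ (fromℕ 3))))) ⟩
    fromℕ 3 * (e* 0 y + e* 1 y) + - e* 1 y
      ≈⟨ solve 2 (λ a b → k3 :* (a :+ b) :+ :- b := k3 :* a :+ (k2 :* b :+ k0)) ≈-refl (e* 0 y) (e* 1 y) ⟩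
    combine (λ i → W₀-matrix i (suc zero)) B₀ y  ∎

  E*-e* : ∀ i → i ℕ.≤ 1 → ∀ j → Span B₀ (E* i · B₀ j)
  E*-e* i i≤1 j = Span-resp B₀ (λ y → ≈-sym (E*· i (B₀ j) y)) (product i i≤1 j)
    where
    product : ∀ i → i ℕ.≤ 1 → ∀ j → Span B₀ (λ y → e* i y * B₀ j y)
    product zero _ zero = Span-resp B₀ (λ y → ≈-sym (e*-idem 0 y)) (Span-gen B₀ zero)
    product zero _ (suc zero) = Span-resp B₀ (λ y → ≈-sym (e*-orthogonal {0} {1} (λ ()) y)) (Span-zero B₀)
    product (suc zero) _ zero = Span-resp B₀ (λ y → ≈-sym (e*-orthogonal {1} {0} (λ ()) y)) (Span-zero B₀)
    product (suc zero) _ (suc zero) = Span-resp B₀ (λ y → ≈-sym (e*-idem 1 y)) (Span-gen B₀ (suc zero))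
    product (suc (suc _)) (s≤s ()) _

  W₀ : TModule
  W₀ = spanModule B₀ (λ j → (λ i → W₀-matrix i j) , A-represents j) E*-e*

  combine-B₀-x : ∀ a → combine a B₀ x ≈ a zero
  combine-B₀-x a = ≈-trans (+-cong (*-congˡ e*₀-x) (+-congʳ (*-congˡ e*₁-x)))
    (solve 2 (λ a b → a :* k1 :+ (b :* k0 :+ k0) := a) ≈-refl (a zero) (a (suc zero)))

  sum-combine-B₀ : ∀ a → sum (combine a B₀) ≈ a zero + a (suc zero) * fromℕ 3
  sum-combine-B₀ a = begin
    sum (λ y → sum λ j → a j * B₀ j y)                        ≈⟨ ∑-comm (λ y j → a j * B₀ j y) ⟩
    sum (λ j → sum λ y → a j * B₀ j y)                        ≈⟨ sum-cong-≋ (λ j → *-distribˡ-sum (a j) (B₀ j)) ⟨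
    a zero * sum (e* 0) + (a (suc zero) * sum (e* 1) + 0#)
      ≈⟨ +-cong (*-congˡ sum-e*₀) (+-congʳ (*-congˡ sum-e*₁)) ⟩
    a zero * 1# + (a (suc zero) * fromℕ 3 + 0#)
      ≈⟨ solve 2 (λ a b → a :* k1 :+ (b :* k3 :+ k0) := a :+ b :* k3) ≈-refl (a zero) (a (suc zero)) ⟩
    a zero + a (suc zero) * fromℕ 3                           ∎

  -- The value at `x` and the coordinate sum are independent functionals on W₀. They are the two
  -- that define `TypeII`, so this gives both the independence of `B₀` and the absence of nonzero
  -- vectors of type II in W₀.
  B₀-coefficients : ∀ a → combine a B₀ x ≈ 0# → sum (combine a B₀) ≈ 0# → ∀ j → a j ≈ 0#
  B₀-coefficients a at-x total zero = ≈-trans (≈-sym (combine-B₀-x a)) at-x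
  B₀-coefficients a at-x total (suc zero) = *-cancel-zero (fromℤ-invertible {ℤ.+ 3} λ ()) (begin
    a (suc zero) * fromℕ 3              ≈⟨ +-identityˡ _ ⟨
    0# + a (suc zero) * fromℕ 3         ≈⟨ +-congʳ (B₀-coefficients a at-x total zero) ⟨
    a zero + a (suc zero) * fromℕ 3     ≈⟨ sum-combine-B₀ a ⟨
    sum (combine a B₀)                  ≈⟨ total ⟩
    0#                                  ∎)

  B₀-basis : IsBasis B₀ (Mem W₀)
  B₀-basis = (Span-gen B₀ , λ _ v∈ → v∈) , λ a eq → B₀-coefficients a (eq x) (sum-zero eq)

  e*₀-nonzero : Nonzero (e* 0)
  e*₀-nonzero = x , #-resp-≈ (≈-sym e*₀-x) 1#0

  -- As `A` maps e*₀ to e*₁, the vector e*₀ generates W₀.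
  W₀-⊆ : ∀ U → Mem U (e* 0) → W₀ ⊆ U
  W₀-⊆ U e*₀∈U v (a , eq) = ∈-resp U (λ y → ≈-sym (eq y))
    (combine-closed (Mem U) (∈-zero U) (∈-add U) (∈-scale U) a B₀ λ { zero → e*₀∈U ; (suc zero) → e*₁∈U })
    where
    e*₁∈U : Mem U (e* 1)
    e*₁∈U = ∈-resp U (λ y → ≈-trans (A-represents zero y)
      (solve 2 (λ a b → k0 :* a :+ (k1 :* b :+ k0) := b) ≈-refl (e* 0 y) (e* 1 y))) (T-closed U A∈T e*₀∈U)

  -- Modules of type II

  -- The orthogonal complement of W₀, cut out by two linear equations.
  TypeII : V → Set
  TypeII v = v x ≈ 0# × sum v ≈ 0#

  module _ {v : V} (t : TypeII v) where

    private
      vx≈0 = proj₁ t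
      sum≈0 = proj₂ t

    typeII-A : A · v ≋ λ y → -1# * v y
    typeII-A y = ≈-trans (K₄-adjacency· v y) (≈-trans (+-congʳ sum≈0) (+-identityˡ (- v y)))

    typeII-e*₀ : ∀ y → e* 0 y * v y ≈ 0#
    typeII-e*₀ y = ≈-trans (e*₀* v y) (≈-trans (*-congˡ vx≈0) (zeroʳ _))

    typeII-e*₁ : ∀ y → e* 1 y * v y ≈ v y
    typeII-e*₁ y = begin
      e* 1 y * v y                      ≈⟨ +-identityˡ _ ⟨
      0# + e* 1 y * v y                 ≈⟨ +-congʳ (typeII-e*₀ y) ⟨
      e* 0 y * v y + e* 1 y * v y
        ≈⟨ solve 3 (λ a b v → a :* v :+ b :* v := (a :+ b) :* v) ≈-refl (e* 0 y) (e* 1 y) (v y) ⟩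
      (e* 0 y + e* 1 y) * v y           ≈⟨ *-congʳ (e*₀+e*₁ y) ⟩
      1# * v y                          ≈⟨ *-identityˡ (v y) ⟩
      v y                               ∎

    typeII-E*₀ : E* 0 · v ≋ λ y → 0# * v y
    typeII-E*₀ y = ≈-trans (E*· 0 v y) (≈-trans (typeII-e*₀ y) (≈-sym (zeroˡ (v y))))

    typeII-E*₁ : E* 1 · v ≋ λ y → 1# * v y
    typeII-E*₁ y = ≈-trans (E*· 1 v y) (≈-trans (typeII-e*₁ y) (≈-sym (*-identityˡ (v y))))

  -- The scalar is chosen before the vector. This uniformity makes any two lines of type II
  -- isomorphic, and it supplies the last coefficient in `matrices-span`.
  character : ∀ {B} → T B → ∃[ χ ] ∀ {v} → TypeII v → B · v ≋ λ y → χ * v y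
  character A∈T = -1# , typeII-A
  character (E*∈T zero _) = 0# , typeII-E*₀
  character (E*∈T (suc zero) _) = 1# , typeII-E*₁
  character (E*∈T (suc (suc _)) (s≤s ()))
  character one = 1# , λ {v} _ y → ≈-trans (δ· v y) (≈-sym (*-identityˡ (v y)))
  character (add {B} {C} b c) = let (χ , B·) = character b ; (ψ , C·) = character c in χ + ψ , λ {v} t y →
    ≈-trans (+· B C v y) (≈-trans (+-cong (B· t y) (C· t y))
      (solve 3 (λ χ ψ v → χ :* v :+ ψ :* v := (χ :+ ψ) :* v) ≈-refl χ ψ (v y)))
  character (scale a {B} b) = let (χ , B·) = character b in a * χ , λ {v} t y →
    ≈-trans (*· a B v y) (≈-trans (*-congˡ (B· t y)) (≈-sym (*-assoc a χ (v y))))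
  character (mul {B} {C} b c) = let (χ , B·) = character b ; (ψ , C·) = character c in χ * ψ , λ {v} t y →
    ≈-trans (mul· B C v y) (≈-trans (·-cong B {C · v} {λ z → ψ * v z} (C· t) y) (≈-trans (·-* B ψ v y) (≈-trans (*-congˡ (B· t y))
      (solve 3 (λ χ ψ v → ψ :* (χ :* v) := (χ :* ψ) :* v) ≈-refl χ ψ (v y)))))
  character (resp B≈C b) = let (χ , B·) = character b in χ , λ {v} t y →
    ≈-trans (≈-sym (·-congˡ v B≈C y)) (B· t y)

  typeII-line : ∀ {p} → TypeII p → ∀ {v} → Line p v → TypeII v
  typeII-line {p} (px≈0 , sum≈0) (a , eq) =
      ≈-trans (eq x) (≈-trans (*-congˡ px≈0) (zeroʳ a))
    , ≈-trans (sum-cong-≋ eq) (≈-trans (≈-sym (*-distribˡ-sum a p)) (≈-trans (*-congˡ sum≈0) (zeroʳ a)))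

  lineModule : ∀ p → TypeII p → TModule
  lineModule p t = spanModule (p ∷ [])
    (λ { zero → Span-resp (p ∷ []) (λ y → ≈-sym (typeII-A t y)) (Span-* (p ∷ []) -1# (Span-gen (p ∷ []) zero)) })
    (λ { zero _ zero → Span-resp (p ∷ []) (λ y → ≈-sym (typeII-E*₀ t y)) (Span-* (p ∷ []) 0# (Span-gen (p ∷ []) zero))
       ; (suc zero) _ zero → Span-resp (p ∷ []) (λ y → ≈-sym (typeII-E*₁ t y)) (Span-* (p ∷ []) 1# (Span-gen (p ∷ []) zero))
       ; (suc (suc _)) (s≤s ()) })

  line-⊆ : ∀ {p} (t : TypeII p) U → Mem U p → lineModule p t ⊆ U
  line-⊆ {p} t U p∈U v v∈ = let (a , eq) = Span⇒Line p v∈ in ∈-resp U (λ y → ≈-sym (eq y)) (∈-scale U a p∈U)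

  -- u decomposes as u x · e*₀ + m · e*₁ + p with m the mean of u over Γ₁(x) and p of type II; u being
  -- nonzero, one of these three terms is, and each can be extracted from u by T.
  nonzero-submodule : ∀ U → NonzeroSpace (Mem U) →
                      Mem U (e* 0) ⊎ ∃[ p ] (TypeII p × Nonzero p × Mem U p)
  nonzero-submodule U (u , u∈U , y , uy#0) = conclude (Sum.map₂ +-apart (+-apart (#-resp-≈ (u-split y) uy#0)))
    where
    h = proj₁ (fromℤ-invertible {ℤ.+ 3} λ ())
    3h≈1 = proj₂ (fromℤ-invertible {ℤ.+ 3} λ ())
    w p Aw : V
    w = E* 1 · u
    Aw = A · w
    -- Since E*₁ J w = s e*₁ and E*₁ w = w, the bracket is s e*₁, and `h` is 1 / 3. So `p` is w
    -- minus its mean on Γ₁(x), written so that it visibly stays in U.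
    p z = w z + - h * ((E* 1 · Aw) z + w z)
    s = sum w
    w∈U : Mem U w
    w∈U = T-closed U (E*∈T 1 ℕ.≤-refl) u∈U
    Aw∈U : Mem U Aw
    Aw∈U = T-closed U A∈T w∈U
    p∈U : Mem U p
    p∈U = ∈-add U w∈U (∈-scale U (- h) (∈-add U (T-closed U (E*∈T 1 ℕ.≤-refl) Aw∈U) w∈U))
    w≈ : ∀ z → w z ≈ e* 1 z * u z
    w≈ = E*· 1 u
    e*₁w : ∀ z → e* 1 z * w z ≈ w z
    e*₁w z = ≈-trans (*-congˡ (w≈ z)) (≈-trans (≈-sym (*-assoc _ _ _)) (≈-trans (*-congʳ (e*-idem 1 z)) (≈-sym (w≈ z))))
    e*₀w : ∀ z → e* 0 z * w z ≈ 0#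
    e*₀w z = ≈-trans (*-congˡ (w≈ z)) (≈-trans (≈-sym (*-assoc _ _ _))
      (≈-trans (*-congʳ (e*-orthogonal {0} {1} (λ ()) z)) (zeroˡ (u z))))
    p≈ : ∀ z → p z ≈ w z + - h * (s * e* 1 z)
    p≈ z = +-congˡ (*-congˡ (begin
      (E* 1 · Aw) z + w z                 ≈⟨ +-congʳ (≈-trans (E*· 1 Aw z) (*-congˡ (K₄-adjacency· w z))) ⟩
      e* 1 z * (s + - w z) + w z
        ≈⟨ solve 3 (λ e s w → e :* (s :+ :- w) :+ w := s :* e :+ (w :+ :- (e :* w))) ≈-refl (e* 1 z) s (w z) ⟩
      s * e* 1 z + (w z + - (e* 1 z * w z))  ≈⟨ +-congˡ (+-congˡ (-‿cong (e*₁w z))) ⟩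
      s * e* 1 z + (w z + - w z)
        ≈⟨ solve 3 (λ e s w → s :* e :+ (w :+ :- w) := s :* e) ≈-refl (e* 1 z) s (w z) ⟩
      s * e* 1 z                          ∎))
    typeII-p : TypeII p
    typeII-p = ≈-trans (p≈ x) (≈-trans (+-cong (≈-trans (w≈ x) (*-congʳ e*₁-x)) (*-congˡ (*-congˡ e*₁-x)))
                 (solve 3 (λ u h s → k0 :* u :+ :- h :* (s :* k0) := k0) ≈-refl (u x) h s))
             , (begin
      sum p                                     ≈⟨ sum-cong-≋ p≈ ⟩
      sum (λ z → w z + - h * (s * e* 1 z))      ≈⟨ sum-linear (- h) w (λ z → s * e* 1 z) ⟩
      s + - h * sum (λ z → s * e* 1 z)
        ≈⟨ +-congˡ (*-congˡ (≈-trans (≈-sym (*-distribˡ-sum s (e* 1))) (*-congˡ sum-e*₁))) ⟩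
      s + - h * (s * fromℕ 3)
        ≈⟨ solve 2 (λ s h → s :+ :- h :* (s :* k3) := s :* (k1 :+ :- (k3 :* h))) ≈-refl s h ⟩
      s * (1# + - (fromℕ 3 * h))                ≈⟨ *-congˡ (+-congˡ (-‿cong 3h≈1)) ⟩
      s * (1# + - 1#)                           ≈⟨ solve 1 (λ s → s :* (k1 :+ :- k1) := k0) ≈-refl s ⟩
      0#                                        ∎)
    u-split : ∀ z → u z ≈ u x * e* 0 z + (s * (h * e* 1 z) + p z)
    u-split z = begin
      u z                                                ≈⟨ *-identityˡ (u z) ⟨
      1# * u z                                           ≈⟨ *-congʳ (e*₀+e*₁ z) ⟨
      (e* 0 z + e* 1 z) * u z
        ≈⟨ solve 3 (λ a b u → (a :+ b) :* u := a :* u :+ b :* u) ≈-refl (e* 0 z) (e* 1 z) (u z) ⟩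
      e* 0 z * u z + e* 1 z * u z                        ≈⟨ +-cong (≈-trans (e*₀* u z) (*-comm _ _)) (≈-sym (w≈ z)) ⟩
      u x * e* 0 z + w z
        ≈⟨ +-congˡ (solve 4 (λ w h s e → w := s :* (h :* e) :+ (w :+ :- h :* (s :* e))) ≈-refl (w z) h s (e* 1 z)) ⟩
      u x * e* 0 z + (s * (h * e* 1 z) + (w z + - h * (s * e* 1 z)))  ≈⟨ +-congˡ (+-congˡ (p≈ z)) ⟨
      u x * e* 0 z + (s * (h * e* 1 z) + p z)            ∎
    extract : ∀ {c v} → Invertible c → Mem U v → (∀ z → v z ≈ c * e* 0 z) → Mem U (e* 0)
    extract {c} {v} (t , ct≈1) v∈U eq = ∈-resp U (λ z → begin
      t * v z              ≈⟨ *-congˡ (eq z) ⟩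
      t * (c * e* 0 z)     ≈⟨ solve 3 (λ t c e → t :* (c :* e) := (c :* t) :* e) ≈-refl t c (e* 0 z) ⟩
      (c * t) * e* 0 z     ≈⟨ *-congʳ ct≈1 ⟩
      1# * e* 0 z          ≈⟨ *-identityˡ (e* 0 z) ⟩
      e* 0 z               ∎) (∈-scale U t v∈U)
    conclude : u x * e* 0 y # 0# ⊎ (s * (h * e* 1 y) # 0# ⊎ p y # 0#) →
               Mem U (e* 0) ⊎ ∃[ p ] (TypeII p × Nonzero p × Mem U p)
    conclude (inj₁ ux#0) = inj₁ (extract (*-invertibleˡ (e* 0 y) (invertible ux#0))
      (T-closed U (E*∈T 0 z≤n) u∈U)
      (λ z → ≈-trans (E*· 0 u z) (≈-trans (e*₀* u z) (*-comm _ _))))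
    -- As w vanishes at `x`, E*₀ A w = s e*₀; here s is a unit because it divides a product apart
    -- from 0.
    conclude (inj₂ (inj₁ s#0)) = inj₁ (extract (*-invertibleˡ (h * e* 1 y) (invertible s#0))
      (T-closed U (E*∈T 0 z≤n) Aw∈U)
      (λ z → begin
        (E* 0 · Aw) z                        ≈⟨ ≈-trans (E*· 0 Aw z) (*-congˡ (K₄-adjacency· w z)) ⟩
        e* 0 z * (s + - w z)
          ≈⟨ solve 3 (λ e s w → e :* (s :+ :- w) := s :* e :+ :- (e :* w)) ≈-refl (e* 0 z) s (w z) ⟩
        s * e* 0 z + - (e* 0 z * w z)        ≈⟨ +-congˡ (-‿cong (e*₀w z)) ⟩
        s * e* 0 z + - 0#                    ≈⟨ solve 2 (λ s e → s :* e :+ :- k0 := s :* e) ≈-refl s (e* 0 z) ⟩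
        s * e* 0 z                           ∎))
    conclude (inj₂ (inj₂ py#0)) = inj₂ (p , typeII-p , (y , py#0) , p∈U)

  -- A nonzero submodule yields e*₀, which generates W₀, or a nonzero vector of type II, which
  -- `B₀-coefficients` excludes from W₀.
  W₀-irreducible : Irreducible W₀
  W₀-irreducible = (e* 0 , Span-gen B₀ zero , e*₀-nonzero) , λ U U⊆W₀ U≢0 →
    W₀-⊆ U (Sum.[ (λ e*₀∈U → e*₀∈U) , (λ (p , (px≈0 , sum≈0) , (y , py#0) , p∈U) →
      let (a , p≋) = U⊆W₀ p p∈U
          a≈0 = B₀-coefficients a (≈-trans (≈-sym (p≋ x)) px≈0) (≈-trans (sum-cong-≋ {4} {combine a B₀} {p} λ z → ≈-sym (p≋ z)) sum≈0)
      in contradiction (≈-trans (p≋ y) (combine-zero a B₀ a≈0 y)) (#0⇒≉0 py#0)) ]′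
      (nonzero-submodule U U≢0))

  module _ {p : V} (t : TypeII p) (p#0 : Nonzero p) where

    -- The vector e*₀ is not on the line, being 1 at `x`. Any q = a p with a coordinate apart from 0
    -- has a invertible, so p is recovered from q.
    line-irreducible : Irreducible (lineModule p t)
    line-irreducible = (p , Span-gen (p ∷ []) zero , p#0) , λ U U⊆ U≢0 →
      line-⊆ t U (Sum.[ (λ e*₀∈U →
          contradiction (≈-trans (≈-sym e*₀-x) (proj₁ (typeII-line t (Span⇒Line p (U⊆ (e* 0) e*₀∈U))))) (#0⇒≉0 1#0))
        , (λ (q , _ , (y , qy#0) , q∈U) →
          let (a , q≋ap) = Span⇒Line p (U⊆ q q∈U)
              (b , ab≈1) = *-invertibleˡ (p y) (Invertible-resp (q≋ap y) (invertible qy#0))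
          in ∈-resp U (λ z → begin
              b * q z          ≈⟨ *-congˡ (q≋ap z) ⟩
              b * (a * p z)    ≈⟨ solve 3 (λ a b p → b :* (a :* p) := (a :* b) :* p) ≈-refl a b (p z) ⟩
              (a * b) * p z    ≈⟨ *-congʳ ab≈1 ⟩
              1# * p z         ≈⟨ *-identityˡ (p z) ⟩
              p z              ∎) (∈-scale U b q∈U)) ]′
        (nonzero-submodule U U≢0))

  -- Classification and isomorphism of irreducible modules

  Primary Secondary : TModule → Set
  Primary U = U ⊆ W₀ × W₀ ⊆ U
  Secondary U = ∃[ p ] (TypeII p × Nonzero p × Mem U p × ∀ v → Mem U v → Line p v)

  -- The vector found by `nonzero-submodule` generates W₀ or a line inside U, and irreducibility
  -- makes this all of U.
  classify : ∀ U → Irreducible U → Primary U ⊎ Secondary U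
  classify U (U≢0 , minimal) = Sum.map
    (λ e*₀∈U → minimal W₀ (W₀-⊆ U e*₀∈U) (e* 0 , Span-gen B₀ zero , e*₀-nonzero) , W₀-⊆ U e*₀∈U)
    (λ (p , t , p#0 , p∈U) → p , t , p#0 , p∈U , λ v v∈U → Span⇒Line p
      (minimal (lineModule p t) (line-⊆ t U p∈U) (p , Span-gen (p ∷ []) zero , p#0) v v∈U))
    (nonzero-submodule U U≢0)

  -- E*₀ fixes e*₀ but annihilates every vector of type II. Its annihilation of a module is the
  -- invariant that separates the two types.
  primary-E*₀ : ∀ {U} → Primary U → ¬ (∀ u → Mem U u → E* 0 · u ≋ λ _ → 0#)
  primary-E*₀ (_ , W₀⊆U) kill = #0⇒≉0 1#0 (begin
    1#                 ≈⟨ *-identityˡ 1# ⟨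
    1# * 1#            ≈⟨ *-cong e*₀-x e*₀-x ⟨
    e* 0 x * e* 0 x    ≈⟨ E*· 0 (e* 0) x ⟨
    (E* 0 · e* 0) x    ≈⟨ kill (e* 0) (W₀⊆U (e* 0) (Span-gen B₀ zero)) x ⟩
    0#                 ∎)

  secondary-E*₀ : ∀ {U} → Secondary U → ∀ u → Mem U u → E* 0 · u ≋ λ _ → 0#
  secondary-E*₀ (p , t , _ , _ , gen) u u∈U y =
    ≈-trans (typeII-E*₀ (typeII-line t (gen u u∈U)) y) (zeroˡ (u y))

  E*₀∈T : T (E* 0)
  E*₀∈T = E*∈T 0 z≤n

  primary-≇-secondary : ∀ U W → Primary U → Secondary W → ¬ (U ≅ W)
  primary-≇-secondary U W P S iso = primary-E*₀ {U} P (≅-annihilatesˡ iso E*₀∈T (secondary-E*₀ {W} S))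

  secondary-≇-primary : ∀ U W → Secondary U → Primary W → ¬ (U ≅ W)
  secondary-≇-primary U W S P iso = primary-E*₀ {W} P (≅-annihilatesʳ iso E*₀∈T (secondary-E*₀ {U} S))

  primary-≅ : ∀ U W → Primary U → Primary W → U ≅ W
  primary-≅ U W (U⊆ , ⊆U) (W⊆ , ⊆W) = ⊆-antisym⇒≅ U W (λ v → ⊆W v ∘ U⊆ v) (λ v → ⊆U v ∘ W⊆ v)

  secondary-≅ : ∀ U W → Secondary U → Secondary W → U ≅ W
  secondary-≅ U W (p , t , p#0 , p∈U , gen) (q , t′ , q#0 , q∈W , gen′) =
    line-≅ U W p#0 q#0 q∈W gen gen′ p∈U λ B∈T → let (χ , acts) = character B∈T in χ , acts t , acts t′

  W₀-primary : Primary W₀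
  W₀-primary = (λ _ v∈ → v∈) , λ _ v∈ → v∈

  line-secondary : ∀ {p} (t : TypeII p) → Nonzero p → Secondary (lineModule p t)
  line-secondary {p} t p#0 = p , t , p#0 , Span-gen (p ∷ []) zero , λ _ → Span⇒Line p

  -- The diagonal entries at x of the projections onto the summands count the primary ones, since
  -- they are 1 for W₀ and 0 for a line of type II; all other summands have dimension 1.
  module _ {m : ℕ} (U : Fin m → TModule) (irreducible : ∀ i → Irreducible (U i)) (⨁U : IsOrthogonalDirectSum U) where

    primary? : Fin m → Bool
    primary? i = isInj₁ (classify (U i) (irreducible i))

    primary?-correct : ∀ i → (primary? i ≡ true × Primary (U i)) ⊎ (primary? i ≡ false × Secondary (U i))
    primary?-correct i = isInj₁-correct (classify (U i) (irreducible i))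

    part-x : ∀ i → part ⨁U x i x ≈ indicator (primary? i)
    part-x i = Sum.[ (λ (eq , P) → ≈-trans (primary-x P) (reflexive (cong indicator (≡.sym eq))))
                   , (λ (eq , S) → ≈-trans (secondary-x S) (reflexive (cong indicator (≡.sym eq)))) ]′
               (primary?-correct i)
      where
      primary-x : Primary (U i) → part ⨁U x i x ≈ 1#
      -- The unit vector at `x` is e*₀. It already lies in `U i`, so the projection fixes it.
      primary-x (_ , W₀⊆U) = begin
        part ⨁U x i x                        ≈⟨ sum-δ x (λ y → part ⨁U y i x) ⟨
        sum (λ y → δ x y * part ⨁U y i x)    ≈⟨ sum-cong-≋ (λ y → *-congʳ {part ⨁U y i x} (e*₀≋δ y)) ⟨
        sum (λ y → e* 0 y * part ⨁U y i x)   ≈⟨ part-project ⨁U i (W₀⊆U (e* 0) (Span-gen B₀ zero)) x ⟩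
        e* 0 x                               ≈⟨ e*₀-x ⟩
        1#                                   ∎
      secondary-x : Secondary (U i) → part ⨁U x i x ≈ 0#
      secondary-x (p , t , _ , _ , gen) = proj₁ (typeII-line t (gen _ (part∈ ⨁U x i)))

    dim : Bool → ℕ
    dim b = if b then 2 else 1

    hasDim : ∀ i → HasDim (Mem (U i)) (dim (primary? i))
    hasDim i = Sum.[ (λ (eq , U⊆W₀ , W₀⊆U) → subst (HasDim (Mem (U i)) ∘ dim) (≡.sym eq)
                        (B₀ , ((λ j → W₀⊆U (B₀ j) (Span-gen B₀ j)) , U⊆W₀) , proj₂ B₀-basis))
                   , (λ (eq , p , t , p#0 , p∈U , gen) → subst (HasDim (Mem (U i)) ∘ dim) (≡.sym eq)
                        ((p ∷ []) , line-basis p∈U p#0 gen)) ]′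
               (primary?-correct i)

    count-primary : ∣ Vec.tabulate primary? ∣ ≡ 1
    count-primary = ℤ.+-injective (fromℤ-injective (begin
      fromℕ ∣ Vec.tabulate primary? ∣    ≈⟨ sum-indicator primary? ⟨
      sum (indicator ∘ primary?)         ≈⟨ sum-cong-≋ part-x ⟨
      sum (λ i → part ⨁U x i x)          ≈⟨ sum-part ⨁U x x ⟨
      δ x x                              ≈⟨ δ-refl x ⟩
      1#                                 ∎))

    -- With c secondary and d primary summands, the dimensions give c + 2 d = 4, and d = 1 by
    -- `count-primary`.
    count-secondary : ∣ Vec.tabulate (not ∘ primary?) ∣ ≡ 2
    count-secondary = ℤ.+-injective (fromℤ-injective (begin
      c                                       ≈⟨ solve 2 (λ c d → c := (c :+ k2 :* d) :+ :- (k2 :* d)) ≈-refl c d ⟩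
      (c + fromℕ 2 * d) + - (fromℕ 2 * d)
        ≈⟨ +-cong total (-‿cong (*-congˡ (reflexive (cong fromℕ count-primary)))) ⟩
      fromℕ 4 + - (fromℕ 2 * 1#)              ≈⟨ solve 0 (con (ℤ.+ 4) :+ :- (k2 :* k1) := k2) ≈-refl ⟩
      fromℕ 2                                 ∎))
      where
      c = fromℕ ∣ Vec.tabulate (not ∘ primary?) ∣
      d = fromℕ ∣ Vec.tabulate primary? ∣
      dim-indicator : ∀ b → indicator (not b) + fromℕ 2 * indicator b ≈ fromℕ (dim b)
      dim-indicator true  = solve 0 (k0 :+ k2 :* k1 := k2) ≈-refl
      dim-indicator false = solve 0 (k1 :+ k2 :* k0 := k1) ≈-refl
      total : c + fromℕ 2 * d ≈ fromℕ 4
      total = begin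
        c + fromℕ 2 * d
          ≈⟨ +-cong (sum-indicator (not ∘ primary?)) (*-congˡ (sum-indicator primary?)) ⟨
        sum (indicator ∘ not ∘ primary?) + fromℕ 2 * sum (indicator ∘ primary?)
          ≈⟨ sum-linear (fromℕ 2) (indicator ∘ not ∘ primary?) (indicator ∘ primary?) ⟨
        sum (λ i → indicator (not (primary? i)) + fromℕ 2 * indicator (primary? i))
          ≈⟨ sum-cong-≋ (λ i → dim-indicator (primary? i)) ⟩
        sum (λ i → fromℕ (dim (primary? i)))
          ≈⟨ dimension-⨁ ⨁U hasDim ⟩
        fromℕ 4 ∎

  W₀-multiplicity : HasMultiplicity W₀ 1
  W₀-multiplicity U irr ⨁U = Vec.tabulate (primary? U irr ⨁U) , (λ i → mk⇔ (to i) (from i)) , count-primary U irr ⨁U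
    where
    to : ∀ i → i ∈ₛ Vec.tabulate (primary? U irr ⨁U) → U i ≅ W₀
    to i i∈ = Sum.[ (λ (_ , P) → primary-≅ (U i) W₀ P W₀-primary)
                  , (λ (eq , _) → case ≡.trans (≡.sym eq) (Equivalence.to (∈-tabulate⇔ (primary? U irr ⨁U) i) i∈) of λ ()) ]′
              (primary?-correct U irr ⨁U i)
    from : ∀ i → U i ≅ W₀ → i ∈ₛ Vec.tabulate (primary? U irr ⨁U)
    from i iso = Sum.[ (λ (eq , _) → Equivalence.from (∈-tabulate⇔ (primary? U irr ⨁U) i) eq)
                     , (λ (_ , S) → contradiction iso (secondary-≇-primary (U i) W₀ S W₀-primary)) ]′
                 (primary?-correct U irr ⨁U i)

  secondary-multiplicity : ∀ W → Secondary W → HasMultiplicity W 2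
  secondary-multiplicity W S U irr ⨁U =
    Vec.tabulate (not ∘ primary? U irr ⨁U) , (λ i → mk⇔ (to i) (from i)) , count-secondary U irr ⨁U
    where
    to : ∀ i → i ∈ₛ Vec.tabulate (not ∘ primary? U irr ⨁U) → U i ≅ W
    to i i∈ = Sum.[ (λ (eq , _) → case ≡.trans (≡.sym (cong not eq))
                        (Equivalence.to (∈-tabulate⇔ (not ∘ primary? U irr ⨁U) i) i∈) of λ ())
                  , (λ (_ , S′) → secondary-≅ (U i) W S′ S) ]′
              (primary?-correct U irr ⨁U i)
    from : ∀ i → U i ≅ W → i ∈ₛ Vec.tabulate (not ∘ primary? U irr ⨁U)
    from i iso = Sum.[ (λ (_ , P) → contradiction iso (primary-≇-secondary (U i) W P S))
                     , (λ (eq , _) → Equivalence.from (∈-tabulate⇔ (not ∘ primary? U irr ⨁U) i) (cong not eq)) ]′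
                 (primary?-correct U irr ⨁U i)

-- Data of the modules, and orthogonality

module K₄-Data (x : Fin 4) where

  open Terwilliger K₄ x
  open TModule
  open Modules K₄ x
  open K₄-Modules x
  open Graph K₄ using (dist)

  e*₁-nonzero : Nonzero (e* 1)
  -- `punchIn x zero` is a vertex other than `x`, hence a neighbour of it.
  e*₁-nonzero = Fin.punchIn x zero , #-resp-≈ (≈-sym (≈-trans (e*₁≋1-δ _)
    (≈-trans (+-congˡ (-‿cong (δ-≢ (Fin.punchInᵢ≢i x zero ∘ ≡.sym)))) (solve 0 (k1 :+ :- k0 := k1) ≈-refl)))) 1#0

  e*-supported : ∀ i → e* i ≋ E* i · e* i
  e*-supported i y = ≈-sym (≈-trans (E*· i (e* i) y) (e*-idem i y))

  W₀-data : ModuleData W₀ 0 1 2 1 (1 Vec.∷ 1 Vec.∷ Vec.[]) (e* 0 ∷ e* 1 ∷ []) W₀-matrix (fromℕ 3 List.∷ -1# List.∷ List.[])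
  W₀-data = record
    { irreducible  = W₀-irreducible
    ; endpoint     = e*₀-in , λ _ _ → z≤n
    ; multiplicity = W₀-multiplicity
    ; dimension    = B₀ , B₀-basis
    ; diameter     = (true Vec.∷ true Vec.∷ Vec.[]) ,
        (λ { zero → mk⇔ (λ _ → e*₀-in) (λ _ → Vec.here)
           ; (suc zero) → mk⇔ (λ _ → e*₁-in) (λ _ → Vec.there Vec.here) }) , refl
    ; hasShape     = λ { zero → shape zero e*₀-nonzero ; (suc zero) → shape (suc zero) e*₁-nonzero }
    ; pureBasis    = B₀-basis , Fin.toℕ
                   , (λ { zero → e*₀-nonzero , e* 0 , tt , e*-supported 0
                        ; (suc zero) → e*₁-nonzero , e* 1 , tt , e*-supported 1 })
                   , λ _ _ j≤k → j≤k
    ; represents   = A-represents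
    ; eigenvalues  = W₀-eigenvalues
    }
    where
    e*₀-in : NonzeroSpace (E*[ 0 ] (Mem W₀))
    e*₀-in = e* 0 , (e* 0 , Span-gen B₀ zero , e*-supported 0) , e*₀-nonzero
    e*₁-in : NonzeroSpace (E*[ 1 ] (Mem W₀))
    e*₁-in = e* 1 , (e* 1 , Span-gen B₀ (suc zero) , e*-supported 1) , e*₁-nonzero
    e*B₀ : ∀ i j → Line (B₀ i) (λ y → B₀ i y * B₀ j y)
    e*B₀ zero       zero       = 1# , λ y → ≈-trans (e*-idem 0 y) (≈-sym (*-identityˡ _))
    e*B₀ zero       (suc zero) = 0# , λ y → ≈-trans (e*-orthogonal {0} {1} (λ ()) y) (≈-sym (zeroˡ _))
    e*B₀ (suc zero) zero       = 0# , λ y → ≈-trans (e*-orthogonal {1} {0} (λ ()) y) (≈-sym (zeroˡ _))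
    e*B₀ (suc zero) (suc zero) = 1# , λ y → ≈-trans (e*-idem 1 y) (≈-sym (*-identityˡ _))
    -- Both sides reduce to a common form only for concrete i; the equation lets `shape` treat the
    -- two supports at once.
    B₀≡e* : ∀ i → B₀ i ≡ e* (Fin.toℕ i)
    B₀≡e* zero = refl
    B₀≡e* (suc zero) = refl
    e*W₀ : ∀ i {w} → Mem W₀ w → Line (B₀ i) (λ y → B₀ i y * w y)
    e*W₀ i {w} (a , eq) =
      let (c , e*e*₀) = e*B₀ i zero
          (d , e*e*₁) = e*B₀ i (suc zero)
      in a zero * c + a (suc zero) * d , λ y → begin
        B₀ i y * w y                                                      ≈⟨ *-congˡ (eq y) ⟩
        B₀ i y * (a zero * e* 0 y + (a (suc zero) * e* 1 y + 0#))
          ≈⟨ solve 5 (λ e a b u v → e :* (a :* u :+ (b :* v :+ k0)) := a :* (e :* u) :+ b :* (e :* v))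
              ≈-refl (B₀ i y) (a zero) (a (suc zero)) (e* 0 y) (e* 1 y) ⟩
        a zero * (B₀ i y * e* 0 y) + a (suc zero) * (B₀ i y * e* 1 y)
          ≈⟨ +-cong (*-congˡ (e*e*₀ y)) (*-congˡ (e*e*₁ y)) ⟩
        a zero * (c * B₀ i y) + a (suc zero) * (d * B₀ i y)
          ≈⟨ solve 5 (λ e a b c d → a :* (c :* e) :+ b :* (d :* e) := (a :* c :+ b :* d) :* e)
              ≈-refl (B₀ i y) (a zero) (a (suc zero)) c d ⟩
        (a zero * c + a (suc zero) * d) * B₀ i y                          ∎
    shape : ∀ i → Nonzero (e* (Fin.toℕ i)) → HasDim (E*[ Fin.toℕ i ] (Mem W₀)) 1
    shape i e*#0 = (e* (Fin.toℕ i) ∷ []) , line-basis {E*[ Fin.toℕ i ] (Mem W₀)} {e* (Fin.toℕ i)}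
      (e* (Fin.toℕ i) , subst (Mem W₀) (B₀≡e* i) (Span-gen B₀ i) , e*-supported (Fin.toℕ i)) e*#0
      λ v (w , w∈ , v≋) → let (c , eq) = subst (λ b → Line b (λ y → b y * w y)) (B₀≡e* i) (e*W₀ i w∈)
                          in c , λ y → ≈-trans (v≋ y) (≈-trans (E*· (Fin.toℕ i) w y) (eq y))

  module _ {p : V} (t : TypeII p) (p#0 : Nonzero p) where

    private
      W₁ = lineModule p t
      line : ∀ {v} → Mem W₁ v → TypeII v
      line v∈ = typeII-line t (Span⇒Line p v∈)

    line-E*₀ : ¬ NonzeroSpace (E*[ 0 ] (Mem W₁))
    line-E*₀ (v , (w , w∈ , v≋) , y , vy#0) =
      #0⇒≉0 vy#0 (≈-trans (v≋ y) (≈-trans (typeII-E*₀ (line w∈) y) (zeroˡ (w y))))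

    p-supported : p ≋ E* 1 · p
    p-supported y = ≈-sym (≈-trans (typeII-E*₁ t y) (*-identityˡ (p y)))

    typeII-pure : Pure p 1
    typeII-pure = p#0 , p , tt , p-supported

    line-E*₁ : NonzeroSpace (E*[ 1 ] (Mem W₁))
    line-E*₁ = p , (p , Span-gen (p ∷ []) zero , p-supported) , p#0

    line-E*₁-basis : IsBasis (p ∷ []) (E*[ 1 ] (Mem W₁))
    line-E*₁-basis = line-basis {E*[ 1 ] (Mem W₁)} {p} (p , Span-gen (p ∷ []) zero , p-supported) p#0
      λ v (w , w∈ , v≋) → let (a , w≋) = Span⇒Line p w∈ in
        a , λ y → ≈-trans (v≋ y) (≈-trans (typeII-E*₁ (line w∈) y) (≈-trans (*-identityˡ (w y)) (w≋ y)))

    line-data : ModuleData W₁ 1 2 1 0 (1 Vec.∷ Vec.[]) (p ∷ []) ((-1# ∷ []) ∷ []) (-1# List.∷ List.[])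
    line-data = record
      { irreducible  = line-irreducible t p#0
      ; endpoint     = line-E*₁ , λ { zero E*₀W → contradiction E*₀W line-E*₀ ; (suc _) _ → s≤s z≤n }
      ; multiplicity = secondary-multiplicity W₁ (line-secondary t p#0)
      ; dimension    = (p ∷ []) , basis
      ; diameter     = (false Vec.∷ true Vec.∷ Vec.[]) ,
          (λ { zero → mk⇔ (λ ()) (λ E*₀W → contradiction E*₀W line-E*₀)
             ; (suc zero) → mk⇔ (λ _ → line-E*₁) (λ _ → Vec.there Vec.here) }) , refl
      ; hasShape     = λ { zero → (p ∷ []) , line-E*₁-basis }
      ; pureBasis    = basis , (λ _ → 1) , (λ { zero → typeII-pure }) , λ _ _ _ → ℕ.≤-refl
      ; represents   = λ { zero y → ≈-trans (typeII-A t y) (≈-sym (+-identityʳ _)) }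
      ; eigenvalues  = line-eigenvalues -1#
      }
      where
      basis : IsBasis (p ∷ []) (Mem W₁)
      basis = line-basis {Mem W₁} {p} (Span-gen (p ∷ []) zero) p#0 λ _ → Span⇒Line p

    line-seed : IsSeed p 1 W₁
    line-seed = proj₁ line-E*₁-basis , (p ∷ []) , line-E*₁-basis

  -- Orthogonality

  Real : V → Set
  Real v = ∀ y → conj (v y) ≈ v y

  dot : V → V → ℂ
  dot u v = sum λ y → u y * v y

  dot-sym : ∀ u v → dot u v ≈ dot v u
  dot-sym u v = sum-cong-≋ λ y → *-comm (u y) (v y)

  dot-combine : ∀ {k} a (u : Vector V k) v → (∀ j → dot (u j) v ≈ 0#) → dot (combine a u) v ≈ 0#
  dot-combine a u v u⊥v = begin
    sum (λ y → combine a u y * v y)               ≈⟨ sum-cong-≋ (λ y → *-distribʳ-sum (v y) (λ j → a j * u j y)) ⟩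
    sum (λ y → sum λ j → a j * u j y * v y)       ≈⟨ ∑-comm (λ y j → a j * u j y * v y) ⟩
    sum (λ j → sum λ y → a j * u j y * v y)
      ≈⟨ sum-zero (λ j → ≈-trans (sum-cong-≋ (λ y → *-assoc (a j) (u j y) (v y)))
                                                       (≈-trans (≈-sym (*-distribˡ-sum (a j) (λ y → u j y * v y)))
                                                         (≈-trans (*-congˡ (u⊥v j)) (zeroʳ (a j))))) ⟩
    0#                                            ∎

  conj-combine : ∀ {k} a (u : Vector V k) → (∀ j → Real (u j)) → ∀ y → conj (combine a u y) ≈ combine (conj ∘ a) u y
  conj-combine {zero} a u real y = conj-fromℤ (ℤ.+ 0)
  conj-combine {suc k} a u real y = ≈-trans (conj-homo-+ _ _) (+-cong
    (≈-trans (conj-homo-* (a zero) (u zero y)) (*-congˡ (real zero y)))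
    (conj-combine (a ∘ suc) (u ∘ suc) (real ∘ suc) y))

  -- The generators on the right being real, conjugation touches only their coefficients. Hermitian
  -- orthogonality of the spans thus reduces to the bilinear `dot` on generators.
  Span-orthogonal : ∀ {k l} (u : Vector V k) (v : Vector V l) → (∀ j → Real (v j)) → (∀ i j → dot (u i) (v j) ≈ 0#) →
                    ∀ s t → Span u s → Span v t → ⟨ s , t ⟩ ≈ 0#
  Span-orthogonal u v real u⊥v s t (a , s≋) (b , t≋) = begin
    sum (λ y → s y * conj (t y))
      ≈⟨ sum-cong-≋ (λ y → *-cong (s≋ y) (≈-trans (conj-cong (t≋ y)) (conj-combine b v real y))) ⟩
    dot (combine a u) (combine b̄ v)
      ≈⟨ dot-combine a u (combine b̄ v) (λ i → ≈-trans (dot-sym (u i) (combine b̄ v))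
                                                  (dot-combine b̄ v (u i) λ j → ≈-trans (dot-sym (v j) (u i)) (u⊥v i j))) ⟩
    0#                                       ∎
    where
    b̄ = conj ∘ b

  e*-real : ∀ i → Real (e* i)
  e*-real i y with dist x y ℕ.≟ i
  ... | yes d = ≈-trans (conj-cong (e*-dist d)) (≈-trans (conj-fromℤ (ℤ.+ 1)) (≈-sym (e*-dist d)))
  ... | no ¬d = ≈-trans (conj-cong (e*-≢ ¬d)) (≈-trans (conj-fromℤ (ℤ.+ 0)) (≈-sym (e*-≢ ¬d)))

  B₀-real : ∀ j → Real (B₀ j)
  B₀-real zero = e*-real 0
  B₀-real (suc zero) = e*-real 1

  B₀-dot-typeII : ∀ {p} → TypeII p → ∀ j → dot (B₀ j) p ≈ 0#
  B₀-dot-typeII {p} t zero = sum-zero (typeII-e*₀ {p} t)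
  B₀-dot-typeII {p} t (suc zero) = ≈-trans (sum-cong-≋ (typeII-e*₁ {p} t)) (proj₂ t)

-- The decomposition attached to an ordering of the neighbours

module K₄-Ordered (x : Fin 4) (o : Terwilliger.Ordering K₄ x 1 3) where

  open Terwilliger K₄ x
  open TModule
  open Modules K₄ x
  open K₄-Modules x
  open K₄-Data x
  open Graph K₄ using (dist)
  open Bijection o using () renaming (to to neighbour; injective to neighbour-injective; surjective to neighbour-surjective)

  -- This relabelling puts `x` first and the neighbours next in the given order. Identities of
  -- vectors then become the same integer computations for every `x` and every ordering.
  σ : Fin 4 → Fin 4
  σ zero    = x
  σ (suc j) = proj₁ (neighbour j)

  σ-injective : ∀ {k l} → σ k ≡ σ l → k ≡ l
  σ-injective {zero}  {zero}  _  = refl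
  σ-injective {zero}  {suc l} eq = contradiction
    (≡.trans (≡.sym dist-refl) (≡.trans (cong (dist x) eq) (proj₂ (neighbour l)))) λ ()
  σ-injective {suc k} {zero}  eq = contradiction
    (≡.trans (≡.sym dist-refl) (≡.trans (cong (dist x) (≡.sym eq)) (proj₂ (neighbour k)))) λ ()
  σ-injective {suc k} {suc l} eq = cong suc (neighbour-injective (pair-≡ eq))
    where
    -- The ordering lists pairs of a vertex and a proof of its distance; such proofs are unique, so
    -- the vertex determines the pair.
    pair-≡ : ∀ {p q : ∃[ y ] dist x y ≡ 1} → proj₁ p ≡ proj₁ q → p ≡ q
    pair-≡ {y , d} {.y , d′} refl = cong (y ,_) (ℕ.≡-irrelevant d d′)

  σ-surjective : ∀ y → ∃[ k ] σ k ≡ y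
  σ-surjective y with x Fin.≟ y in eq
  ... | yes x≡y = zero , x≡y
  ... | no  _   =
    -- `dist x y` is a conditional on deciding x = y; the remembered equation `eq` evaluates it to
    -- 1.
    let (j , neighbour-j) = neighbour-surjective (y , cong (λ b → if b then 0 else 1) (cong does eq))
    in suc j , cong proj₁ (neighbour-j refl)

  π : Permutation 4 4
  π = ⤖⇒↔ (mk⤖ {to = σ} (σ-injective , λ y → proj₁ (σ-surjective y) , λ { refl → proj₂ (σ-surjective y) }))

  σ-ext : ∀ {u v : V} → (∀ k → u (σ k) ≈ v (σ k)) → u ≋ v
  σ-ext {u} {v} eq y = let (k , σk≡y) = σ-surjective y in subst (λ z → u z ≈ v z) σk≡y (eq k)

  place : (Fin 4 → ℤ) → V
  place c y = fromℤ (c (π ⟨$⟩ˡ y))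

  place-σ : ∀ c k → place c (σ k) ≈ fromℤ (c k)
  place-σ c k = reflexive (cong (fromℤ ∘ c) (inverseˡ π {k}))

  sum-place : ∀ c → sum (place c) ≈ sum (λ k → fromℤ (c k))
  sum-place c = ≈-trans (sum-permute (place c) π) (sum-cong-≋ {4} {λ k → place c (σ k)} {λ k → fromℤ (c k)} (place-σ c))

  place-real : ∀ c → Real (place c)
  place-real c y = conj-fromℤ _

  -- The coordinates of e*₀, e*₁, νₐ and νᵦ at the vertices x, o 0, o 1, o 2.
  table : Fin 4 → Fin 4 → ℤ
  table zero                   = ℤ.+ 1 ∷ ℤ.+ 0 ∷ ℤ.+ 0 ∷ ℤ.+ 0 ∷ []
  table (suc zero)             = ℤ.+ 0 ∷ ℤ.+ 1 ∷ ℤ.+ 1 ∷ ℤ.+ 1 ∷ []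
  table (suc (suc zero))       = ℤ.+ 0 ∷ ℤ.+ 1 ∷ ℤ.-1ℤ ∷ ℤ.+ 0 ∷ []
  table (suc (suc (suc zero))) = ℤ.+ 0 ∷ ℤ.+ 1 ∷ ℤ.+ 1 ∷ -[1+ 1 ] ∷ []

  cₐ cᵦ : Fin 4 → ℤ
  cₐ = table (suc (suc zero))
  cᵦ = table (suc (suc (suc zero)))

  νₐ νᵦ : V
  νₐ = place cₐ
  νᵦ = place cᵦ

  typeII-place : ∀ c → fromℤ (c zero) ≈ 0# → sum (λ k → fromℤ (c k)) ≈ 0# → TypeII (place c)
  typeII-place c c₀≈0 sum≈0 = ≈-trans (place-σ c zero) c₀≈0 , ≈-trans (sum-place c) sum≈0

  typeII-νₐ : TypeII νₐ
  typeII-νₐ = typeII-place cₐ ≈-refl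
    (solve 0 (k0 :+ (k1 :+ (con ℤ.-1ℤ :+ (k0 :+ k0))) := k0) ≈-refl)

  typeII-νᵦ : TypeII νᵦ
  typeII-νᵦ = typeII-place cᵦ ≈-refl
    (solve 0 (k0 :+ (k1 :+ (k1 :+ (con -[1+ 1 ] :+ k0))) := k0) ≈-refl)

  νₐ#0 : Nonzero νₐ
  νₐ#0 = σ (suc zero) , #-resp-≈ (≈-sym (place-σ cₐ (suc zero))) 1#0

  νᵦ#0 : Nonzero νᵦ
  νᵦ#0 = σ (suc zero) , #-resp-≈ (≈-sym (place-σ cᵦ (suc zero))) 1#0

  W₁ₐ W₁ᵦ : TModule
  W₁ₐ = lineModule νₐ typeII-νₐ
  W₁ᵦ = lineModule νᵦ typeII-νᵦ

  dot-νₐ-νᵦ : dot νₐ νᵦ ≈ 0#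
  dot-νₐ-νᵦ = begin
    sum (λ y → νₐ y * νᵦ y)                    ≈⟨ sum-permute (λ y → νₐ y * νᵦ y) π ⟩
    sum (λ k → νₐ (σ k) * νᵦ (σ k))            ≈⟨ sum-cong-≋ {4} (λ k → *-cong (place-σ cₐ k) (place-σ cᵦ k)) ⟩
    sum (λ k → fromℤ (cₐ k) * fromℤ (cᵦ k))
      ≈⟨ solve 0 (k0 :* k0 :+ (k1 :* k1 :+ (con ℤ.-1ℤ :* k1 :+ (k0 :* con -[1+ 1 ] :+ k0))) := k0) ≈-refl ⟩
    0#                                         ∎

  frame : Vector V 4
  frame = e* 0 ∷ e* 1 ∷ νₐ ∷ νᵦ ∷ []

  frame-σ : ∀ j k → frame j (σ k) ≈ fromℤ (table j k)
  frame-σ zero zero = e*₀-x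
  frame-σ zero (suc k) = ≈-trans (e*-≢ λ d≡0 → case ≡.trans (≡.sym d≡0) (proj₂ (neighbour k)) of λ ()) (zeros k)
    where
    zeros : ∀ k → 0# ≈ fromℤ (table zero (suc k))
    zeros zero = ≈-refl
    zeros (suc zero) = ≈-refl
    zeros (suc (suc zero)) = ≈-refl
  frame-σ (suc zero) zero = e*₁-x
  frame-σ (suc zero) (suc k) = ≈-trans (e*-dist (proj₂ (neighbour k))) (ones k)
    where
    ones : ∀ k → 1# ≈ fromℤ (table (suc zero) (suc k))
    ones zero = ≈-refl
    ones (suc zero) = ≈-refl
    ones (suc (suc zero)) = ≈-refl
  frame-σ (suc (suc zero)) = place-σ cₐ
  frame-σ (suc (suc (suc zero))) = place-σ cᵦ

  combine-frame-σ : ∀ a k → combine a frame (σ k) ≈ sum (λ j → a j * fromℤ (table j k))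
  combine-frame-σ a k = sum-cong-≋ {4} λ j → *-congˡ {a j} (frame-σ j k)

  -- The frame is orthogonal: pairing the four rows with one of its vectors isolates that
  -- coefficient times a squared norm. The constants 3, 2 and 6 are the squared norms of e*₁, νₐ and
  -- νᵦ.
  frame-independent : LinearlyIndependent frame
  frame-independent a eq = λ
    { zero → ≈-trans (solve 4 (λ a b c d → a := a :* k1 :+ (b :* k0 :+ (c :* k0 :+ (d :* k0 :+ k0))))
        ≈-refl a₀ a₁ a₂ a₃) (at zero)
    ; (suc zero) → *-cancel-zero (fromℤ-invertible {ℤ.+ 3} λ ()) (begin
        a₁ * fromℕ 3
          ≈⟨ solve 4 (λ a b c d → b :* k3 := (a :* k0 :+ (b :* k1 :+ (c :* k1 :+ (d :* k1 :+ k0))))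
               :+ (a :* k0 :+ (b :* k1 :+ (c :* con ℤ.-1ℤ :+ (d :* k1 :+ k0))))
               :+ (a :* k0 :+ (b :* k1 :+ (c :* k0 :+ (d :* con -[1+ 1 ] :+ k0))))) ≈-refl a₀ a₁ a₂ a₃ ⟩
        row (suc zero) + row (suc (suc zero)) + row (suc (suc (suc zero)))
          ≈⟨ +-cong (+-cong (at (suc zero)) (at (suc (suc zero)))) (at (suc (suc (suc zero)))) ⟩
        0# + 0# + 0#  ≈⟨ solve 0 (k0 :+ k0 :+ k0 := k0) ≈-refl ⟩
        0#            ∎)
    ; (suc (suc zero)) → *-cancel-zero (fromℤ-invertible {ℤ.+ 2} λ ()) (begin
        a₂ * fromℕ 2
          ≈⟨ solve 4 (λ a b c d → c :* k2 := (a :* k0 :+ (b :* k1 :+ (c :* k1 :+ (d :* k1 :+ k0))))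
               :+ :- (a :* k0 :+ (b :* k1 :+ (c :* con ℤ.-1ℤ :+ (d :* k1 :+ k0))))) ≈-refl a₀ a₁ a₂ a₃ ⟩
        row (suc zero) + - row (suc (suc zero))
          ≈⟨ +-cong (at (suc zero)) (-‿cong (at (suc (suc zero)))) ⟩
        0# + - 0#  ≈⟨ solve 0 (k0 :+ :- k0 := k0) ≈-refl ⟩
        0#         ∎)
    ; (suc (suc (suc zero))) → *-cancel-zero (fromℤ-invertible {ℤ.+ 6} λ ()) (begin
        a₃ * fromℕ 6
          ≈⟨ solve 4 (λ a b c d → d :* con (ℤ.+ 6) := (a :* k0 :+ (b :* k1 :+ (c :* k1 :+ (d :* k1 :+ k0))))
               :+ (a :* k0 :+ (b :* k1 :+ (c :* con ℤ.-1ℤ :+ (d :* k1 :+ k0))))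
               :+ :- (k2 :* (a :* k0 :+ (b :* k1 :+ (c :* k0 :+ (d :* con -[1+ 1 ] :+ k0)))))) ≈-refl a₀ a₁ a₂ a₃ ⟩
        row (suc zero) + row (suc (suc zero)) + - (fromℕ 2 * row (suc (suc (suc zero))))
          ≈⟨ +-cong (+-cong (at (suc zero)) (at (suc (suc zero)))) (-‿cong (*-congˡ (at (suc (suc (suc zero)))))) ⟩
        0# + 0# + - (fromℕ 2 * 0#)  ≈⟨ solve 0 (k0 :+ k0 :+ :- (k2 :* k0) := k0) ≈-refl ⟩
        0#                          ∎) }
    where
    a₀ = a zero
    a₁ = a (suc zero)
    a₂ = a (suc (suc zero))
    a₃ = a (suc (suc (suc zero)))
    row : Fin 4 → ℂ
    row k = sum (λ j → a j * fromℤ (table j k))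
    at : ∀ k → row k ≈ 0#
    at k = ≈-trans (≈-sym (combine-frame-σ a k)) (eq (σ k))

  frame-spans : ∀ v → Span frame v
  frame-spans v = a , σ-ext {v} {combine a frame} λ k → ≈-trans (solution k) (≈-sym (combine-frame-σ a k))
    where
    h = proj₁ (fromℤ-invertible {ℤ.+ 6} λ ())
    6h≈1 = proj₂ (fromℤ-invertible {ℤ.+ 6} λ ())
    p = v (σ (suc zero))
    q = v (σ (suc (suc zero)))
    r = v (σ (suc (suc (suc zero))))
    a : Vector ℂ 4
    -- These are the orthogonal projection coefficients (p + q + r) / 3, (p - q) / 2 and (p + q - 2
    -- r) / 6, over the common denominator 6; `h` is 1 / 6.
    a = v x ∷ fromℕ 2 * (p + q + r) * h ∷ fromℕ 3 * (p + - q) * h ∷ (p + q + - (fromℕ 2 * r)) * h ∷ []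
    expand : ∀ z → z ≈ z * (fromℕ 6 * h)
    expand z = ≈-trans (≈-sym (*-identityʳ z)) (*-congˡ (≈-sym 6h≈1))
    solution : ∀ k → v (σ k) ≈ sum (λ j → a j * fromℤ (table j k))
    solution zero = solve 5 (λ z p q r h → z := z :* k1 :+ (k2 :* (p :+ q :+ r) :* h :* k0 :+
      (k3 :* (p :+ :- q) :* h :* k0 :+ ((p :+ q :+ :- (k2 :* r)) :* h :* k0 :+ k0)))) ≈-refl (v x) p q r h
    solution (suc zero) = ≈-trans (expand p) (solve 5 (λ z p q r h → p :* (con (ℤ.+ 6) :* h) :=
      z :* k0 :+ (k2 :* (p :+ q :+ r) :* h :* k1 :+
      (k3 :* (p :+ :- q) :* h :* k1 :+ ((p :+ q :+ :- (k2 :* r)) :* h :* k1 :+ k0)))) ≈-refl (v x) p q r h)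
    solution (suc (suc zero)) = ≈-trans (expand q) (solve 5 (λ z p q r h → q :* (con (ℤ.+ 6) :* h) :=
      z :* k0 :+ (k2 :* (p :+ q :+ r) :* h :* k1 :+
      (k3 :* (p :+ :- q) :* h :* con ℤ.-1ℤ :+ ((p :+ q :+ :- (k2 :* r)) :* h :* k1 :+ k0)))) ≈-refl (v x) p q r h)
    solution (suc (suc (suc zero))) = ≈-trans (expand r) (solve 5 (λ z p q r h → r :* (con (ℤ.+ 6) :* h) :=
      z :* k0 :+ (k2 :* (p :+ q :+ r) :* h :* k1 :+
      (k3 :* (p :+ :- q) :* h :* k0 :+ ((p :+ q :+ :- (k2 :* r)) :* h :* con -[1+ 1 ] :+ k0)))) ≈-refl (v x) p q r h)

  summand : Vector TModule 3
  summand = W₀ ∷ W₁ₐ ∷ W₁ᵦ ∷ []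

  combine-frame-split : ∀ a₀ a₁ a₂ a₃ y → combine (a₀ ∷ a₁ ∷ a₂ ∷ a₃ ∷ []) frame y
    ≈ combine (a₀ ∷ a₁ ∷ []) B₀ y + (combine (a₂ ∷ []) (νₐ ∷ []) y + (combine (a₃ ∷ []) (νᵦ ∷ []) y + 0#))
  combine-frame-split a₀ a₁ a₂ a₃ y = solve 8 (λ a b c d s t u v → a :* s :+ (b :* t :+ (c :* u :+ (d :* v :+ k0)))
      := (a :* s :+ (b :* t :+ k0)) :+ ((c :* u :+ k0) :+ ((d :* v :+ k0) :+ k0))) ≈-refl
    a₀ a₁ a₂ a₃ (e* 0 y) (e* 1 y) (νₐ y) (νᵦ y)

  ⨁-summand : IsOrthogonalDirectSum summand
  ⨁-summand = record
    { orthogonal = orthogonal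
    ; decompose  = decompose
    ; direct     = direct }
    where
    decompose : ∀ v → Σ (Vector V 3) λ w → (∀ i → Mem (summand i) (w i)) × v ≋ λ y → sum λ i → w i y
    decompose v =
        (combine a₀₁ B₀ ∷ combine a₂ (νₐ ∷ []) ∷ combine a₃ (νᵦ ∷ []) ∷ [])
      , (λ { zero → a₀₁ , (λ _ → ≈-refl) ; (suc zero) → a₂ , (λ _ → ≈-refl) ; (suc (suc zero)) → a₃ , (λ _ → ≈-refl) })
      , λ y → ≈-trans (proj₂ (frame-spans v) y) (combine-frame-split (a zero) (a (suc zero)) (a (suc (suc zero))) (a (suc (suc (suc zero)))) y)
      where
      a = proj₁ (frame-spans v)
      a₀₁ : Vector ℂ 2
      a₀₁ = a zero ∷ a (suc zero) ∷ []
      a₂ a₃ : Vector ℂ 1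
      a₂ = a (suc (suc zero)) ∷ []
      a₃ = a (suc (suc (suc zero))) ∷ []

    orthogonal : ∀ i j → i ≢ j → ∀ u v → Mem (summand i) u → Mem (summand j) v → ⟨ u , v ⟩ ≈ 0#
    orthogonal zero zero i≢j = contradiction refl i≢j
    orthogonal zero (suc zero) _ = Span-orthogonal B₀ (νₐ ∷ []) (λ { zero → place-real cₐ })
      λ { i zero → B₀-dot-typeII {νₐ} typeII-νₐ i }
    orthogonal zero (suc (suc zero)) _ = Span-orthogonal B₀ (νᵦ ∷ []) (λ { zero → place-real cᵦ })
      λ { i zero → B₀-dot-typeII {νᵦ} typeII-νᵦ i }
    orthogonal (suc zero) zero _ = Span-orthogonal (νₐ ∷ []) B₀ B₀-real
      λ { zero j → ≈-trans (dot-sym νₐ (B₀ j)) (B₀-dot-typeII {νₐ} typeII-νₐ j) }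
    orthogonal (suc zero) (suc zero) i≢j = contradiction refl i≢j
    orthogonal (suc zero) (suc (suc zero)) _ = Span-orthogonal (νₐ ∷ []) (νᵦ ∷ []) (λ { zero → place-real cᵦ })
      λ { zero zero → dot-νₐ-νᵦ }
    orthogonal (suc (suc zero)) zero _ = Span-orthogonal (νᵦ ∷ []) B₀ B₀-real
      λ { zero j → ≈-trans (dot-sym νᵦ (B₀ j)) (B₀-dot-typeII {νᵦ} typeII-νᵦ j) }
    orthogonal (suc (suc zero)) (suc zero) _ = Span-orthogonal (νᵦ ∷ []) (νₐ ∷ []) (λ { zero → place-real cₐ })
      λ { zero zero → ≈-trans (dot-sym νᵦ νₐ) dot-νₐ-νᵦ }
    orthogonal (suc (suc zero)) (suc (suc zero)) i≢j = contradiction refl i≢j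

    direct : ∀ (w : Vector V 3) → (∀ i → Mem (summand i) (w i)) → (λ y → sum λ i → w i y) ≋ (λ _ → 0#) →
             ∀ i → w i ≋ λ _ → 0#
    direct w w∈ sum≈0 = λ
      { zero y → ≈-trans (w₀≋ y) (combine-zero a B₀ (λ { zero → d≈0 zero ; (suc zero) → d≈0 (suc zero) }) y)
      ; (suc zero) y → ≈-trans (w₁≋ y) (combine-zero b (νₐ ∷ []) (λ { zero → d≈0 (suc (suc zero)) }) y)
      ; (suc (suc zero)) y → ≈-trans (w₂≋ y) (combine-zero c (νᵦ ∷ []) (λ { zero → d≈0 (suc (suc (suc zero))) }) y) }
      where
      a = proj₁ (w∈ zero)
      b = proj₁ (w∈ (suc zero))
      c = proj₁ (w∈ (suc (suc zero)))
      w₀≋ = proj₂ (w∈ zero)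
      w₁≋ = proj₂ (w∈ (suc zero))
      w₂≋ = proj₂ (w∈ (suc (suc zero)))
      d : Vector ℂ 4
      d = a zero ∷ a (suc zero) ∷ b zero ∷ c zero ∷ []
      d≈0 : ∀ j → d j ≈ 0#
      d≈0 = frame-independent d λ y → ≈-trans (combine-frame-split (a zero) (a (suc zero)) (b zero) (c zero) y)
        (≈-trans (≈-sym (+-cong (w₀≋ y) (+-cong (w₁≋ y) (+-congʳ (w₂≋ y))))) (sum≈0 y))

  summand-≅ : ∀ i j → (summand i ≅ summand j) ⇔ ((I ∷ II ∷ II ∷ []) i ≡ (I ∷ II ∷ II ∷ []) j)
  summand-≅ = λ
    { zero zero → mk⇔ (λ _ → refl) (λ _ → primary-≅ W₀ W₀ W₀-primary W₀-primary)
    ; zero (suc zero) → mk⇔ (λ iso → contradiction iso (primary-≇-secondary W₀ W₁ₐ W₀-primary secondaryₐ)) λ ()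
    ; zero (suc (suc zero)) → mk⇔ (λ iso → contradiction iso (primary-≇-secondary W₀ W₁ᵦ W₀-primary secondaryᵦ)) λ ()
    ; (suc zero) zero → mk⇔ (λ iso → contradiction iso (secondary-≇-primary W₁ₐ W₀ secondaryₐ W₀-primary)) λ ()
    ; (suc zero) (suc zero) → mk⇔ (λ _ → refl) (λ _ → secondary-≅ W₁ₐ W₁ₐ secondaryₐ secondaryₐ)
    ; (suc zero) (suc (suc zero)) → mk⇔ (λ _ → refl) (λ _ → secondary-≅ W₁ₐ W₁ᵦ secondaryₐ secondaryᵦ)
    ; (suc (suc zero)) zero → mk⇔ (λ iso → contradiction iso (secondary-≇-primary W₁ᵦ W₀ secondaryᵦ W₀-primary)) λ ()
    ; (suc (suc zero)) (suc zero) → mk⇔ (λ _ → refl) (λ _ → secondary-≅ W₁ᵦ W₁ₐ secondaryᵦ secondaryₐ)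
    ; (suc (suc zero)) (suc (suc zero)) → mk⇔ (λ _ → refl) (λ _ → secondary-≅ W₁ᵦ W₁ᵦ secondaryᵦ secondaryᵦ) }
    where
    secondaryₐ = line-secondary typeII-νₐ νₐ#0
    secondaryᵦ = line-secondary typeII-νᵦ νᵦ#0

-- The dimension of the Terwilliger algebra

module K₄-Algebra (x : Fin 4) (o : Terwilliger.Ordering K₄ x 1 3) where

  open Terwilliger K₄ x
  open TModule
  open Modules K₄ x
  open K₄-Modules x
  open K₄-Ordered x o

  E*-entry : ∀ i y z → E* i y z ≈ e* i y * δ y z
  E*-entry i y z with does (y Fin.≟ z)
  ... | true  = ≈-sym (*-identityʳ (e* i y))
  ... | false = ≈-sym (zeroʳ (e* i y))

  -- e*ᵢ (e*ⱼ)ᵗ = E*ᵢ (A + I) E*ⱼ, as A + I is the all-ones matrix.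
  rank-one∈T : ∀ i j → i ℕ.≤ 1 → j ℕ.≤ 1 → T (λ y z → e* i y * e* j z)
  rank-one∈T i j i≤1 j≤1 = resp entry (mul (E*∈T i i≤1) (mul (resp all-ones (add A∈T one)) (E*∈T j j≤1)))
    where
    all-ones : ∀ y z → A y z + δ y z ≈ 1#
    all-ones y z with does (y Fin.≟ z)
    ... | true  = +-identityˡ 1#
    ... | false = ≈-trans (+-comm 1# 0#) (+-identityˡ 1#)
    entry : ∀ y z → sum (λ v → E* i y v * sum (λ w → 1# * E* j w z)) ≈ e* i y * e* j z
    entry y z = ≈-trans (E*· i (λ _ → sum (λ w → 1# * E* j w z)) y) (*-congˡ {e* i y} (≈-trans
      (sum-cong-≋ {4} {λ w → 1# * E* j w z} {λ w → e* j w * δ w z} λ w → ≈-trans (*-identityˡ (E* j w z)) (E*-entry j w z))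
      (sum-δʳ z (e* j))))

  -- The first four annihilate all vectors of type II and give all linear maps of W₀ into itself;
  -- E*₁ has character 1. They account for the summands 2² and 1² of the dimension.
  matrices : Vector (Fin 4 × Fin 4 → ℂ) 5
  matrices = (λ (y , z) → e* 0 y * e* 0 z) ∷ (λ (y , z) → e* 0 y * e* 1 z)
           ∷ (λ (y , z) → e* 1 y * e* 0 z) ∷ (λ (y , z) → e* 1 y * e* 1 z)
           ∷ (λ (y , z) → E* 1 y z) ∷ []

  matrices∈T : ∀ j → T (curry (matrices j))
  matrices∈T zero                         = rank-one∈T 0 0 z≤n z≤n
  matrices∈T (suc zero)                   = rank-one∈T 0 1 z≤n (s≤s z≤n)
  matrices∈T (suc (suc zero))             = rank-one∈T 1 0 (s≤s z≤n) z≤n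
  matrices∈T (suc (suc (suc zero)))       = rank-one∈T 1 1 (s≤s z≤n) (s≤s z≤n)
  matrices∈T (suc (suc (suc (suc zero)))) = E*∈T 1 (s≤s z≤n)

  δ-split : ∀ y z → δ y z ≈ e* 0 y * e* 0 z + E* 1 y z
  δ-split y z = begin
    δ y z                                ≈⟨ *-identityˡ (δ y z) ⟨
    1# * δ y z                           ≈⟨ *-congʳ (e*₀+e*₁ y) ⟨
    (e* 0 y + e* 1 y) * δ y z
      ≈⟨ solve 3 (λ a b d → (a :+ b) :* d := a :* d :+ b :* d) ≈-refl (e* 0 y) (e* 1 y) (δ y z) ⟩
    e* 0 y * δ y z + e* 1 y * δ y z
      ≈⟨ +-cong (≈-trans (e*₀* (λ w → δ w z) y) (*-congˡ (≈-sym (e*₀≋δ z)))) (≈-sym (E*-entry 1 y z)) ⟩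
    e* 0 y * e* 0 z + E* 1 y z           ∎

  -- The unit vector at z is the sum of its projection to W₀ and a vector of type II, so an element
  -- of T is determined by its action on e*₀ and e*₁ and by its character.
  matrices-span : ∀ M → T (curry M) → Span matrices M
  matrices-span M M∈T = coefficients , λ (y , z) → begin
    M (y , z)                                            ≈⟨ sum-δʳ z (λ w → M (y , w)) ⟨
    (B · (λ w → δ w z)) y
      ≈⟨ ·-cong B {λ w → δ w z} {λ w → e* 0 z * e* 0 w + (h * e* 1 z * e* 1 w + q z w)} (unit z) y ⟩
    (B · (λ w → e* 0 z * e* 0 w + (h * e* 1 z * e* 1 w + q z w))) y
      ≈⟨ ·-+ B (λ w → e* 0 z * e* 0 w) (λ w → h * e* 1 z * e* 1 w + q z w) y ⟩
    (B · (λ w → e* 0 z * e* 0 w)) y + (B · (λ w → h * e* 1 z * e* 1 w + q z w)) y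
      ≈⟨ +-cong (·-* B (e* 0 z) (e* 0) y) (·-+ B (λ w → h * e* 1 z * e* 1 w) (q z) y) ⟩
    e* 0 z * (B · e* 0) y + ((B · (λ w → h * e* 1 z * e* 1 w)) y + (B · q z) y)
      ≈⟨ +-cong (*-congˡ (Be*₀ y)) (+-cong (≈-trans (·-* B (h * e* 1 z) (e* 1) y) (*-congˡ (Be*₁ y))) (≈-trans (Bq {q z} (typeII-q z) y) (*-congˡ (+-congʳ (δ-split y z))))) ⟩
    e* 0 z * combine a B₀ y + (h * e* 1 z * combine b B₀ y + χ * (e* 0 y * e* 0 z + E* 1 y z + - (e* 0 z * e* 0 y + h * e* 1 z * e* 1 y)))
      ≈⟨ solve 11 (λ u v s t E h χ a₀ a₁ b₀ b₁ →
           s :* (a₀ :* u :+ (a₁ :* v :+ k0)) :+ (h :* t :* (b₀ :* u :+ (b₁ :* v :+ k0)) :+ χ :* (u :* s :+ E :+ :- (s :* u :+ h :* t :* v)))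
           := a₀ :* (u :* s) :+ (h :* b₀ :* (u :* t) :+ (a₁ :* (v :* s) :+ (h :* (b₁ :+ :- χ) :* (v :* t) :+ (χ :* E :+ k0))))) ≈-refl
         (e* 0 y) (e* 1 y) (e* 0 z) (e* 1 z) (E* 1 y z) h χ (a zero) (a (suc zero)) (b zero) (b (suc zero)) ⟩
    combine coefficients matrices (y , z)                ∎
    where
    B : Mat 4
    B = curry M
    h = proj₁ (fromℤ-invertible {ℤ.+ 3} λ ())
    3h≈1 = proj₂ (fromℤ-invertible {ℤ.+ 3} λ ())
    a = proj₁ (T-closed W₀ M∈T (Span-gen B₀ zero))
    Be*₀ = proj₂ (T-closed W₀ M∈T (Span-gen B₀ zero))
    b = proj₁ (T-closed W₀ M∈T (Span-gen B₀ (suc zero)))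
    Be*₁ = proj₂ (T-closed W₀ M∈T (Span-gen B₀ (suc zero)))
    χ = proj₁ (character M∈T)
    Bq = proj₂ (character M∈T)
    coefficients : Vector ℂ 5
    -- The W₀-part of the unit vector at z is e*₀(z) e*₀ + h e*₁(z) e*₁ with h = 1 / 3, whence the
    -- factors `h`. The correction -χ arises because the projection onto type II is E*₁ minus h
    -- times e*₁ (e*₁)ᵗ.
    coefficients = a zero ∷ h * b zero ∷ a (suc zero) ∷ h * (b (suc zero) + - χ) ∷ χ ∷ []
    q : Fin 4 → V
    q z w = δ w z + - (e* 0 z * e* 0 w + h * e* 1 z * e* 1 w)
    unit : ∀ z w → δ w z ≈ e* 0 z * e* 0 w + (h * e* 1 z * e* 1 w + q z w)
    unit z w = solve 3 (λ d s t → d := s :+ (t :+ (d :+ :- (s :+ t))))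
        ≈-refl (δ w z) (e* 0 z * e* 0 w) (h * e* 1 z * e* 1 w)
    typeII-q : ∀ z → TypeII (q z)
    typeII-q z = (begin
        δ x z + - (e* 0 z * e* 0 x + h * e* 1 z * e* 1 x)
          ≈⟨ +-cong (≈-sym (e*₀≋δ z)) (-‿cong (+-cong (*-congˡ e*₀-x) (*-congˡ e*₁-x))) ⟩
        e* 0 z + - (e* 0 z * 1# + h * e* 1 z * 0#)
          ≈⟨ solve 3 (λ s t h → s :+ :- (s :* k1 :+ h :* t :* k0) := k0) ≈-refl (e* 0 z) (e* 1 z) h ⟩
        0#  ∎)
      , (begin
        sum (q z)
          ≈⟨ sum-linear -1# (λ w → δ w z) (λ w → e* 0 z * e* 0 w + h * e* 1 z * e* 1 w) ⟩
        sum (λ w → δ w z) + - sum (λ w → e* 0 z * e* 0 w + h * e* 1 z * e* 1 w)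
          ≈⟨ +-cong (≈-trans (sum-cong-≋ {4} {λ w → δ w z} {δ z} λ w → δ-sym w z) (sum-δ-one z))
               (-‿cong (≈-trans (sum-linear (h * e* 1 z) (λ w → e* 0 z * e* 0 w) (e* 1))
                 (+-cong (≈-trans (≈-sym (*-distribˡ-sum (e* 0 z) (e* 0))) (*-congˡ sum-e*₀)) (*-congˡ sum-e*₁)))) ⟩
        1# + - (e* 0 z * 1# + h * e* 1 z * fromℕ 3)
          ≈⟨ solve 3 (λ s t h → k1 :+ :- (s :* k1 :+ h :* t :* k3) := k1 :+ :- (s :+ t :* (k3 :* h)))
              ≈-refl (e* 0 z) (e* 1 z) h ⟩
        1# + - (e* 0 z + e* 1 z * (fromℕ 3 * h))
          ≈⟨ +-congˡ (-‿cong (≈-trans (+-congˡ (≈-trans (*-congˡ 3h≈1) (*-identityʳ _))) (e*₀+e*₁ z))) ⟩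
        1# + - 1#  ≈⟨ -‿inverseʳ 1# ⟩
        0#         ∎)

  -- The entries at (x, x), (x, o 0) and (o 0, x) isolate the first three coefficients. E*₁ is
  -- diagonal, so the entry at (o 0, o 1) isolates the fourth; the entry at (o 0, o 0) is the sum of
  -- the last two.
  matrices-independent : LinearlyIndependent matrices
  matrices-independent c eq = λ
    { zero → at₀₀ ; (suc zero) → at₀₁ ; (suc (suc zero)) → at₁₀ ; (suc (suc (suc zero))) → at₁₂ ; (suc (suc (suc (suc zero)))) → at₁₁ }
    where
    c₀ = c zero
    c₁ = c (suc zero)
    c₂ = c (suc (suc zero))
    c₃ = c (suc (suc (suc zero)))
    c₄ = c (suc (suc (suc (suc zero))))
    F : Fin 4 → ℂ
    F k = fromℤ (table zero k)
    G : Fin 4 → ℂ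
    G k = fromℤ (table (suc zero) k)
    entry : ∀ k l → c₀ * (F k * F l) + (c₁ * (F k * G l) + (c₂ * (G k * F l) + (c₃ * (G k * G l)
              + (c₄ * (G k * δ (σ k) (σ l)) + 0#)))) ≈ 0#
    entry k l = ≈-trans (≈-sym (+-cong (*-congˡ (*-cong (f k) (f l))) (+-cong (*-congˡ (*-cong (f k) (g l)))
      (+-cong (*-congˡ (*-cong (g k) (f l))) (+-cong (*-congˡ (*-cong (g k) (g l)))
        (+-congʳ (*-congˡ (≈-trans (E*-entry 1 (σ k) (σ l)) (*-congʳ (g k)))))))))) (eq (σ k , σ l))
      where
      f = frame-σ zero
      g = frame-σ (suc zero)
    at₀₀ : c₀ ≈ 0#
    at₀₀ = ≈-trans (solve 6 (λ a b c d e t → a := a :* (k1 :* k1) :+ (b :* (k1 :* k0) :+ (c :* (k0 :* k1) :+ (d :* (k0 :* k0) :+ (e :* (k0 :* t) :+ k0)))))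
      ≈-refl c₀ c₁ c₂ c₃ c₄ (δ (σ zero) (σ zero))) (entry zero zero)
    at₀₁ : c₁ ≈ 0#
    at₀₁ = ≈-trans (solve 6 (λ a b c d e t → b := a :* (k1 :* k0) :+ (b :* (k1 :* k1) :+ (c :* (k0 :* k0) :+ (d :* (k0 :* k1) :+ (e :* (k0 :* t) :+ k0)))))
      ≈-refl c₀ c₁ c₂ c₃ c₄ (δ (σ zero) (σ (suc zero)))) (entry zero (suc zero))
    at₁₀ : c₂ ≈ 0#
    at₁₀ = begin
      c₂
        ≈⟨ solve 5 (λ a b c d e → c := a :* (k0 :* k1) :+ (b :* (k0 :* k0) :+ (c :* (k1 :* k1) :+ (d :* (k1 :* k0) :+ (e :* (k1 :* k0) :+ k0)))))
                                                    ≈-refl c₀ c₁ c₂ c₃ c₄ ⟩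
      c₀ * (0# * 1#) + (c₁ * (0# * 0#) + (c₂ * (1# * 1#) + (c₃ * (1# * 0#) + (c₄ * (1# * 0#) + 0#))))
        ≈⟨ +-congˡ (+-congˡ (+-congˡ (+-congˡ (+-congʳ (*-congˡ (*-congˡ (δ-≢ {y = σ (suc zero)} {z = x} λ eq → case σ-injective {suc zero} {zero} eq of λ ()))))))) ⟨
      c₀ * (0# * 1#) + (c₁ * (0# * 0#) + (c₂ * (1# * 1#) + (c₃ * (1# * 0#) + (c₄ * (1# * δ (σ (suc zero)) x) + 0#))))
        ≈⟨ entry (suc zero) zero ⟩
      0#                                       ∎
    at₁₂ : c₃ ≈ 0#
    at₁₂ = begin
      c₃
        ≈⟨ solve 5 (λ a b c d e → d := a :* (k0 :* k0) :+ (b :* (k0 :* k1) :+ (c :* (k1 :* k0) :+ (d :* (k1 :* k1) :+ (e :* (k1 :* k0) :+ k0)))))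
                                                    ≈-refl c₀ c₁ c₂ c₃ c₄ ⟩
      c₀ * (0# * 0#) + (c₁ * (0# * 1#) + (c₂ * (1# * 0#) + (c₃ * (1# * 1#) + (c₄ * (1# * 0#) + 0#))))
        ≈⟨ +-congˡ (+-congˡ (+-congˡ (+-congˡ (+-congʳ (*-congˡ (*-congˡ (δ-≢ {y = σ (suc zero)} {z = σ (suc (suc zero))} λ eq → case σ-injective {suc zero} {suc (suc zero)} eq of λ ()))))))) ⟨
      c₀ * (0# * 0#) + (c₁ * (0# * 1#) + (c₂ * (1# * 0#) + (c₃ * (1# * 1#) + (c₄ * (1# * δ (σ (suc zero)) (σ (suc (suc zero)))) + 0#))))
        ≈⟨ entry (suc zero) (suc (suc zero)) ⟩
      0#                                       ∎
    at₁₁ : c₄ ≈ 0#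
    at₁₁ = begin
      c₄
        ≈⟨ solve 5 (λ a b c d e → e := (a :* (k0 :* k0) :+ (b :* (k0 :* k1) :+ (c :* (k1 :* k0) :+ (d :* (k1 :* k1) :+ (e :* (k1 :* k1) :+ k0))))) :+ :- d)
                                                    ≈-refl c₀ c₁ c₂ c₃ c₄ ⟩
      c₀ * (0# * 0#) + (c₁ * (0# * 1#) + (c₂ * (1# * 0#) + (c₃ * (1# * 1#) + (c₄ * (1# * 1#) + 0#)))) + - c₃
        ≈⟨ +-cong (+-congˡ (+-congˡ (+-congˡ (+-congˡ (+-congʳ (*-congˡ (*-congˡ (≈-sym (δ-refl (σ (suc zero)))))))))))  (-‿cong at₁₂) ⟩
      c₀ * (0# * 0#) + (c₁ * (0# * 1#) + (c₂ * (1# * 0#) + (c₃ * (1# * 1#) + (c₄ * (1# * δ (σ (suc zero)) (σ (suc zero))) + 0#)))) + - 0#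
        ≈⟨ +-congʳ (entry (suc zero) (suc zero)) ⟩
      0# + - 0#                                ≈⟨ -‿inverseʳ 0# ⟩
      0#                                       ∎

  dimT : DimT 5
  dimT = matrices , (matrices∈T , matrices-span) , matrices-independent

  νₐ-part : HasEssentialPart o νₐ (1# ∷ -1# ∷ 0# ∷ [])
  νₐ-part = K₄-Data.typeII-pure x {νₐ} typeII-νₐ νₐ#0 , λ
    { zero → place-σ cₐ (suc zero) ; (suc zero) → place-σ cₐ (suc (suc zero)) ; (suc (suc zero)) → place-σ cₐ (suc (suc (suc zero))) }

  νᵦ-part : HasEssentialPart o νᵦ (1# ∷ 1# ∷ fromℤ (-[1+ 1 ]) ∷ [])
  νᵦ-part = K₄-Data.typeII-pure x {νᵦ} typeII-νᵦ νᵦ#0 , λ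
    { zero → place-σ cᵦ (suc zero) ; (suc zero) → place-σ cᵦ (suc (suc zero)) ; (suc (suc zero)) → place-σ cᵦ (suc (suc (suc zero))) }
mainTheorem1 : HasIntersectionArray K₄ (3 Vec.∷ Vec.[]) (1 Vec.∷ Vec.[])
    × (∀ (Γ : Graph 4) → HasIntersectionArray Γ (3 Vec.∷ Vec.[]) (1 Vec.∷ Vec.[]) → Γ ≅ᴳ K₄)
    × HasSpectrum (Graph.adjacency K₄) ((fromℕ 3 , 1) List.∷ (-1# , 3) List.∷ List.[])
    × (∀ (x : Fin 4) → let open Terwilliger K₄ x in
    (o : Ordering 1 3) →
    (Σ TModule λ W₀ → Σ TModule λ W₁ₐ → Σ TModule λ W₁ᵦ →
    Σ V λ νₐ → Σ V λ νᵦ →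
    let
    W : Vector TModule 3
    W = W₀ ∷ W₁ₐ ∷ W₁ᵦ ∷ []
    type : Vector Type 3
    type = I ∷ II ∷ II ∷ []
    in
    IsOrthogonalDirectSum W
    × (∀ i j → (W i ≅ W j) ⇔ (type i ≡ type j))
    × ModuleData W₀ 0 1 2 1 (1 Vec.∷ 1 Vec.∷ Vec.[])
    (e* 0 ∷ e* 1 ∷ [])
    ((fromℕ 0 ∷ fromℕ 3 ∷ []) ∷ (fromℕ 1 ∷ fromℕ 2 ∷ []) ∷ [])
    (fromℕ 3 List.∷ -1# List.∷ List.[])
    × HasEssentialPart o νₐ (1# ∷ -1# ∷ 0# ∷ [])
    × HasEssentialPart o νᵦ (1# ∷ 1# ∷ fromℤ (-[1+ 1 ]) ∷ [])
    × ModuleData W₁ₐ 1 2 1 0 (1 Vec.∷ Vec.[])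
    (νₐ ∷ []) ((-1# ∷ []) ∷ []) (-1# List.∷ List.[])
    × ModuleData W₁ᵦ 1 2 1 0 (1 Vec.∷ Vec.[])
    (νᵦ ∷ []) ((-1# ∷ []) ∷ []) (-1# List.∷ List.[])
    × IsSeed νₐ 1 W₁ₐ
    × IsSeed νᵦ 1 W₁ᵦ)
    × DimT 5
    × 2 ℕ.^ 2 ℕ.+ 1 ℕ.^ 2 ≡ 5)
mainTheorem1 =
    K₄-array
  , (λ Γ array → diameter-one⇒complete Γ (HasIntersectionArray.diam≡D array))
  , K₄-spectrum
  , λ x o →
      let open K₄-Modules x
          open K₄-Data x
          open K₄-Ordered x o
          open K₄-Algebra x o
      in ( W₀ , W₁ₐ , W₁ᵦ , νₐ , νᵦ
         , ⨁-summand , summand-≅ , W₀-data , νₐ-part , νᵦ-part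
         , line-data {νₐ} typeII-νₐ νₐ#0 , line-data {νᵦ} typeII-νᵦ νᵦ#0
         , line-seed {νₐ} typeII-νₐ νₐ#0 , line-seed {νᵦ} typeII-νᵦ νᵦ#0 )
       , dimT
       , refl
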